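{- There is an algorithm that, given any string $T$ of length $N \ge 1$ over an integer alphabet of size polynomially bounded in $N$, enumerates all maximal block palindromes that appear in $T$ in $O(N + \|\mathrm{MBP}(T)\|)$ time, where $\|\mathrm{MBP}(T)\|$ is the sum of the sizes of all maximal block palindromes in $T$ (the output size).
   Context: Model: standard word RAM with words of $\Theta(\log N)$ bits. In the output, each block of a maximal block palindrome is represented by its beginning and ending positions in $T$ ($O(1)$ words per block). Strings: $T[i\ldots j]$ is the substring of $T$ from position $i$ to position $j$ (positions are $1,\dots,N$); it is the empty string $\varepsilon$ if $j<i$. For non-integer multiples of $1/2$ the convention is $T[i\ldots j]=T[\lceil i\rceil\ldots\lfloor j\rfloor]$. Block palindrome: a block palindrome of a string $w$ is a factorization $f=f_{ -n}\cdots f_{ -1}f_0f_1\cdots f_n$ of $w$ ($n\ge 0$) in which $f_{ -i}=f_i$ is a non-empty string for every $1\le i\le n$, and the center block $f_0$ is a possibly empty string. The $f_i$ are called blocks. The length $|f|$ is the total length of the blocks; the size $\|f\|$ is the number of non-empty blocks. The largest block palindrome of $w$ is the (unique) block palindrome of $w$ with the largest number of non-empty blocks. Maximal block palindromes: let $c$ be a center position, i.e. an integer multiple of $1/2$ with $1\le c\le N$, and let $d\ge 1$ be an integer such that the range $T[c-d+1\ldots c+d-1]$ lies within $T$. Let $F_T(c,d)$ be the set of all factorizations $f=f_{ -n}\cdots f_0\cdots f_n$ such that $f_0$ is the occurrence $T[c-d+1\ldots c+d-1]$, $f$ is a factorization of the occurrence $T[c-d-k+1\ldots c+d+k-1]$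 (lying within $T$) with $k=|f_1\cdots f_n|$, and $f$ is the largest block palindrome of that substring. When $F_T(c,d)$ is non-empty, its element with the largest length $|f|$ (equivalently, with the largest number of blocks) is called a maximal block palindrome in $T$ (ones of size $0$, consisting only of an empty center block, are disregarded). $\mathrm{MBP}(T)$ is the set of all maximal block palindromes in $T$, over all such pairs $(c,d)$, regarded as occurrences (positions matter), and $\|\mathrm{MBP}(T)\|=\sum_{f\in \mathrm{MBP}(T)}\|f\|$. -}

module Defs where

open import Data.Bool using (Bool; true; false; not; if_then_else_; _∧_; _∨_; _xor_)
open import Data.List using (List; []; _∷_; _++_; _∷ʳ_; concat; concatMap; drop; filterᵇ; length; map; null; reverse; sum; take)
open import Data.List.Membership.Propositional using (_∈_)
open import Data.List.Relation.Unary.All using (All)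
open import Data.List.Relation.Unary.Unique.Propositional using (Unique)
open import Data.Maybe using (Maybe; just; nothing)
open import Data.Nat using (ℕ; zero; suc; _+_; _*_; _∸_; _^_; _≤_; _<ᵇ_; _≡ᵇ_; ⌊_/2⌋; ⌈_/2⌉; _/_; _%_)
open import Data.Nat.Logarithm using (⌊log₂_⌋)
open import Data.Nat.Properties using (m^n≢0)
open import Data.Product using (_×_; _,_; ∃-syntax)
open import Function using (_∘_; _⇔_)
open import Relation.Binary.PropositionalEquality using (_≡_; _≢_)

String : Set
String = List ℕ

-- Positions are 1-based.
_[_⋯_] : String → ℕ → ℕ → String
T [ i ⋯ j ] = take (suc j ∸ i) (drop (i ∸ 1) T)

-- Substrings with half-integer ends: the arguments are the doubled ends,
-- so this is T[i/2 … j/2] = T[⌈i/2⌉ … ⌊j/2⌋].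
_⟪_⋯_⟫ : String → ℕ → ℕ → String
T ⟪ i ⋯ j ⟫ = T [ ⌈ i /2⌉ ⋯ ⌊ j /2⌋ ]

Within : String → ℕ → ℕ → Set
Within T i j = 1 ≤ ⌈ i /2⌉ × ⌊ j /2⌋ ≤ length T

-- The doubled ends of the range c-d+1 … c+d-1, where c₂ = 2c.
-- When c-d+1 < 0 the truncated subtraction gives 0, which Within rejects.
lo hi : ℕ → ℕ → ℕ
lo c₂ d = c₂ + 2 ∸ 2 * d
hi c₂ d = c₂ + 2 * d ∸ 2

-- A factorization f₋ₙ ⋯ f₋₁ f₀ f₁ ⋯ fₙ with f₋ᵢ = fᵢ: center is f₀ and
-- arms is f₁ , … , fₙ (read outwards from the center).
record Factorization : Set where
  constructor factorization
  field
    center : String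
    arms   : List String

  blocks : List String
  blocks = reverse arms ++ center ∷ arms

  ∣_∣ : ℕ
  ∣_∣ = sum (map length blocks)

  size : ℕ
  size = length (filterᵇ (not ∘ null) blocks)

open Factorization public

record IsBlockPalindrome (w : String) (f : Factorization) : Set where
  field
    arms≢[] : All (_≢ []) (arms f)
    factors : concat (blocks f) ≡ w

IsLargestBlockPalindrome : String → Factorization → Set
IsLargestBlockPalindrome w f =
  IsBlockPalindrome w f × (∀ g → IsBlockPalindrome w g → size g ≤ size f)

-- A factorization of the occurrence of a substring beginning at position start.
record Occurrence : Set where
  constructor occurrence
  field
    start : ℕ
    fact  : Factorization

open Occurrence public

-- Membership in F_T(c,d). As k = |f₁⋯fₙ| = |f₋ₙ⋯f₋₁|, starting at
-- ⌈c-d-k+1⌉ places the center block at ⌈c-d+1⌉.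
record InF (T : String) (c₂ d : ℕ) (o : Occurrence) : Set where
  k : ℕ
  k = length (concat (arms (fact o)))

  field
    center≡ : center (fact o) ≡ T ⟪ lo c₂ d ⋯ hi c₂ d ⟫
    within  : Within T (lo c₂ (d + k)) (hi c₂ (d + k))
    start≡  : start o ≡ ⌈ lo c₂ (d + k) /2⌉
    largest : IsLargestBlockPalindrome (T ⟪ lo c₂ (d + k) ⋯ hi c₂ (d + k) ⟫) (fact o)

record IsMaximalAt (T : String) (c₂ d : ℕ) (o : Occurrence) : Set where
  field
    1≤c     : 2 ≤ c₂
    c≤N     : c₂ ≤ 2 * length T
    1≤d     : 1 ≤ d
    inRange : Within T (lo c₂ d) (hi c₂ d)
    inF     : InF T c₂ d o
    longest : ∀ o′ → InF T c₂ d o′ → ∣ fact o′ ∣ ≤ ∣ fact o ∣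
    size≢0  : size (fact o) ≢ 0

MBP : String → Occurrence → Set
MBP T o = ∃[ c₂ ] ∃[ d ] IsMaximalAt T c₂ d o

record Enumerates {A : Set} (L : List A) (P : A → Set) : Set where
  field
    unique : Unique L
    exact  : ∀ x → x ∈ L ⇔ P x

-- For an enumeration L of MBP(T) this is ‖MBP(T)‖.
totalSize : List Occurrence → ℕ
totalSize L = sum (map (size ∘ fact) L)

-- Beginning and ending positions of consecutive blocks, from position s on.
-- An empty center block at s is reported as (s , s - 1).
spans : ℕ → List String → List ℕ
spans s []       = []
spans s (b ∷ bs) = s ∷ s + length b ∸ 1 ∷ spans (s + length b) bs

-- Every position is at least 1, so 0 can serve as end marker.
encode : Occurrence → List ℕ
encode o = spans (start o) (blocks (fact o)) ∷ʳ 0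

encodeAll : List Occurrence → List ℕ
encodeAll = concatMap encode

-- Word RAM. Words are the naturals below 2 ^ w, w being the word size.

Word Reg Label : Set
Word  = ℕ
Reg   = ℕ
Label = ℕ

wrap : ℕ → ℕ → Word
wrap w x = _%_ x (2 ^ w) {{m^n≢0 2 w}}

data Op : Set where
  add sub mul div mod and or xor shl shr : Op

bit : Bool → ℕ
bit b = if b then 1 else 0

odd : ℕ → Bool
odd x = x % 2 ≡ᵇ 1

bitwise : (Bool → Bool → Bool) → ℕ → Word → Word → Word
bitwise f zero    x y = 0
bitwise f (suc w) x y = bit (f (odd x) (odd y)) + 2 * bitwise f w (x / 2) (y / 2)

evalOp : ℕ → Op → Word → Word → Word
evalOp w add x y       = wrap w (x + y)
evalOp w sub x y       = wrap w (x + 2 ^ w ∸ y)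
evalOp w mul x y       = wrap w (x * y)
evalOp w div x zero    = 0
evalOp w div x (suc y) = x / suc y
evalOp w mod x zero    = 0
evalOp w mod x (suc y) = x % suc y
evalOp w and x y       = bitwise _∧_ w x y
evalOp w or  x y       = bitwise _∨_ w x y
evalOp w xor x y       = bitwise _xor_ w x y
evalOp w shl x y       = wrap w (x * 2 ^ y)
evalOp w shr x y       = _/_ x (2 ^ y) {{m^n≢0 2 y}}

data Instr : Set where
  const  : Reg → ℕ → Instr
  move   : Reg → Reg → Instr
  op     : Op → Reg → Reg → Reg → Instr
  load   : Reg → Reg → Instr
  store  : Reg → Reg → Instr
  jump   : Label → Instr
  jumpLt : Reg → Reg → Label → Instr
  jumpEq : Reg → Reg → Label → Instr
  out    : Reg → Instr
  halt   : Instr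

Program : Set
Program = List Instr

record Config : Set where
  constructor config
  field
    pc   : Label
    regs : Reg → Word
    mem  : Word → Word
    outs : List Word

open Config public

_[_≔_] : (ℕ → ℕ) → ℕ → ℕ → ℕ → ℕ
(f [ i ≔ x ]) j = if i ≡ᵇ j then x else f j

exec : ℕ → Instr → Config → Maybe Config
exec w (const r n) (config p R M O)      = just (config (suc p) (R [ r ≔ wrap w n ]) M O)
exec w (move r a) (config p R M O)       = just (config (suc p) (R [ r ≔ R a ]) M O)
exec w (op o r a b) (config p R M O)     = just (config (suc p) (R [ r ≔ evalOp w o (R a) (R b) ]) M O)
exec w (load r a) (config p R M O)       = just (config (suc p) (R [ r ≔ M (R a) ]) M O)
exec w (store a r) (config p R M O)      = just (config (suc p) R (M [ R a ≔ R r ]) O)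
exec w (jump l) (config p R M O)         = just (config l R M O)
exec w (jumpLt a b l) (config p R M O)   = just (config (if R a <ᵇ R b then l else suc p) R M O)
exec w (jumpEq a b l) (config p R M O)   = just (config (if R a ≡ᵇ R b then l else suc p) R M O)
exec w (out r) (config p R M O)          = just (config (suc p) R M (O ∷ʳ R r))
exec w halt _                            = nothing

fetch : Program → Label → Instr
fetch []      _       = halt
fetch (i ∷ P) zero    = i
fetch (i ∷ P) (suc p) = fetch P p

step : ℕ → Program → Config → Maybe Config
step w P s = exec w (fetch P (pc s)) s

-- Halts w P s t O: from s, program P halts after t steps with output O.
data Halts (w : ℕ) (P : Program) : Config → ℕ → List Word → Set where
  done : ∀ {s} → step w P s ≡ nothing → Halts w P s 0 (outs s)
  next : ∀ {s s′ t O} → step w P s ≡ just s′ → Halts w P s′ t O → Halts w P s (suc t) O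

cells : ℕ → List ℕ → ℕ → Word
cells w []      _       = 0
cells w (x ∷ _) zero    = wrap w x
cells w (_ ∷ T) (suc i) = cells w T i

-- Register 0 holds N = |T| and memory cell i holds T[i] for 1 ≤ i ≤ N;
-- all other registers and cells are 0.
initial : ℕ → String → Config
initial w T = config 0 ((λ _ → 0) [ 0 ≔ wrap w (length T) ]) mem₀ []
  where
  mem₀ : ℕ → Word
  mem₀ zero    = 0
  mem₀ (suc i) = cells w T i

-- Number of binary digits of N ≥ 1: a form of log N that is never 0.
bits : ℕ → ℕ
bits N = suc ⌊log₂ N ⌋

{-# OPTIONS --safe #-}
-- Every non-empty substring of T has exactly one largest block palindrome, obtained by splitting
-- off shortest borders, and dropping its outermost blocks gives all shorter elements of the same
-- F_T(c,d). So the maximal block palindromes partition the N(N+1)/2 substrings into chains whose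
-- lengths are bounded by their sizes, and ‖MBP(T)‖ is at least quadratic in N: the program may
-- spend O(N²) time. It runs Knuth–Morris–Pratt on every suffix to tabulate the shortest border of
-- every substring, stores with each substring the length of its (unique) extension by two equal
-- blocks, and finally, from each substring that has no extension, walks inwards along the shortest
-- borders and outwards again along the extensions.
module Submission where

-- Why shortest borders: the shortest non-empty border `v` of a string is itself unbordered, so its
-- two occurrences are disjoint. An outer block `u` longer than `v` has `v` as a border, and again
-- without overlap, so `u` is `v z v` for some possibly empty `z` and can be split further, which
-- yields strictly more blocks. Why extensions are unique: if one substring had extensions of two
-- lengths, the shorter arm would be a non-empty proper border of the longer arm. Hence the step
-- outwards is a function, chains do not branch, and one table entry per substring lets the program
-- retrace a chain without a stack. The same fact makes any two chains with a common centre
-- comparable, which is what identifies the members of one F_T(c,d) with an initial part of a single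
-- chain. Empty substrings (`i = suc s`) occur as centres of chains but are left out of the count
-- N(N+1)/2. The tables need quadratically many addresses and the letters are bounded by
-- `m * N ^ k`; both fit into words because the constant factor in the word size may be chosen in
-- terms of `m` and `k`.

open import Defs
open import Data.Bool using (Bool; true; false; T; _∧_; _∨_; if_then_else_)
open import Data.Empty using (⊥; ⊥-elim)
open import Data.Fin using (Fin; zero; suc; toℕ)
import Data.Fin as Fin
open import Data.Fin.Patterns
open import Data.Fin.Properties using (toℕ<n; toℕ-injective)
open import Data.List using (List; []; _∷_; _++_; _∷ʳ_; allFin; concat; concatMap; drop; filterᵇ; initLast; length; map; reverse; take; upTo; _∷ʳ′_)
open import Data.List.Membership.Propositional using (_∈_)
open import Data.List.Membership.Propositional.Properties using (∈-++⁺ˡ; ∈-++⁺ʳ; ∈-++⁻; ∈-map⁺; ∈-map⁻; ∈-upTo⁻; ∈-∃++)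
open import Data.List.Properties using (∷-injective; ∷-injectiveˡ; ∷-injectiveʳ; ++-assoc; ++-cancelʳ; ++-identityʳ; concat-++; concatMap-++; drop-drop; length-++; length-drop; length-map; length-take; length-upTo; map-++; reverse-++)
open import Data.List.Relation.Unary.All using (All; []; _∷_)
import Data.List.Relation.Unary.All as All
import Data.List.Relation.Unary.All.Properties as All
open import Data.List.Relation.Unary.AllPairs using (AllPairs; []; _∷_)
import Data.List.Relation.Unary.AllPairs as AllPairs
import Data.List.Relation.Unary.AllPairs.Properties as AllPairs
open import Data.List.Relation.Unary.Any using (here; there)
open import Data.List.Relation.Unary.Unique.Propositional using (Unique)
import Data.List.Relation.Unary.Unique.Propositional.Properties as Unique
open import Data.Maybe using (just; nothing)
open import Data.Nat
open import Data.Nat.DivMod using (m<n⇒m%n≡m; [m+n]%n≡m%n)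
open import Data.Nat.ListAction using (sum)
open import Data.Nat.ListAction.Properties using (sum-++)
open import Data.Nat.Logarithm using (⌊log₂_⌋; ⌊log₂⌋-mono-≤; ⌊log₂[2^n]⌋≡n)
open import Data.Nat.Properties
open import Data.Nat.Tactic.RingSolver using (solve-∀)
open import Data.Product using (_×_; _,_; proj₁; proj₂; ∃-syntax)
open import Data.Product.Properties using (,-injectiveˡ; ,-injectiveʳ)
open import Data.Sum using (_⊎_; inj₁; inj₂)
open import Data.Unit using (⊤; tt)
open import Data.Vec using (Vec; []; _∷_; lookup; replicate; zipWith; _[_]≔_)
import Data.Vec as Vec
open import Data.Vec.N-ary using (N-ary; ∀ⁿ; curryⁿ; _$ⁿ_)
open import Data.Vec.Properties using (lookup∘updateAt; lookup∘updateAt′)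
open import Function using (mk⇔)
open import Relation.Binary.Definitions using (tri<; tri≈; tri>)
open import Relation.Binary.PropositionalEquality using (_≡_; _≢_; refl; sym; trans; cong; cong₂; subst; subst₂; module ≡-Reasoning)
open import Relation.Nullary using (¬_; yes; no; contradiction)

-- Linear arithmetic over ℕ, decided by Fourier–Motzkin elimination

infixl 6 _⊞_
infixl 7 _⊠_
infix 4 _≼_ _≺_ _≊_
infixr 3 _⇛_

data Term (n : ℕ) : Set where
  var : Fin n → Term n
  con : ℕ → Term n
  _⊞_ : Term n → Term n → Term n
  _⊠_ : ℕ → Term n → Term n

data Fact (n : ℕ) : Set where
  _≼_ _≊_ : Term n → Term n → Fact n

_≺_ : ∀ {n} → Term n → Term n → Fact n
s ≺ t = con 1 ⊞ s ≼ t

data Sequent (n : ℕ) : Set where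
  goal  : Fact n → Sequent n
  absurd : Sequent n
  _⇛_   : Fact n → Sequent n → Sequent n

module _ {n : ℕ} (ρ : Vec ℕ n) where

  ⟦_⟧ᵗ : Term n → ℕ
  ⟦ var x ⟧ᵗ = lookup ρ x
  ⟦ con c ⟧ᵗ = c
  ⟦ s ⊞ t ⟧ᵗ = ⟦ s ⟧ᵗ + ⟦ t ⟧ᵗ
  ⟦ c ⊠ t ⟧ᵗ = c * ⟦ t ⟧ᵗ

  ⟦_⟧ᶠ : Fact n → Set
  ⟦ s ≼ t ⟧ᶠ = ⟦ s ⟧ᵗ ≤ ⟦ t ⟧ᵗ
  ⟦ s ≊ t ⟧ᶠ = ⟦ s ⟧ᵗ ≡ ⟦ t ⟧ᵗ

  ⟦_⟧ˢ : Sequent n → Set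
  ⟦ goal f ⟧ˢ = ⟦ f ⟧ᶠ
  ⟦ absurd ⟧ˢ = ⊥
  ⟦ f ⇛ s ⟧ˢ  = ⟦ f ⟧ᶠ → ⟦ s ⟧ˢ

-- An inequality is kept as two vectors of natural coefficients, one for each side, so that no
-- negative numbers arise. The first coordinate has the value 1 and carries the constant term.
Row : ℕ → Set
Row m = Vec ℕ m × Vec ℕ m

dot : ∀ {m} → Vec ℕ m → Vec ℕ m → ℕ
dot []       []       = 0
dot (a ∷ as) (x ∷ xs) = a * x + dot as xs

Holds : ∀ {m} → Vec ℕ m → Row m → Set
Holds σ (l , r) = dot l σ ≤ dot r σ

dot-+ : ∀ {m} (a b σ : Vec ℕ m) → dot (zipWith _+_ a b) σ ≡ dot a σ + dot b σ
dot-+ []       []       []       = refl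
dot-+ (a ∷ as) (b ∷ bs) (x ∷ σ) rewrite dot-+ as bs σ = lemma a b x (dot as σ) (dot bs σ)
  where
  lemma : ∀ a b x p q → (a + b) * x + (p + q) ≡ a * x + p + (b * x + q)
  lemma = solve-∀

dot-* : ∀ {m} c (a σ : Vec ℕ m) → dot (Vec.map (c *_) a) σ ≡ c * dot a σ
dot-* c []       []      = sym (*-zeroʳ c)
dot-* c (a ∷ as) (x ∷ σ) rewrite dot-* c as σ = lemma c a x (dot as σ)
  where
  lemma : ∀ c a x p → c * a * x + c * p ≡ c * (a * x + p)
  lemma = solve-∀

dot-0 : ∀ {m} (σ : Vec ℕ m) → dot (replicate m 0) σ ≡ 0
dot-0 []      = refl
dot-0 (x ∷ σ) = dot-0 σ

dot-unit : ∀ {m} (x : Fin m) (σ : Vec ℕ m) → dot (replicate m 0 [ x ]≔ 1) σ ≡ lookup σ x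
dot-unit zero    (y ∷ σ) rewrite dot-0 σ = trans (+-identityʳ _) (*-identityˡ y)
dot-unit (suc x) (y ∷ σ) = dot-unit x σ

coefficients : ∀ {n} → Term n → Vec ℕ (suc n)
coefficients (var x) = 0 ∷ (replicate _ 0 [ x ]≔ 1)
coefficients (con c) = c ∷ replicate _ 0
coefficients (s ⊞ t) = zipWith _+_ (coefficients s) (coefficients t)
coefficients (c ⊠ t) = Vec.map (c *_) (coefficients t)

dot-coefficients : ∀ {n} (t : Term n) ρ → dot (coefficients t) (1 ∷ ρ) ≡ ⟦ ρ ⟧ᵗ t
dot-coefficients (var x) ρ = dot-unit x ρ
dot-coefficients (con c) ρ rewrite dot-0 ρ = trans (+-identityʳ _) (*-identityʳ c)
dot-coefficients (s ⊞ t) ρ =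
  trans (dot-+ (coefficients s) (coefficients t) (1 ∷ ρ)) (cong₂ _+_ (dot-coefficients s ρ) (dot-coefficients t ρ))
dot-coefficients (c ⊠ t) ρ =
  trans (dot-* c (coefficients t) (1 ∷ ρ)) (cong (c *_) (dot-coefficients t ρ))

cancel : ∀ {m} → Row m → Row m
cancel (l , r) = zipWith _∸_ l r , zipWith _∸_ r l

m⊔n≡m+n∸m : ∀ m n → m ⊔ n ≡ m + (n ∸ m)
m⊔n≡m+n∸m zero    n       = refl
m⊔n≡m+n∸m (suc m) zero    = sym (+-identityʳ _)
m⊔n≡m+n∸m (suc m) (suc n) = cong suc (m⊔n≡m+n∸m m n)

-- Both sides are the product with the pointwise maximum of `l` and `r`. This replaces the truncated
-- subtractions in `cancel` by additions on both sides.
dot-⊔ : ∀ {m} (l r σ : Vec ℕ m) →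
        dot r σ + dot (zipWith _∸_ l r) σ ≡ dot l σ + dot (zipWith _∸_ r l) σ
dot-⊔ []      []      []      = refl
dot-⊔ (a ∷ l) (b ∷ r) (x ∷ σ) = begin
  b * x + dot r σ + ((a ∸ b) * x + dot (zipWith _∸_ l r) σ) ≡⟨ lemma b (a ∸ b) x (dot r σ) _ ⟩
  (b + (a ∸ b)) * x + (dot r σ + dot (zipWith _∸_ l r) σ)   ≡⟨ cong₂ (λ u v → u * x + v) ⊔-swap (dot-⊔ l r σ) ⟩
  (a + (b ∸ a)) * x + (dot l σ + dot (zipWith _∸_ r l) σ)   ≡⟨ lemma a (b ∸ a) x (dot l σ) _ ⟨
  a * x + dot l σ + ((b ∸ a) * x + dot (zipWith _∸_ r l) σ) ∎
  where
  open ≡-Reasoning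
  lemma : ∀ b c x p q → b * x + p + (c * x + q) ≡ (b + c) * x + (p + q)
  lemma = solve-∀
  ⊔-swap : b + (a ∸ b) ≡ a + (b ∸ a)
  ⊔-swap = trans (sym (m⊔n≡m+n∸m b a)) (trans (⊔-comm b a) (m⊔n≡m+n∸m a b))

cancel-sound : ∀ {m} (σ : Vec ℕ m) row → Holds σ row → Holds σ (cancel row)
cancel-sound σ (l , r) l≤r = +-cancelˡ-≤ (dot r σ) _ _
  (≤-trans (≤-reflexive (dot-⊔ l r σ)) (+-monoˡ-≤ (dot (zipWith _∸_ r l) σ) l≤r))

combine : ∀ {m} → ℕ → Row m → ℕ → Row m → Row m
combine c (l , r) d (l′ , r′) =
  zipWith _+_ (Vec.map (c *_) l) (Vec.map (d *_) l′) , zipWith _+_ (Vec.map (c *_) r) (Vec.map (d *_) r′)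

dot-combine : ∀ {m} c d (a b σ : Vec ℕ m) →
              dot (zipWith _+_ (Vec.map (c *_) a) (Vec.map (d *_) b)) σ ≡ c * dot a σ + d * dot b σ
dot-combine c d a b σ =
  trans (dot-+ (Vec.map (c *_) a) (Vec.map (d *_) b) σ) (cong₂ _+_ (dot-* c a σ) (dot-* d b σ))

combine-sound : ∀ {m} (σ : Vec ℕ m) c row d row′ → Holds σ row → Holds σ row′ → Holds σ (combine c row d row′)
combine-sound σ c (l , r) d (l′ , r′) h h′ = subst₂ _≤_
  (sym (dot-combine c d l l′ σ)) (sym (dot-combine c d r r′ σ))
  (+-mono-≤ (*-monoʳ-≤ c h) (*-monoʳ-≤ d h′))

-- `p` has `x` on the left and bounds it from above; the rows with `x` on the right bound it from
-- below. Rows are kept cancelled, so the crosswise multiples give `x` the same coefficient on both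
-- sides and `cancel` removes it.
meet : ∀ {m} → Fin m → Row m → List (Row m) → List (Row m)
meet x p []         = []
meet x p (q ∷ rows) with lookup (proj₂ q) x
... | zero  = meet x p rows
... | suc c = cancel (combine (suc c) p (lookup (proj₁ p) x) q) ∷ meet x p rows

meet-sound : ∀ {m} (σ : Vec ℕ m) x p rows → Holds σ p → All (Holds σ) rows → All (Holds σ) (meet x p rows)
meet-sound σ x p []         hp []         = []
meet-sound σ x p (q ∷ rows) hp (hq ∷ hs) with lookup (proj₂ q) x
... | zero  = meet-sound σ x p rows hp hs
... | suc c = cancel-sound σ (combine (suc c) p (lookup (proj₁ p) x) q) (combine-sound σ (suc c) p (lookup (proj₁ p) x) q hp hq) ∷ meet-sound σ x p rows hp hs

-- Lower bounds of `x` are dropped from the result because each of them has already been combined,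
-- through `all`, with every upper bound.
eliminate : ∀ {m} → Fin m → List (Row m) → List (Row m) → List (Row m)
eliminate x all []         = []
eliminate x all (p ∷ rows) with lookup (proj₁ p) x | lookup (proj₂ p) x
... | suc _ | _     = meet x p all ++ eliminate x all rows
... | zero  | suc _ = eliminate x all rows
... | zero  | zero  = p ∷ eliminate x all rows

eliminate-sound : ∀ {m} (σ : Vec ℕ m) x all rows → All (Holds σ) all → All (Holds σ) rows →
                  All (Holds σ) (eliminate x all rows)
eliminate-sound σ x all []         ha []        = []
eliminate-sound σ x all (p ∷ rows) ha (hp ∷ hs) with lookup (proj₁ p) x | lookup (proj₂ p) x
... | suc _ | _     = All.++⁺ (meet-sound σ x p all hp ha) (eliminate-sound σ x all rows ha hs)
... | zero  | suc _ = eliminate-sound σ x all rows ha hs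
... | zero  | zero  = hp ∷ eliminate-sound σ x all rows ha hs

allZero : ∀ {m} → Vec ℕ m → Bool
allZero []          = true
allZero (zero ∷ v)  = allZero v
allZero (suc _ ∷ v) = false

allZero-sound : ∀ {m} (v σ : Vec ℕ m) → T (allZero v) → dot v σ ≡ 0
allZero-sound []         []      _ = refl
allZero-sound (zero ∷ v) (x ∷ σ) h = allZero-sound v σ h

-- A positive constant on the left against nothing on the right is false whatever the other left
-- coefficients are, since the variables are natural numbers.
contradictory : ∀ {n} → Row (suc n) → Bool
contradictory (zero  ∷ l , _ ∷ r)    = false
contradictory (suc _ ∷ l , suc _ ∷ r) = false
contradictory (suc _ ∷ l , zero ∷ r) = allZero r

contradictory-sound : ∀ {n} (ρ : Vec ℕ n) row → T (contradictory row) → Holds (1 ∷ ρ) row → ⊥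
contradictory-sound ρ (suc c ∷ l , zero ∷ r) z h rewrite allZero-sound r ρ z with () ← h

refute₀ : ∀ {n} → List (Row (suc n)) → Bool
refute₀ []         = false
refute₀ (r ∷ rows) = contradictory r ∨ refute₀ rows

refute₀-sound : ∀ {n} (ρ : Vec ℕ n) rows → T (refute₀ rows) → All (Holds (1 ∷ ρ)) rows → ⊥
refute₀-sound ρ (r ∷ rows) c (h ∷ hs) with contradictory r in eq
... | true  = contradictory-sound ρ r (subst T (sym eq) tt) h
... | false = refute₀-sound ρ rows c hs

nonneg : ∀ {m} → Fin m → Row m
nonneg x = replicate _ 0 , replicate _ 0 [ x ]≔ 1

nonneg-sound : ∀ {m} (σ : Vec ℕ m) x → Holds σ (nonneg x)
nonneg-sound σ x = ≤-trans (≤-reflexive (dot-0 σ)) z≤n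

refute : ∀ {n} → List (Fin (suc n)) → List (Row (suc n)) → Bool
refute []       rows = refute₀ rows
-- Over ℕ every variable has the additional lower bound 0, with which its upper bounds must also be
-- combined.
refute (x ∷ xs) rows = refute xs (eliminate x (nonneg x ∷ rows) (nonneg x ∷ rows))

refute-sound : ∀ {n} (ρ : Vec ℕ n) xs rows → T (refute xs rows) → All (Holds (1 ∷ ρ)) rows → ⊥
refute-sound ρ []       rows c hs = refute₀-sound ρ rows c hs
refute-sound ρ (x ∷ xs) rows c hs =
  refute-sound ρ xs _ c (eliminate-sound (1 ∷ ρ) x (nonneg x ∷ rows) (nonneg x ∷ rows) hs′ hs′)
  where
  hs′ : All (Holds (1 ∷ ρ)) (nonneg x ∷ rows)
  hs′ = nonneg-sound (1 ∷ ρ) x ∷ hs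

row≤ : ∀ {n} → Term n → Term n → Row (suc n)
row≤ s t = cancel (coefficients s , coefficients t)

row≤-sound : ∀ {n} (ρ : Vec ℕ n) s t → ⟦ ρ ⟧ᵗ s ≤ ⟦ ρ ⟧ᵗ t → Holds (1 ∷ ρ) (row≤ s t)
row≤-sound ρ s t h = cancel-sound (1 ∷ ρ) (coefficients s , coefficients t)
  (subst₂ _≤_ (sym (dot-coefficients s ρ)) (sym (dot-coefficients t ρ)) h)

variables : ∀ n → List (Fin (suc n))
variables n = map suc (allFin n)

valid : ∀ {n} → List (Row (suc n)) → Sequent n → Bool
valid rows (goal (s ≼ t)) = refute (variables _) (row≤ (con 1 ⊞ t) s ∷ rows)
valid rows (goal (s ≊ t)) = valid rows (goal (s ≼ t)) ∧ valid rows (goal (t ≼ s))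
valid rows absurd         = refute (variables _) rows
valid rows (s ≼ t ⇛ f)    = valid (row≤ s t ∷ rows) f
valid rows (s ≊ t ⇛ f)    = valid (row≤ s t ∷ row≤ t s ∷ rows) f

valid-≤ : ∀ {n} (ρ : Vec ℕ n) rows s t → T (valid rows (goal (s ≼ t))) → All (Holds (1 ∷ ρ)) rows →
          ⟦ ρ ⟧ᵗ s ≤ ⟦ ρ ⟧ᵗ t
valid-≤ ρ rows s t v hs with ⟦ ρ ⟧ᵗ s ≤? ⟦ ρ ⟧ᵗ t
... | yes h = h
... | no ¬h = ⊥-elim (refute-sound ρ (variables _) _ v (row≤-sound ρ (con 1 ⊞ t) s (≰⇒> ¬h) ∷ hs))

T-∧ : ∀ {a b} → T (a ∧ b) → T a × T b
T-∧ {true} {true} _ = tt , tt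

valid-sound : ∀ {n} (ρ : Vec ℕ n) rows f → T (valid rows f) → All (Holds (1 ∷ ρ)) rows → ⟦ ρ ⟧ˢ f
valid-sound ρ rows (goal (s ≼ t)) v hs = valid-≤ ρ rows s t v hs
valid-sound ρ rows (goal (s ≊ t)) v hs with v₁ , v₂ ← T-∧ v =
  ≤-antisym (valid-≤ ρ rows s t v₁ hs) (valid-≤ ρ rows t s v₂ hs)
valid-sound ρ rows absurd         v hs = refute-sound ρ (variables _) rows v hs
valid-sound ρ rows (s ≼ t ⇛ f)    v hs h = valid-sound ρ _ f v (row≤-sound ρ s t h ∷ hs)
valid-sound ρ rows (s ≊ t ⇛ f)    v hs h = valid-sound ρ _ f v
  (row≤-sound ρ s t (≤-reflexive h) ∷ row≤-sound ρ t s (≤-reflexive (sym h)) ∷ hs)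

close : ∀ {A : Set} n → N-ary n (Term n) A → A
close n f = f $ⁿ Vec.map var (Vec.allFin n)

∀ⁿ-curry : ∀ n (P : Vec ℕ n → Set) → (∀ ρ → P ρ) → ∀ⁿ n (curryⁿ P)
∀ⁿ-curry zero    P h = h []
∀ⁿ-curry (suc n) P h = λ x → ∀ⁿ-curry n (λ ρ → P (x ∷ ρ)) (λ ρ → h (x ∷ ρ))

-- The hidden argument has type `⊤` exactly when the elimination finds a contradiction, so the
-- search runs during type checking and leaves nothing to prove at the call.
linear : ∀ n (f : N-ary n (Term n) (Sequent n)) {_ : T (valid [] (close n f))} →
         ∀ⁿ n (curryⁿ λ ρ → ⟦ ρ ⟧ˢ (close n f))
linear n f {v} = ∀ⁿ-curry n _ (λ ρ → valid-sound ρ [] (close n f) v [])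

-- A structured language and its compilation to the word RAM

infixl 6 _⊕_ _⊖_
infixl 7 _⊗_
infix 4 _:=_ _*:=_
infixr 2 _⨾_
infix 3 ifₜ_then_else_ while_repeat_

data Exp (v : ℕ) : Set where
  ‵_      : Fin v → Exp v
  #_      : ℕ → Exp v
  _⊕_ _⊖_ : Exp v → Exp v → Exp v
  _⊗_     : Exp v → Exp v → Exp v
  !_      : Exp v → Exp v

infix 8 ‵_ #_
infix 8 !_

data Test (v : ℕ) : Set where
  _≺ₜ_ _≡ₜ_ : Exp v → Exp v → Test v

infix 5 _≺ₜ_ _≡ₜ_

data Cmd (v : ℕ) : Set where
  _:=_            : Fin v → Exp v → Cmd v
  _*:=_           : Exp v → Exp v → Cmd v
  emit            : Exp v → Cmd v
  _⨾_             : Cmd v → Cmd v → Cmd v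
  ifₜ_then_else_  : Test v → Cmd v → Cmd v → Cmd v
  while_repeat_   : Test v → Cmd v → Cmd v

record State (v : ℕ) : Set where
  constructor ⟨_,_,_⟩
  field
    env    : Vec ℕ v
    memory : ℕ → ℕ
    output : List ℕ

open State

module _ {v : ℕ} (ρ : Vec ℕ v) (M : ℕ → ℕ) where

  ⟦_⟧ : Exp v → ℕ
  ⟦ ‵ x ⟧   = lookup ρ x
  ⟦ # c ⟧   = c
  ⟦ a ⊕ b ⟧ = ⟦ a ⟧ + ⟦ b ⟧
  ⟦ a ⊖ b ⟧ = ⟦ a ⟧ ∸ ⟦ b ⟧
  ⟦ a ⊗ b ⟧ = ⟦ a ⟧ * ⟦ b ⟧
  ⟦ ! a ⟧   = M ⟦ a ⟧

  ⟦_⟧ₜ : Test v → Bool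
  ⟦ a ≺ₜ b ⟧ₜ = ⟦ a ⟧ <ᵇ ⟦ b ⟧
  ⟦ a ≡ₜ b ⟧ₜ = ⟦ a ⟧ ≡ᵇ ⟦ b ⟧

  -- All intermediate values are words below W, so that the machine computes the value over ℕ.
  Fits : ℕ → Exp v → Set
  Fits W (‵ x)   = ⊤
  Fits W (# c)   = c < W
  Fits W (a ⊕ b) = Fits W a × Fits W b × ⟦ a ⟧ + ⟦ b ⟧ < W
  Fits W (a ⊖ b) = Fits W a × Fits W b × ⟦ b ⟧ ≤ ⟦ a ⟧ × ⟦ a ⟧ < W
  Fits W (a ⊗ b) = Fits W a × Fits W b × ⟦ a ⟧ * ⟦ b ⟧ < W
  Fits W (! a)   = Fits W a

  Fitsₜ : ℕ → Test v → Set
  Fitsₜ W (a ≺ₜ b) = Fits W a × Fits W b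
  Fitsₜ W (a ≡ₜ b) = Fits W a × Fits W b

-- A record instead of the bare equation, so that the instruction list and the length can be
-- recovered by unification; `Fit`, `Agrees` and `Run` are wrapped for the same reason.
record HasLength (is : List Instr) (n : ℕ) : Set where
  constructor has-length
  field
    length≡ : length is ≡ n

one-long : ∀ {i} → HasLength (i ∷ []) 1
one-long = has-length refl

infixr 5 _⁺⁺_

_⁺⁺_ : ∀ {is js m n} → HasLength is m → HasLength js n → HasLength (is ++ js) (m + n)
_⁺⁺_ {is} (has-length p) (has-length q) = has-length (trans (length-++ is) (cong₂ _+_ p q))

At : Program → Label → List Instr → Set
At P p []       = ⊤
At P p (i ∷ is) = fetch P p ≡ i × At P (suc p) is

record Fit {v : ℕ} (ρ : Vec ℕ v) (M : ℕ → ℕ) (W : ℕ) (e : Exp v) : Set where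
  constructor fit
  field
    fits : Fits ρ M W e

module _ {v : ℕ} where

  ‖_‖ : Exp v → ℕ
  ‖ ‵ x ‖   = 1
  ‖ # c ‖   = 1
  ‖ a ⊕ b ‖ = ‖ a ‖ + (‖ b ‖ + 1)
  ‖ a ⊖ b ‖ = ‖ a ‖ + (‖ b ‖ + 1)
  ‖ a ⊗ b ‖ = ‖ a ‖ + (‖ b ‖ + 1)
  ‖ ! a ‖   = ‖ a ‖ + 1

  ‖_‖ₜ : Test v → ℕ
  ‖ a ≺ₜ b ‖ₜ = ‖ a ‖ + (‖ b ‖ + 1)
  ‖ a ≡ₜ b ‖ₜ = ‖ a ‖ + (‖ b ‖ + 1)

  len : Cmd v → ℕ
  len (x := e)               = ‖ e ‖ + 1
  len (a *:= e)              = ‖ a ‖ + (‖ e ‖ + 1)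
  len (emit e)               = ‖ e ‖ + 1
  len (c ⨾ d)                = len c + len d
  len (ifₜ t then c else d)  = ‖ t ‖ₜ + (len d + (1 + len c))
  len (while t repeat c)        = ‖ t ‖ₜ + (1 + (len c + 1))

  -- Registers below v hold the variables, the others serve as an evaluation stack from r on.
  codeₑ : Reg → Exp v → List Instr
  codeₑ r (‵ x)   = move r (toℕ x) ∷ []
  codeₑ r (# c)   = const r c ∷ []
  codeₑ r (a ⊕ b) = codeₑ r a ++ codeₑ (suc r) b ++ op add r r (suc r) ∷ []
  codeₑ r (a ⊖ b) = codeₑ r a ++ codeₑ (suc r) b ++ op sub r r (suc r) ∷ []
  codeₑ r (a ⊗ b) = codeₑ r a ++ codeₑ (suc r) b ++ op mul r r (suc r) ∷ []
  codeₑ r (! a)   = codeₑ r a ++ load r r ∷ []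

  codeₜ : Label → Test v → List Instr
  codeₜ l (a ≺ₜ b) = codeₑ v a ++ codeₑ (suc v) b ++ jumpLt v (suc v) l ∷ []
  codeₜ l (a ≡ₜ b) = codeₑ v a ++ codeₑ (suc v) b ++ jumpEq v (suc v) l ∷ []

  -- Jump targets are absolute, hence the dependence on the address `p`. A test jumps when it holds:
  -- the else-branch therefore comes first, followed by a jump over the then-branch, and in a loop
  -- the test jumps over the exit jump into the body.
  code : Label → Cmd v → List Instr
  code p (x := e)  = codeₑ v e ++ move (toℕ x) v ∷ []
  code p (a *:= e) = codeₑ v a ++ codeₑ (suc v) e ++ store v (suc v) ∷ []
  code p (emit e)  = codeₑ v e ++ out v ∷ []
  code p (c ⨾ d)   = code p c ++ code (p + len c) d
  code p (ifₜ t then c else d) =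
    codeₜ (p + ‖ t ‖ₜ + len d + 1) t ++
    code (p + ‖ t ‖ₜ) d ++ jump (p + len (ifₜ t then c else d)) ∷
    code (p + ‖ t ‖ₜ + len d + 1) c
  code p (while t repeat c) =
    codeₜ (p + ‖ t ‖ₜ + 1) t ++ jump (p + len (while t repeat c)) ∷ code (p + ‖ t ‖ₜ + 1) c ++ jump p ∷ []

  length-codeₑ : ∀ r e → HasLength (codeₑ r e) ‖ e ‖
  length-codeₑ r (‵ x)   = one-long
  length-codeₑ r (# c)   = one-long
  length-codeₑ r (a ⊕ b) = length-codeₑ r a ⁺⁺ (length-codeₑ (suc r) b ⁺⁺ one-long)
  length-codeₑ r (a ⊖ b) = length-codeₑ r a ⁺⁺ (length-codeₑ (suc r) b ⁺⁺ one-long)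
  length-codeₑ r (a ⊗ b) = length-codeₑ r a ⁺⁺ (length-codeₑ (suc r) b ⁺⁺ one-long)
  length-codeₑ r (! a)   = length-codeₑ r a ⁺⁺ one-long

  length-codeₜ : ∀ l t → HasLength (codeₜ l t) ‖ t ‖ₜ
  length-codeₜ l (a ≺ₜ b) = length-codeₑ v a ⁺⁺ (length-codeₑ (suc v) b ⁺⁺ one-long)
  length-codeₜ l (a ≡ₜ b) = length-codeₑ v a ⁺⁺ (length-codeₑ (suc v) b ⁺⁺ one-long)

  length-code : ∀ p c → HasLength (code p c) (len c)
  length-code p (x := e)  = length-codeₑ v e ⁺⁺ one-long
  length-code p (a *:= e) = length-codeₑ v a ⁺⁺ (length-codeₑ (suc v) e ⁺⁺ one-long)
  length-code p (emit e)  = length-codeₑ v e ⁺⁺ one-long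
  length-code p (c ⨾ d)   = length-code p c ⁺⁺ length-code _ d
  length-code p (ifₜ t then c else d) = length-codeₜ _ t ⁺⁺ (length-code _ d ⁺⁺ (one-long ⁺⁺ length-code _ c))
  length-code p (while t repeat c)    = length-codeₜ _ t ⁺⁺ (one-long ⁺⁺ (length-code _ c ⁺⁺ one-long))

at-++ : ∀ {P p xs ys n} → HasLength xs n → At P p (xs ++ ys) → At P p xs × At P (p + n) ys
at-++ {P} {p} {xs} {ys} (has-length refl) = split p xs
  where
  split : ∀ p xs → At P p (xs ++ ys) → At P p xs × At P (p + length xs) ys
  split p []       h       = tt , subst (λ q → At P q ys) (sym (+-identityʳ p)) h
  split p (x ∷ xs) (e , h) with h₁ , h₂ ← split (suc p) xs h =
    (e , h₁) , subst (λ q → At P q ys) (sym (+-suc p (length xs))) h₂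

at-∷ : ∀ {P p i} is → At P p is → At (i ∷ P) (suc p) is
at-∷ []       h       = tt
at-∷ (_ ∷ is) (e , h) = e , at-∷ is h

at-start : ∀ P → At P 0 P
at-start []      = tt
at-start (i ∷ P) = refl , at-∷ P (at-start P)

at-≡ : ∀ {P p q is} → p ≡ q → At P p is → At P q is
at-≡ refl h = h

≡ᵇ-refl : ∀ n → (n ≡ᵇ n) ≡ true
≡ᵇ-refl zero    = refl
≡ᵇ-refl (suc n) = ≡ᵇ-refl n

≢⇒≡ᵇ-false : ∀ {m n} → m ≢ n → (m ≡ᵇ n) ≡ false
≢⇒≡ᵇ-false {m} {n} m≢n with m ≡ᵇ n in eq
... | true  = contradiction (≡ᵇ⇒≡ m n (subst T (sym eq) tt)) m≢n
... | false = refl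

≔-same : ∀ (R : ℕ → ℕ) r x → (R [ r ≔ x ]) r ≡ x
≔-same R r x rewrite ≡ᵇ-refl r = refl

≔-other : ∀ (R : ℕ → ℕ) {r q} x → r ≢ q → (R [ r ≔ x ]) q ≡ R q
≔-other R x r≢q rewrite ≢⇒≡ᵇ-false r≢q = refl

-- Simulation of structured commands by their compiled code

module Execution (w : ℕ) where

  W : ℕ
  W = 2 ^ w

  wrap-< : ∀ {x} → x < W → wrap w x ≡ x
  wrap-< x<W = m<n⇒m%n≡m {{m^n≢0 2 w}} x<W

  wrap-sub : ∀ {x y} → y ≤ x → x < W → wrap w (x + W ∸ y) ≡ x ∸ y
  wrap-sub {x} {y} y≤x x<W = begin
    wrap w (x + W ∸ y)   ≡⟨ cong (wrap w) (+-∸-comm W y≤x) ⟩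
    wrap w (x ∸ y + W)   ≡⟨ [m+n]%n≡m%n (x ∸ y) W {{m^n≢0 2 w}} ⟩
    wrap w (x ∸ y)       ≡⟨ wrap-< (≤-<-trans (m∸n≤m x y) x<W) ⟩
    x ∸ y                ∎
    where open ≡-Reasoning

  data Steps (P : Program) : Config → ℕ → Config → Set where
    stop : ∀ {s} → Steps P s 0 s
    _▹_  : ∀ {s s′ s″ t} → step w P s ≡ just s′ → Steps P s′ t s″ → Steps P s (suc t) s″

  infixr 5 _▹_ _▹▹_

  _▹▹_ : ∀ {P s s′ s″ t t′} → Steps P s t s′ → Steps P s′ t′ s″ → Steps P s (t + t′) s″
  stop     ▹▹ q = q
  (e ▹ p) ▹▹ q = e ▹ (p ▹▹ q)

  halts : ∀ {P s t s′} → Steps P s t s′ → step w P s′ ≡ nothing → Halts w P s t (outs s′)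
  halts stop    h = done h
  halts (e ▹ p) h = next e (halts p h)

  to : ∀ {P s t p p′ R M O} → p ≡ p′ → Steps P s t (config p R M O) → Steps P s t (config p′ R M O)
  to refl st = st

  one : ∀ {P p R M O i s′} → fetch P p ≡ i → exec w i (config p R M O) ≡ just s′ → Steps P (config p R M O) 1 s′
  one {R = R} {M} {O} e h = trans (cong (λ i → exec w i (config _ R M O)) e) h ▹ stop

  in-time : ∀ {P s s′ t t′} → t ≡ t′ → Steps P s t s′ → Steps P s t′ s′
  in-time refl st = st

  record Agrees {v : ℕ} (R : Reg → Word) (ρ : Vec ℕ v) : Set where
    constructor agrees
    field
      at : ∀ x → R (toℕ x) ≡ lookup ρ x

  agrees-below : ∀ {v} {ρ : Vec ℕ v} {R R′ r} → v ≤ r → Agrees R ρ → (∀ q → q < r → R′ q ≡ R q) → Agrees R′ ρ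
  agrees-below v≤r (agrees agr) same = agrees λ x → trans (same _ (≤-trans (toℕ<n x) v≤r)) (agr x)

  module _ {v : ℕ} {ρ : Vec ℕ v} {M : ℕ → ℕ} {O : List ℕ} {P : Program} where

    -- Registers below `r` survive because they hold the variables and the pending operands of the
    -- enclosing expressions.
    Evaluates : Exp v → Reg → Label → (Reg → Word) → Set
    Evaluates e r p R = ∃[ R′ ]
      Steps P (config p R M O) ‖ e ‖ (config (p + ‖ e ‖) R′ M O) ×
      R′ r ≡ ⟦_⟧ ρ M e × (∀ q → q < r → R′ q ≡ R q)

    evaluate : ∀ e {r p R} → v ≤ r → At P p (codeₑ r e) → Agrees R ρ → Fits ρ M W e → Evaluates e r p R

    evaluate₂ : ∀ a b {r p R is} → v ≤ r → At P p (codeₑ r a ++ codeₑ (suc r) b ++ is) → Agrees R ρ →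
                Fits ρ M W a → Fits ρ M W b →
                ∃[ R′ ] Steps P (config p R M O) (‖ a ‖ + ‖ b ‖) (config (p + ‖ a ‖ + ‖ b ‖) R′ M O) ×
                        R′ r ≡ ⟦_⟧ ρ M a × R′ (suc r) ≡ ⟦_⟧ ρ M b × (∀ q → q < r → R′ q ≡ R q) ×
                        At P (p + ‖ a ‖ + ‖ b ‖) is
    evaluate₂ a b {r} {p} v≤r at agr fa fb
      with at₁ , at₂ ← at-++ (length-codeₑ r a) at
      with at₃ , at₄ ← at-++ (length-codeₑ (suc r) b) at₂
      with R₁ , st₁ , v₁ , same₁ ← evaluate a v≤r at₁ agr fa
      with R₂ , st₂ , v₂ , same₂ ← evaluate b (m≤n⇒m≤1+n v≤r) at₃ (agrees-below v≤r agr same₁) fb =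
      R₂ , st₁ ▹▹ st₂ , trans (same₂ r ≤-refl) v₁ , v₂ ,
      (λ q q<r → trans (same₂ q (m<n⇒m<1+n q<r)) (same₁ q q<r)) , at₄

    binary : ∀ o a b {r p R x} → v ≤ r → At P p (codeₑ r a ++ codeₑ (suc r) b ++ op o r r (suc r) ∷ []) →
             Agrees R ρ → Fits ρ M W a → Fits ρ M W b → evalOp w o (⟦_⟧ ρ M a) (⟦_⟧ ρ M b) ≡ x →
             ∃[ R′ ] Steps P (config p R M O) (‖ a ‖ + (‖ b ‖ + 1)) (config (p + (‖ a ‖ + (‖ b ‖ + 1))) R′ M O) ×
             R′ r ≡ x × (∀ q → q < r → R′ q ≡ R q)
    binary o a b {r} {p} v≤r at agr fa fb refl
      with R₂ , st , v₁ , v₂ , same , e , _ ← evaluate₂ a b v≤r at agr fa fb =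
      R₂ [ r ≔ evalOp w o (R₂ r) (R₂ (suc r)) ] ,
      in-time (+-assoc ‖ a ‖ ‖ b ‖ 1) (st ▹▹ to (shift p ‖ a ‖ ‖ b ‖) (one e refl)) ,
      trans (≔-same R₂ r _) (cong₂ (evalOp w o) v₁ v₂) ,
      (λ q q<r → trans (≔-other R₂ _ (>⇒≢ q<r)) (same q q<r))
      where
      shift : ∀ p a b → suc (p + a + b) ≡ p + (a + (b + 1))
      shift = solve-∀

    evaluate (‵ x) {r} {p} {R} v≤r (e , _) agr _ =
      R [ r ≔ R (toℕ x) ] , to (+-comm 1 p) (one e refl) , trans (≔-same R r _) (Agrees.at agr x) , λ q q<r → ≔-other R _ (>⇒≢ q<r)
    evaluate (# c) {r} {p} {R} v≤r (e , _) agr c<W =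
      R [ r ≔ wrap w c ] , to (+-comm 1 p) (one e refl) , trans (≔-same R r _) (wrap-< c<W) , λ q q<r → ≔-other R _ (>⇒≢ q<r)
    evaluate (a ⊕ b) v≤r at agr (fa , fb , h)      = binary add a b v≤r at agr fa fb (wrap-< h)
    evaluate (a ⊖ b) v≤r at agr (fa , fb , h , h′) = binary sub a b v≤r at agr fa fb (wrap-sub h h′)
    evaluate (a ⊗ b) v≤r at agr (fa , fb , h)      = binary mul a b v≤r at agr fa fb (wrap-< h)
    evaluate (! a) {r} {p} v≤r at agr fa
      with at₁ , e , _ ← at-++ (length-codeₑ r a) at
      with R₁ , st , v₁ , same ← evaluate a v≤r at₁ agr fa =
      R₁ [ r ≔ M (R₁ r) ] ,
      st ▹▹ to (trans (sym (+-suc p ‖ a ‖)) (cong (p +_) (+-comm 1 ‖ a ‖))) (one e refl) ,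
      trans (≔-same R₁ r _) (cong M v₁) , λ q q<r → trans (≔-other R₁ _ (>⇒≢ q<r)) (same q q<r)

    test : ∀ t {l p R} → At P p (codeₜ l t) → Agrees R ρ → Fitsₜ ρ M W t →
           ∃[ R′ ] Steps P (config p R M O) ‖ t ‖ₜ (config (if ⟦_⟧ₜ ρ M t then l else p + ‖ t ‖ₜ) R′ M O) × Agrees R′ ρ
    test (a ≺ₜ b) {l} {p} at agr (fa , fb)
      with R , st , v₁ , v₂ , same , e , _ ← evaluate₂ a b ≤-refl at agr fa fb =
      R , in-time (+-assoc ‖ a ‖ ‖ b ‖ 1) (st ▹▹ to target (one e refl)) , agrees-below ≤-refl agr same
      where
      shift : ∀ p a b → suc (p + a + b) ≡ p + (a + (b + 1))
      shift = solve-∀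
      target : (if R v <ᵇ R (suc v) then l else suc (p + ‖ a ‖ + ‖ b ‖)) ≡
               (if ⟦_⟧ ρ M a <ᵇ ⟦_⟧ ρ M b then l else p + (‖ a ‖ + (‖ b ‖ + 1)))
      target rewrite v₁ | v₂ | shift p ‖ a ‖ ‖ b ‖ = refl
    test (a ≡ₜ b) {l} {p} at agr (fa , fb)
      with R , st , v₁ , v₂ , same , e , _ ← evaluate₂ a b ≤-refl at agr fa fb =
      R , in-time (+-assoc ‖ a ‖ ‖ b ‖ 1) (st ▹▹ to target (one e refl)) , agrees-below ≤-refl agr same
      where
      shift : ∀ p a b → suc (p + a + b) ≡ p + (a + (b + 1))
      shift = solve-∀
      target : (if R v ≡ᵇ R (suc v) then l else suc (p + ‖ a ‖ + ‖ b ‖)) ≡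
               (if ⟦_⟧ ρ M a ≡ᵇ ⟦_⟧ ρ M b then l else p + (‖ a ‖ + (‖ b ‖ + 1)))
      target rewrite v₁ | v₂ | shift p ‖ a ‖ ‖ b ‖ = refl

  -- An upper bound on the number of steps, not the exact number, so that branches of different cost
  -- can share a bound. The address and the scratch registers are arbitrary, which makes runs
  -- composable.
  record Run {v : ℕ} (c : Cmd v) (s : State v) (n : ℕ) (s′ : State v) : Set where
    constructor run
    field
      simulate : ∀ {P p} → At P p (code p c) → ∀ {R} → Agrees R (env s) →
        ∃[ t ] ∃[ R′ ] t ≤ n ×
          Steps P (config p R (memory s) (output s)) t (config (p + len c) R′ (memory s′) (output s′)) ×
          Agrees R′ (env s′)

  open Run public

  module _ {v : ℕ} {ρ : Vec ℕ v} {M : ℕ → ℕ} {O : List ℕ} where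

    run-set : ∀ {x e y} → Fit ρ M W e → ⟦_⟧ ρ M e ≡ y →
              Run (x := e) ⟨ ρ , M , O ⟩ (‖ e ‖ + 1) ⟨ ρ [ x ]≔ y , M , O ⟩
    run-set {x} {e} (fit f) refl .simulate {P} {p} at {R} agr
      with at₁ , e₁ , _ ← at-++ (length-codeₑ v e) at
      with R₁ , st , v₁ , same ← evaluate e ≤-refl at₁ agr f =
      _ , R₁ [ toℕ x ≔ R₁ v ] , ≤-refl ,
      st ▹▹ to (trans (sym (+-suc p ‖ e ‖)) (cong (p +_) (+-comm 1 ‖ e ‖))) (one e₁ refl) , agrees updated
      where
      updated : ∀ y → (R₁ [ toℕ x ≔ R₁ v ]) (toℕ y) ≡ lookup (ρ [ x ]≔ ⟦_⟧ ρ M e) y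
      updated y with y Fin.≟ x
      ... | yes refl = trans (≔-same R₁ (toℕ x) _) (trans v₁ (sym (lookup∘updateAt x ρ)))
      ... | no y≢x   = trans (≔-other R₁ _ (λ h → y≢x (toℕ-injective (sym h))))
                         (trans (Agrees.at (agrees-below ≤-refl agr same) y) (sym (lookup∘updateAt′ y x y≢x ρ)))

    run-write : ∀ {a e i y} → Fit ρ M W a → Fit ρ M W e → ⟦_⟧ ρ M a ≡ i → ⟦_⟧ ρ M e ≡ y →
                Run (a *:= e) ⟨ ρ , M , O ⟩ (‖ a ‖ + ‖ e ‖ + 1) ⟨ ρ , M [ i ≔ y ] , O ⟩
    run-write {a} {e} (fit fa) (fit fe) refl refl .simulate {P} {p} at agr
      with R₁ , st , v₁ , v₂ , same , e₁ , _ ← evaluate₂ a e ≤-refl at agr fa fe =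
      _ , R₁ , ≤-refl ,
      st ▹▹ to (shift p ‖ a ‖ ‖ e ‖) (one e₁ (cong₂ (λ i y → just (config _ R₁ (M [ i ≔ y ]) O)) v₁ v₂)) ,
      agrees-below ≤-refl agr same
      where
      shift : ∀ p a b → suc (p + a + b) ≡ p + (a + (b + 1))
      shift = solve-∀

    run-emit : ∀ {e y} → Fit ρ M W e → ⟦_⟧ ρ M e ≡ y →
               Run (emit e) ⟨ ρ , M , O ⟩ (‖ e ‖ + 1) ⟨ ρ , M , O ∷ʳ y ⟩
    run-emit {e} (fit f) refl .simulate {P} {p} at agr
      with at₁ , e₁ , _ ← at-++ (length-codeₑ v e) at
      with R₁ , st , v₁ , same ← evaluate e ≤-refl at₁ agr f =
      _ , R₁ , ≤-refl ,
      st ▹▹ to (trans (sym (+-suc p ‖ e ‖)) (cong (p +_) (+-comm 1 ‖ e ‖)))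
               (one e₁ (cong (λ y → just (config _ R₁ M (O ∷ʳ y))) v₁)) ,
      agrees-below ≤-refl agr same

    -- The additional step is the jump over the then-branch.
    run-else : ∀ {t c d n s′} → Fitsₜ ρ M W t → ⟦_⟧ₜ ρ M t ≡ false → Run d ⟨ ρ , M , O ⟩ n s′ →
               Run (ifₜ t then c else d) ⟨ ρ , M , O ⟩ (‖ t ‖ₜ + n + 1) s′
    run-else {t} {c} {d} f h r .simulate {P} {p} at agr
      with at₁ , at₂ ← at-++ (length-codeₜ _ t) at
      with at₃ , e , _ ← at-++ (length-code _ d) at₂
      with R₁ , st₁ , agr₁ ← test {O = O} t at₁ agr f
      with _ , R₂ , t≤n , st₂ , agr₂ ← r .simulate at₃ agr₁ =
      _ , R₂ , +-monoˡ-≤ 1 (+-monoʳ-≤ ‖ t ‖ₜ t≤n) ,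
      (to (cong (if_then _ else _) h) st₁ ▹▹ st₂) ▹▹ one e refl , agr₂

    run-then : ∀ {t c d n s′} → Fitsₜ ρ M W t → ⟦_⟧ₜ ρ M t ≡ true → Run c ⟨ ρ , M , O ⟩ n s′ →
               Run (ifₜ t then c else d) ⟨ ρ , M , O ⟩ (‖ t ‖ₜ + n) s′
    run-then {t} {c} {d} f h r .simulate {P} {p} at agr
      with at₁ , at₂ ← at-++ (length-codeₜ _ t) at
      with _ , _ , at₃ ← at-++ (length-code _ d) at₂
      with R₁ , st₁ , agr₁ ← test {O = O} t at₁ agr f
      with _ , R₂ , t≤n , st₂ , agr₂ ← r .simulate (at-≡ (sym (+-comm _ 1)) at₃) agr₁ =
      _ , R₂ , +-monoʳ-≤ ‖ t ‖ₜ t≤n ,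
      to (cong (if_then _ else _) h) st₁ ▹▹ to (shift p ‖ t ‖ₜ (len d) (len c)) st₂ , agr₂
      where
      shift : ∀ p a b c → p + a + b + 1 + c ≡ p + (a + (b + (1 + c)))
      shift = solve-∀

    run-exit : ∀ {t c} → Fitsₜ ρ M W t → ⟦_⟧ₜ ρ M t ≡ false →
               Run (while t repeat c) ⟨ ρ , M , O ⟩ (‖ t ‖ₜ + 1) ⟨ ρ , M , O ⟩
    run-exit {t} f h .simulate at agr
      with at₁ , e , _ ← at-++ (length-codeₜ _ t) at
      with R₁ , st₁ , agr₁ ← test {O = O} t at₁ agr f =
      _ , R₁ , ≤-refl , to (cong (if_then _ else _) h) st₁ ▹▹ one e refl , agr₁

    run-loop : ∀ {t c n m s′ s″} → Fitsₜ ρ M W t → ⟦_⟧ₜ ρ M t ≡ true → Run c ⟨ ρ , M , O ⟩ n s′ →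
               Run (while t repeat c) s′ m s″ →
               Run (while t repeat c) ⟨ ρ , M , O ⟩ (‖ t ‖ₜ + n + 1 + m) s″
    run-loop {t} {c} f h r r′ .simulate {P} {p} at agr
      with at₁ , _ , at₂ ← at-++ (length-codeₜ _ t) at
      with at₃ , e , _ ← at-++ (length-code _ c) at₂
      with R₁ , st₁ , agr₁ ← test {O = O} t at₁ agr f
      with _ , R₂ , t≤n , st₂ , agr₂ ← r .simulate (at-≡ (sym (+-comm _ 1)) at₃) agr₁
      with _ , R₃ , t≤m , st₃ , agr₃ ← r′ .simulate at agr₂ =
      _ , R₃ , +-mono-≤ (+-monoˡ-≤ 1 (+-monoʳ-≤ ‖ t ‖ₜ t≤n)) t≤m ,
      ((to (cong (if_then _ else _) h) st₁ ▹▹ st₂) ▹▹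
        one (trans (cong (fetch P) (shift (p + ‖ t ‖ₜ) (len c))) e) refl) ▹▹ st₃ , agr₃
      where
      shift : ∀ p c → p + 1 + c ≡ suc (p + c)
      shift = solve-∀

  run-seq : ∀ {v} {c d : Cmd v} {s s′ s″ n m} → Run c s n s′ → Run d s′ m s″ → Run (c ⨾ d) s (n + m) s″
  run-seq {c = c} {d} r r′ .simulate {P} {p} at agr
    with at₁ , at₂ ← at-++ (length-code _ c) at
    with _ , R₁ , t≤n , st₁ , agr₁ ← r .simulate at₁ agr
    with _ , R₂ , t≤m , st₂ , agr₂ ← r′ .simulate at₂ agr₁ =
    _ , R₂ , +-mono-≤ t≤n t≤m , st₁ ▹▹ to (+-assoc p (len c) (len d)) st₂ , agr₂

  run-≤ : ∀ {v} {c : Cmd v} {s s′ n m} → n ≤ m → Run c s n s′ → Run c s m s′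
  run-≤ n≤m r .simulate at agr with t , R , t≤n , rest ← r .simulate at agr = t , R , ≤-trans t≤n n≤m , rest

  run-program : ∀ {v} {c : Cmd v} {ρ M O s′ n R} → Run c ⟨ ρ , M , O ⟩ n s′ → Agrees R ρ →
                ∃[ t ] t ≤ n × Halts w (code 0 c ++ halt ∷ []) (config 0 R M O) t (output s′)
  run-program {c = c} {M = M} {O} r agr
    with at₁ , e , _ ← at-++ (length-code 0 c) (at-start (code 0 c ++ halt ∷ []))
    with t , R , t≤n , st , _ ← r .simulate at₁ agr =
    t , t≤n , halts st (cong (λ i → exec w i (config (len c) R _ _)) e)

-- Borders of substrings

module BorderTheory (ch : ℕ → ℕ) where

  Match : ℕ → ℕ → ℕ → Set
  Match i p b = ∀ x → x < b → ch (i + x) ≡ ch (p + x)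

  -- The length b of a proper border of the substring from i to s; p is where its right occurrence begins.
  Border : ℕ → ℕ → ℕ → Set
  Border i s b = ∃[ p ] i < p × p + b ≡ suc s × Match i p b

  Longest : ℕ → ℕ → ℕ → Set
  Longest i s k = Border i s k × (∀ b → Border i s b → b ≤ k)

  -- Absence of a non-empty border is represented by v = 0.
  Shortest : ℕ → ℕ → ℕ → Set
  Shortest i s v = (1 ≤ v → Border i s v) × (∀ b → 1 ≤ b → Border i s b → 1 ≤ v × v ≤ b)

  border-0 : ∀ {i s} → i ≤ s → Border i s 0
  border-0 {i} {s} i≤s = suc s , s≤s i≤s , +-identityʳ _ , λ _ ()

  border-pred : ∀ {i s b} → Border i (suc s) (suc b) → Border i s b × ch (i + b) ≡ ch (suc s)
  border-pred {i} {s} {b} (p , i<p , p+b , m) =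
    (p , i<p , p+b≡ , λ x x<b → m x (m<n⇒m<1+n x<b)) ,
    trans (m b ≤-refl) (cong ch p+b≡)
    where
    p+b≡ : p + b ≡ suc s
    p+b≡ = suc-injective (trans (sym (+-suc p b)) p+b)

  border-suc : ∀ {i s b} → Border i s b → ch (i + b) ≡ ch (suc s) → Border i (suc s) (suc b)
  border-suc {i} {s} {b} (p , i<p , p+b , m) h = p , i<p , trans (+-suc p b) (cong suc p+b) , m′
    where
    m′ : Match i p (suc b)
    m′ x x<1+b with m≤n⇒m<n∨m≡n (s≤s⁻¹ x<1+b)
    ... | inj₁ x<b  = m x x<b
    ... | inj₂ refl = trans h (cong ch (sym p+b))

  -- The right occurrence of the shorter border lies inside the right occurrence of the longer one,
  -- and the match of the longer border carries it to the left. The end `j` is given by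
  -- `suc j ≡ i + c` to avoid a subtraction.
  border-prefix : ∀ {i s b c j} → b < c → Border i s b → Border i s c → suc j ≡ i + c → Border i j b
  border-prefix {i} {s} {b} {c} {j} b<c (p , i<p , p+b , m) (q , i<q , q+c , n) j≡
    with e , refl ← m≤n⇒∃[o]m+o≡n (<⇒≤ b<c) =
    i + e , linear 3 (λ i b e → b ≺ b ⊞ e ⇛ goal (i ≺ i ⊞ e)) i b e b<c ,
    linear 4 (λ i b e j → con 1 ⊞ j ≊ i ⊞ (b ⊞ e) ⇛ goal (i ⊞ e ⊞ b ≊ con 1 ⊞ j)) i b e j j≡ ,
    λ x x<b → begin
      ch (i + x)       ≡⟨ m x x<b ⟩
      ch (p + x)       ≡⟨ cong ch (linear 6 (λ p q b e s x → p ⊞ b ≊ con 1 ⊞ s ⇛ q ⊞ (b ⊞ e) ≊ con 1 ⊞ s ⇛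
                                     goal (p ⊞ x ≊ q ⊞ (e ⊞ x))) p q b e s x p+b q+c) ⟩
      ch (q + (e + x)) ≡⟨ n (e + x) (linear 3 (λ b e x → x ≺ b ⇛ goal (e ⊞ x ≺ b ⊞ e)) b e x x<b) ⟨
      ch (i + (e + x)) ≡⟨ cong ch (+-assoc i e x) ⟨
      ch (i + e + x)   ∎
    where open ≡-Reasoning

  -- The transport of `border-prefix` in the opposite direction: a border of the left occurrence is
  -- moved to the right occurrence, where it ends at `s`.
  border-trans : ∀ {i s b c j} → Border i j b → Border i s c → suc j ≡ i + c → Border i s b
  border-trans {i} {s} {b} {c} {j} (p , i<p , p+b , m) (q , i<q , q+c , n) j≡
    with e , refl ← m≤n⇒∃[o]m+o≡n (<⇒≤ i<p) =
    q + e , linear 3 (λ i q e → i ≺ q ⇛ goal (i ≺ q ⊞ e)) i q e i<q ,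
    linear 7 (λ i q e b c j s → i ⊞ e ⊞ b ≊ con 1 ⊞ j ⇛ q ⊞ c ≊ con 1 ⊞ s ⇛ con 1 ⊞ j ≊ i ⊞ c ⇛
       goal (q ⊞ e ⊞ b ≊ con 1 ⊞ s)) i q e b c j s p+b q+c j≡ ,
    λ x x<b → begin
      ch (i + x)       ≡⟨ m x x<b ⟩
      ch (i + e + x)   ≡⟨ cong ch (+-assoc i e x) ⟩
      ch (i + (e + x)) ≡⟨ n (e + x) (linear 6 (λ i b c e j x → i ⊞ e ⊞ b ≊ con 1 ⊞ j ⇛ con 1 ⊞ j ≊ i ⊞ c ⇛ x ≺ b ⇛
                            goal (e ⊞ x ≺ c)) i b c e j x p+b j≡ x<b) ⟩
      ch (q + (e + x)) ≡⟨ cong ch (+-assoc q e x) ⟨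
      ch (q + e + x)   ∎
    where open ≡-Reasoning

  border-single : ∀ {i b} → Border i i b → b ≡ 0
  border-single {i} {b} (p , i<p , p+b , _) =
    linear 3 (λ i p b → i ≺ p ⇛ p ⊞ b ≊ con 1 ⊞ i ⇛ goal (b ≊ con 0)) i p b i<p p+b

  longest-single : ∀ {i} → Longest i i 0
  longest-single = border-0 ≤-refl , λ b β → ≤-reflexive (border-single β)

  -- The state of the Knuth–Morris–Pratt automaton before reading position s + 1.
  Candidate : ℕ → ℕ → ℕ → Set
  Candidate i s k = Border i s k × (∀ b → Border i (suc s) b → b ≤ suc k)

  longest⇒candidate : ∀ {i s k} → Longest i s k → Candidate i s k
  longest⇒candidate (β , max) = β , λ { zero _ → z≤n ; (suc b) γ → s≤s (max b (proj₁ (border-pred γ))) }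

  candidate-match : ∀ {i s k} → Candidate i s k → ch (i + k) ≡ ch (suc s) → Longest i (suc s) (suc k)
  candidate-match (β , max) h = border-suc β h , max

  candidate-none : ∀ {i s} → i ≤ s → Candidate i s 0 → ch i ≢ ch (suc s) → Longest i (suc s) 0
  candidate-none {i} {s} i≤s (_ , max) h≢ = border-0 (m≤n⇒m≤1+n i≤s) , λ
    { zero _          → z≤n
    ; (suc zero) β    → contradiction (trans (cong ch (sym (+-identityʳ i))) (proj₂ (border-pred β))) h≢
    ; (suc (suc b)) β → contradiction (max _ β) λ { (s≤s ()) } }

  -- The mismatch excludes a border of length `suc (suc k)`. Any shorter one, without its last
  -- letter, is shorter than the current border, hence a border of it and at most `f`.
  candidate-fail : ∀ {i s k f} → Candidate i s (suc k) → ch (i + suc k) ≢ ch (suc s) → Longest i (i + k) f →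
                   Candidate i s f
  candidate-fail {i} {s} {k} {f} (β , max) h≢ (γ , maxf) = border-trans γ β (sym (+-suc i k)) , bound
    where
    bound : ∀ b → Border i (suc s) b → b ≤ suc f
    bound zero    δ = z≤n
    bound (suc b) δ with δ′ , h ← border-pred δ with m≤n⇒m<n∨m≡n (s≤s⁻¹ (max (suc b) δ))
    ... | inj₂ refl = contradiction h h≢
    ... | inj₁ b<k  = s≤s (maxf b (border-prefix b<k δ′ β (sym (+-suc i k))))

  longest-0⇒shortest : ∀ {i s} → Longest i s 0 → Shortest i s 0
  longest-0⇒shortest (_ , max) = (λ ()) , λ b 1≤b β → contradiction (≤-trans 1≤b (max b β)) λ ()

  -- All borders other than the longest are borders of the longest. So the shortest border is found
  -- from a table entry for the longest: the longest itself if that one is unbordered, and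
  -- otherwise, by `shortest-inherit`, the shortest border of the longest.
  shortest-longest : ∀ {i s k} → Longest i s (suc k) → Shortest i (i + k) 0 → Shortest i s (suc k)
  shortest-longest {i} {s} {k} (β , max) (_ , min) = (λ _ → β) , bound
    where
    bound : ∀ b → 1 ≤ b → Border i s b → 1 ≤ suc k × suc k ≤ b
    bound b 1≤b γ with m≤n⇒m<n∨m≡n (max b γ)
    ... | inj₂ refl = s≤s z≤n , ≤-refl
    ... | inj₁ b<   = contradiction (proj₁ (min b 1≤b (border-prefix b< γ β (sym (+-suc i k))))) λ ()

  shortest-inherit : ∀ {i s k v} → Longest i s (suc k) → Shortest i (i + k) (suc v) → Shortest i s (suc v)
  shortest-inherit {i} {s} {k} {v} (β , max) (σ , min) = (λ _ → border-trans (σ (s≤s z≤n)) β (sym (+-suc i k))) , bound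
    where
    bound : ∀ b → 1 ≤ b → Border i s b → 1 ≤ suc v × suc v ≤ b
    bound b 1≤b γ with m≤n⇒m<n∨m≡n (max b γ)
    ... | inj₁ b<   = min b 1≤b (border-prefix b< γ β (sym (+-suc i k)))
    ... | inj₂ refl with p , i<p , p+v , _ ← σ (s≤s z≤n) = s≤s z≤n ,
      linear 4 (λ i p v k → i ≺ p ⇛ p ⊞ (con 1 ⊞ v) ≊ con 1 ⊞ (i ⊞ k) ⇛ goal (v ≺ con 1 ⊞ k)) i p v k i<p p+v

  -- If the two occurrences overlapped, the overlap would be a suffix of the left one and a prefix
  -- of the right one, hence a non-empty border shorter than `d`.
  shortest-disjoint : ∀ {i s d} → 1 ≤ d → Shortest i s d → i + d + d ≤ suc s
  shortest-disjoint {i} {s} {d} 1≤d (σ , min) with p , i<p , p+d , m ← σ 1≤d with i + d ≤? p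
  ... | yes h = linear 4 (λ i d p s → p ⊞ d ≊ con 1 ⊞ s ⇛ i ⊞ d ≼ p ⇛ goal (i ⊞ d ⊞ d ≼ con 1 ⊞ s)) i d p s p+d h
  ... | no ¬h with b , p+b ← m≤n⇒∃[o]m+o≡n (<⇒≤ (≰⇒> ¬h)) with e , i+e ← m≤n⇒∃[o]m+o≡n (<⇒≤ i<p) =
    ⊥-elim (linear 5 (λ i d p b e → p ⊞ b ≊ i ⊞ d ⇛ i ≺ p ⇛ d ≼ b ⇛ absurd) i d p b e p+b i<p
      (proj₂ (min b
        (linear 4 (λ i d p b → p ⊞ b ≊ i ⊞ d ⇛ p ≺ i ⊞ d ⇛ goal (con 1 ≼ b)) i d p b p+b (≰⇒> ¬h))
        (p + e ,
         linear 3 (λ i p e → i ≺ p ⇛ goal (i ≺ p ⊞ e)) i p e i<p ,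
         linear 6 (λ i d p b e s → p ⊞ b ≊ i ⊞ d ⇛ i ⊞ e ≊ p ⇛ p ⊞ d ≊ con 1 ⊞ s ⇛ goal (p ⊞ e ⊞ b ≊ con 1 ⊞ s))
           i d p b e s p+b i+e p+d ,
         λ x x<b → begin
           ch (i + x)       ≡⟨ m x (linear 5 (λ i d p b x → p ⊞ b ≊ i ⊞ d ⇛ i ≺ p ⇛ x ≺ b ⇛ goal (x ≺ d)) i d p b x p+b i<p x<b) ⟩
           ch (p + x)       ≡⟨ cong (λ p → ch (p + x)) i+e ⟨
           ch (i + e + x)   ≡⟨ cong ch (+-assoc i e x) ⟩
           ch (i + (e + x)) ≡⟨ m (e + x) (linear 6 (λ i d p b e x → p ⊞ b ≊ i ⊞ d ⇛ i ⊞ e ≊ p ⇛ x ≺ b ⇛ goal (e ⊞ x ≺ d))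
                                 i d p b e x p+b i+e x<b) ⟩
           ch (p + (e + x)) ≡⟨ cong ch (+-assoc p e x) ⟨
           ch (p + e + x)   ∎))))
    where open ≡-Reasoning

  shortest-unique : ∀ {i s d e} → Shortest i s d → Shortest i s e → d ≡ e
  shortest-unique {d = zero}  {zero}  _       _         = refl
  shortest-unique {d = zero}  {suc e} (_ , m) (β , _)   = contradiction (proj₁ (m _ (s≤s z≤n) (β (s≤s z≤n)))) λ ()
  shortest-unique {d = suc d} {zero}  (β , _) (_ , m)   = contradiction (proj₁ (m _ (s≤s z≤n) (β (s≤s z≤n)))) λ ()
  shortest-unique {d = suc d} {suc e} (β , m) (β′ , m′) =
    ≤-antisym (proj₂ (m _ (s≤s z≤n) (β′ (s≤s z≤n)))) (proj₂ (m′ _ (s≤s z≤n) (β (s≤s z≤n))))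

  -- The shorter of two extensions of the same substring would be a border of the longer one.
  extension-≮ : ∀ {i i′ r d d′} → d < d′ → 1 ≤ d → i + d ≡ i′ + d′ →
                Shortest i (r + d) d → Shortest i′ (r + d′) d′ → ⊥
  extension-≮ {i} {i′} {r} {d} {d′} d<d′ 1≤d i≡ (σ , _) (σ′ , min′)
    with p , i<p , p+d , m ← σ 1≤d
    with p′ , i′<p′ , p′+d′ , m′ ← σ′ (≤-trans 1≤d (<⇒≤ d<d′))
    with refl ← +-cancelʳ-≡ d p (suc r) p+d
    with refl ← +-cancelʳ-≡ d′ p′ (suc r) p′+d′
    with e , refl ← m≤n⇒∃[o]m+o≡n (<⇒≤ d<d′) =
    -- The right arms both start at `suc r` and the left arms both end just before `i + d`. So the
    -- arm of length `d` is a prefix and a suffix of the longer arm, and thereby a border of the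
    -- larger substring.
    <⇒≱ d<d′ (proj₂ (min′ d 1≤d
      (suc r + e ,
       linear 3 (λ i r e → i ≺ con 1 ⊞ r ⇛ goal (i ≺ con 1 ⊞ r ⊞ e)) i′ r e i′<p′ ,
       linear 3 (λ r d e → goal (con 1 ⊞ r ⊞ e ⊞ d ≊ con 1 ⊞ (r ⊞ (d ⊞ e)))) r d e ,
       λ x x<d → begin
         ch (i′ + x)          ≡⟨ m′ x (≤-trans x<d (m≤m+n d e)) ⟩
         ch (suc r + x)       ≡⟨ m x x<d ⟨
         ch (i + x)           ≡⟨ cong ch (linear 5 (λ i i′ d e x → i ⊞ d ≊ i′ ⊞ (d ⊞ e) ⇛ goal (i ⊞ x ≊ i′ ⊞ (e ⊞ x))) i i′ d e x i≡) ⟩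
         ch (i′ + (e + x))    ≡⟨ m′ (e + x) (linear 3 (λ d e x → x ≺ d ⇛ goal (e ⊞ x ≺ d ⊞ e)) d e x x<d) ⟩
         ch (suc r + (e + x)) ≡⟨ cong ch (+-assoc (suc r) e x) ⟨
         ch (suc r + e + x)   ∎)))
    where open ≡-Reasoning

  extension-unique : ∀ {i i′ r d d′} → 1 ≤ d → 1 ≤ d′ → i + d ≡ i′ + d′ →
                     Shortest i (r + d) d → Shortest i′ (r + d′) d′ → d ≡ d′
  extension-unique {d = d} {d′} 1≤d 1≤d′ i≡ sh sh′ with <-cmp d d′
  ... | tri< d<d′ _ _ = ⊥-elim (extension-≮ d<d′ 1≤d i≡ sh sh′)
  ... | tri≈ _ d≡d′ _ = d≡d′
  ... | tri> _ _ d′<d = ⊥-elim (extension-≮ d′<d 1≤d′ (sym i≡) sh′ sh)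

-- Tabulating shortest borders

-- Three tables share the memory cells from N + 1 = K on: failure function (0), shortest border (1),
-- and length of the extension (2).
opaque
  address : ℕ → ℕ → ℕ → ℕ → ℕ
  address K t a b = (a * 3 + t) * K + b

  address-≡ : ∀ {K t a b} → (a * 3 + t) * K + b ≡ address K t a b
  address-≡ = refl

cell : ℕ → Exp 8 → Exp 8 → Exp 8
cell t a b = (a ⊗ # 3 ⊕ # t) ⊗ ‵ 1F ⊕ b

pattern 𝐾 = ‵_ 1F
pattern 𝑖 = ‵_ 2F
pattern 𝑠 = ‵_ 3F
pattern 𝑘 = ‵_ 4F
pattern 𝑑 = ‵_ 5F
pattern 𝑙 = ‵_ 6F
pattern 𝑟 = ‵_ 7F

-- In `onMatch`, `cell 1 𝑖 (𝑖 ⊕ 𝑘)` is read with the old `𝑘` and so belongs to the new longest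
-- border, of length `𝑘 + 1`. A positive entry is inherited as the shortest border; otherwise the
-- longest border is the shortest.
onMatch onMismatch scan : Cmd 8
onMatch =
  5F := ! cell 1 𝑖 (𝑖 ⊕ 𝑘) ⨾
  4F := 𝑘 ⊕ # 1 ⨾
  cell 0 𝑖 𝑠 *:= 𝑘 ⨾
  (ifₜ # 0 ≺ₜ 𝑑 then 5F := 𝑑 else 5F := 𝑘) ⨾
  cell 1 𝑖 𝑠 *:= 𝑑 ⨾
  cell 2 (𝑖 ⊕ 𝑑) (𝑠 ⊖ 𝑑) *:= 𝑑 ⨾
  3F := 𝑠 ⊕ # 1
onMismatch =
  ifₜ # 0 ≺ₜ 𝑘 then 4F := ! cell 0 𝑖 (𝑖 ⊕ 𝑘 ⊖ # 1) else 3F := 𝑠 ⊕ # 1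
scan = ifₜ ! (𝑖 ⊕ 𝑘) ≡ₜ ! 𝑠 then onMatch else onMismatch

scanRow tabulateBorders : Cmd 8
scanRow = while 𝑠 ≺ₜ 𝐾 repeat scan
tabulateBorders =
  1F := ‵ 0F ⊕ # 1 ⨾
  2F := # 1 ⨾
  (while 𝑖 ≺ₜ 𝐾 repeat (3F := 𝑖 ⊕ # 1 ⨾ 4F := # 0 ⨾ scanRow ⨾ 2F := 𝑖 ⊕ # 1))

quotient-unique : ∀ {K q q′ b b′} → b < K → b′ < K → q * K + b ≡ q′ * K + b′ → q ≡ q′
quotient-unique {K} {q} {q′} {b} {b′} b<K b′<K e with <-cmp q q′
... | tri≈ _ q≡ _ = q≡
... | tri< q< _ _ = ⊥-elim (linear 5 (λ x y b b′ K → K ⊞ x ≼ y ⇛ b ≺ K ⇛ x ⊞ b ≊ y ⊞ b′ ⇛ absurd)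
                      (q * K) (q′ * K) b b′ K (*-monoˡ-≤ K q<) b<K e)
... | tri> _ _ q> = ⊥-elim (linear 5 (λ x y b b′ K → K ⊞ y ≼ x ⇛ b′ ≺ K ⇛ x ⊞ b ≊ y ⊞ b′ ⇛ absurd)
                      (q * K) (q′ * K) b b′ K (*-monoˡ-≤ K q>) b′<K e)

opaque
  unfolding address

  address-injective : ∀ {K t a b t′ a′ b′} → t < 3 → t′ < 3 → b < K → b′ < K →
                      address K t a b ≡ address K t′ a′ b′ → t ≡ t′ × a ≡ a′ × b ≡ b′
  address-injective {K} {t} {a} {b} {t′} {a′} {b′} t< t′< b< b′< e
    with e₁ ← quotient-unique {q = a * 3 + t} {a′ * 3 + t′} b< b′< e
    with refl ← quotient-unique {q = a} {a′} t< t′< e₁ =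
    +-cancelˡ-≡ (a * 3) t t′ e₁ , refl ,
    +-cancelˡ-≡ ((a * 3 + t) * K) b b′ (trans e (cong (λ q → q * K + b′) (sym e₁)))

  -- Rows are numbered from 1, so whole rows of length `suc N` precede every table cell and the
  -- input is never overwritten.
  address-beyond : ∀ {N} t {a} b → 1 ≤ a → N < address (suc N) t a b
  address-beyond {N} t {suc a} b _ = ≤-trans (m≤n*m (suc N) (suc a * 3 + t)) (m≤m+n _ b)

true-T : ∀ {b} → T b → b ≡ true
true-T {true} _ = refl

false-T : ∀ {b} → ¬ T b → b ≡ false
false-T {true}  h = contradiction tt h
false-T {false} _ = refl

<ᵇ-true : ∀ {m n} → m < n → (m <ᵇ n) ≡ true
<ᵇ-true m<n = true-T (<⇒<ᵇ m<n)

<ᵇ-false : ∀ {m n} → n ≤ m → (m <ᵇ n) ≡ false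
<ᵇ-false {m} n≤m = false-T λ h → <⇒≱ (<ᵇ⇒< m _ h) n≤m

loop-cost : ∀ A {B c} m → c ≤ A → c + (A * m + B) ≤ A * suc m + B
loop-cost A {B} {c} m c≤A = ≤-trans (+-monoˡ-≤ (A * m + B) c≤A)
  (≤-reflexive (trans (sym (+-assoc A (A * m) B)) (cong (_+ B) (sym (*-suc A m)))))

-- Opaque, lest products with it are unfolded.
opaque
  unit : ℕ
  unit = 120

  affordable : ∀ {c} → c ≤ 120 → c ≤ unit
  affordable c≤ = c≤

-- Invariant of the three tables

module Tabulation (w N : ℕ) (ch : ℕ → ℕ) (room : (3 * suc N + 3) * suc N ≤ 2 ^ w) where

  open BorderTheory ch
  open Execution w

  K : ℕ
  K = suc N

  cellOf : ℕ → ℕ → ℕ → ℕ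
  cellOf = address K

  small : ∀ {x} → x ≤ suc (suc K) → x < W
  small {x} x≤ = ≤-trans (linear 3 (λ x N y → x ≼ con 3 ⊞ N ⇛ goal (con 1 ⊞ x ≼ (con 6 ⊞ 3 ⊠ N) ⊞ y))
                            x N (N * (3 * K + 3)) x≤)
    (≤-trans (≤-reflexive (lemma N)) room)
    where
    lemma : ∀ N → 6 + 3 * N + N * (3 * suc N + 3) ≡ (3 * suc N + 3) * suc N
    lemma = solve-∀

  numeral : ∀ {x} → x ≤ 3 → x < W
  numeral x≤3 = small (≤-trans x≤3 (s≤s (s≤s (s≤s z≤n))))

  fits-cell : ∀ {n ρ M} t a b → t ≤ 2 → Fits (n ∷ K ∷ ρ) M W a → Fits (n ∷ K ∷ ρ) M W b →
              ⟦_⟧ (n ∷ K ∷ ρ) M a ≤ K → ⟦_⟧ (n ∷ K ∷ ρ) M b ≤ N → Fit (n ∷ K ∷ ρ) M W (cell t a b)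
  fits-cell {n} {ρ} {M} t a b t≤2 fa fb a≤K b≤N = fit (
    (((fa , numeral ≤-refl , below (≤-trans (m≤m+n _ t) row)) , numeral (≤-trans t≤2 (n≤1+n 2)) , below row) ,
     tt , ≤-<-trans (m≤m+n _ _) whole) , fb , whole)
    where
    x = ⟦_⟧ (n ∷ K ∷ ρ) M a
    y = ⟦_⟧ (n ∷ K ∷ ρ) M b
    row : x * 3 + t ≤ 3 * K + 2
    row = +-mono-≤ (≤-trans (≤-reflexive (*-comm x 3)) (*-monoʳ-≤ 3 a≤K)) t≤2
    below : ∀ {z} → z ≤ 3 * K + 2 → z < W
    below {z} h = ≤-trans (≤-trans (≤-trans (s≤s h) (≤-reflexive (sym (+-suc (3 * K) 2))))
                    (m≤m*n (3 * K + 3) K)) room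
    -- The largest address is `(3 * K + 2) * K + N`, one less than `(3 * K + 3) * K`; this is the
    -- origin of the bound `room`.
    whole : (x * 3 + t) * K + y < W
    whole = ≤-trans (s≤s (+-mono-≤ (*-monoˡ-≤ K row) b≤N)) (≤-trans (≤-reflexive lemma) room)
      where
      lemma : suc ((3 * K + 2) * K + N) ≡ (3 * K + 3) * K
      lemma = trans (sym (+-suc _ N)) (trans (+-comm _ K) (cong (_* K) (sym (+-suc (3 * K) 2))))

  fits-load : ∀ {v M a} {ρ : Vec ℕ v} → Fit ρ M W a → Fit ρ M W (! a)
  fits-load (fit f) = fit f

  beyond : ∀ t {a} b → 1 ≤ a → N < cellOf t a b
  beyond = address-beyond

  Done : ℕ → ℕ → ℕ → ℕ → Set
  Done i s a b = a ≤ b × (a < i ⊎ a ≡ i × b < s)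

  -- Row i is tabulated for positions below s, earlier rows are complete.
  record Tabulated (M : ℕ → ℕ) (i s : ℕ) : Set where
    field
      input    : ∀ {x} → x ≤ N → M x ≡ ch x
      longest  : ∀ {a b} → 1 ≤ a → b ≤ N → Done i s a b → Longest a b (M (cellOf 0 a b))
      shortest : ∀ {a b} → 1 ≤ a → b ≤ N → Done i s a b → Shortest a b (M (cellOf 1 a b))
      fresh₀   : ∀ {a b} → 1 ≤ a → b ≤ N → ¬ Done i s a b → M (cellOf 0 a b) ≡ 0
      fresh₁   : ∀ {a b} → 1 ≤ a → b ≤ N → ¬ Done i s a b → M (cellOf 1 a b) ≡ 0
      sound    : ∀ {l r} → 1 ≤ l → r ≤ N → 1 ≤ M (cellOf 2 l r) →
                 ∃[ a ] 1 ≤ a × a + M (cellOf 2 l r) ≡ l × r + M (cellOf 2 l r) ≤ N ×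
                        Shortest a (r + M (cellOf 2 l r)) (M (cellOf 2 l r))
      complete : ∀ {a r d} → 1 ≤ a → r + d ≤ N → 1 ≤ d → Done i s a (r + d) → Shortest a (r + d) d →
                 M (cellOf 2 (a + d) r) ≡ d

  open Tabulated public

  tabulated-start : (∀ {x} → N < x → ch x ≡ 0) → Tabulated ch 0 K
  tabulated-start outside = record
    { input    = λ _ → refl
    ; longest  = λ { (s≤s _) _ (_ , inj₁ ()) ; (s≤s _) _ (_ , inj₂ (() , _)) }
    ; shortest = λ { (s≤s _) _ (_ , inj₁ ()) ; (s≤s _) _ (_ , inj₂ (() , _)) }
    ; fresh₀   = λ {a} {b} 1≤a _ _ → outside (beyond 0 b 1≤a)
    ; fresh₁   = λ {a} {b} 1≤a _ _ → outside (beyond 1 b 1≤a)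
    ; sound    = λ {l} {r} 1≤l _ 1≤ → contradiction (subst (1 ≤_) (outside (beyond 2 r 1≤l)) 1≤) λ ()
    ; complete = λ { (s≤s _) _ _ (_ , inj₁ ()) ; (s≤s _) _ _ (_ , inj₂ (() , _)) }
    }

  done-suc : ∀ {i s a b} → Done i (suc s) a b → Done i s a b ⊎ (a ≡ i × b ≡ s)
  done-suc (a≤b , inj₁ a<i)           = inj₁ (a≤b , inj₁ a<i)
  done-suc (a≤b , inj₂ (a≡i , b<1+s)) with m≤n⇒m<n∨m≡n (s≤s⁻¹ b<1+s)
  ... | inj₁ b<s = inj₁ (a≤b , inj₂ (a≡i , b<s))
  ... | inj₂ b≡s = inj₂ (a≡i , b≡s)

  done-pred : ∀ {i s a b} → Done i s a b → Done i (suc s) a b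
  done-pred (a≤b , inj₁ a<i)         = a≤b , inj₁ a<i
  done-pred (a≤b , inj₂ (a≡i , b<s)) = a≤b , inj₂ (a≡i , m<n⇒m<1+n b<s)

  not-done : ∀ {i s} → ¬ Done i s i s
  not-done (_ , inj₁ h)         = <-irrefl refl h
  not-done (_ , inj₂ (_ , h))   = <-irrefl refl h

  done-unrow : ∀ {i a b} → b ≤ N → Done (suc i) (suc i) a b → Done i K a b
  done-unrow b≤N (a≤b , inj₁ a<1+i) with m≤n⇒m<n∨m≡n (s≤s⁻¹ a<1+i)
  ... | inj₁ a<i = a≤b , inj₁ a<i
  ... | inj₂ a≡i = a≤b , inj₂ (a≡i , s≤s b≤N)
  done-unrow b≤N (a≤b , inj₂ (refl , b<a)) = contradiction a≤b (<⇒≱ b<a)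

  done-row : ∀ {i a b} → Done i K a b → Done (suc i) (suc i) a b
  done-row (a≤b , inj₁ a<i)        = a≤b , inj₁ (m<n⇒m<1+n a<i)
  done-row (a≤b , inj₂ (refl , _)) = a≤b , inj₁ ≤-refl

  tabulated-row : ∀ {M i} → Tabulated M i K → Tabulated M (suc i) (suc i)
  tabulated-row tab = record
    { input    = input tab
    ; longest  = λ 1≤a b≤N δ → longest tab 1≤a b≤N (done-unrow b≤N δ)
    ; shortest = λ 1≤a b≤N δ → shortest tab 1≤a b≤N (done-unrow b≤N δ)
    ; fresh₀   = λ 1≤a b≤N ¬δ → fresh₀ tab 1≤a b≤N λ δ → ¬δ (done-row δ)
    ; fresh₁   = λ 1≤a b≤N ¬δ → fresh₁ tab 1≤a b≤N λ δ → ¬δ (done-row δ)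
    ; sound    = sound tab
    ; complete = λ 1≤a b≤N 1≤d δ → complete tab 1≤a b≤N 1≤d (done-unrow b≤N δ)
    }

  -- Without a border nothing is written, since the cells already contain 0.
  tabulated-skip : ∀ {M i s} → 1 ≤ i → s ≤ N → Longest i s 0 → Tabulated M i s → Tabulated M i (suc s)
  tabulated-skip {M} {i} {s} 1≤i s≤N λ₀ tab = record
    { input    = input tab
    ; longest  = λ {a} {b} 1≤a b≤N δ → longest′ 1≤a b≤N (done-suc δ)
    ; shortest = λ {a} {b} 1≤a b≤N δ → shortest′ 1≤a b≤N (done-suc δ)
    ; fresh₀   = λ 1≤a b≤N ¬δ → fresh₀ tab 1≤a b≤N λ δ → ¬δ (done-pred δ)
    ; fresh₁   = λ 1≤a b≤N ¬δ → fresh₁ tab 1≤a b≤N λ δ → ¬δ (done-pred δ)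
    ; sound    = sound tab
    ; complete = λ 1≤a b≤N 1≤d δ → complete′ 1≤a b≤N 1≤d (done-suc δ)
    }
    where
    longest′ : ∀ {a b} → 1 ≤ a → b ≤ N → Done i s a b ⊎ (a ≡ i × b ≡ s) → Longest a b (M (cellOf 0 a b))
    longest′ 1≤a b≤N (inj₁ δ)             = longest tab 1≤a b≤N δ
    longest′ 1≤a b≤N (inj₂ (refl , refl)) = subst (Longest i s) (sym (fresh₀ tab 1≤a b≤N not-done)) λ₀
    shortest′ : ∀ {a b} → 1 ≤ a → b ≤ N → Done i s a b ⊎ (a ≡ i × b ≡ s) → Shortest a b (M (cellOf 1 a b))
    shortest′ 1≤a b≤N (inj₁ δ)             = shortest tab 1≤a b≤N δ
    shortest′ 1≤a b≤N (inj₂ (refl , refl)) =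
      subst (Shortest i s) (sym (fresh₁ tab 1≤a b≤N not-done)) (longest-0⇒shortest λ₀)
    complete′ : ∀ {a r d} → 1 ≤ a → r + d ≤ N → 1 ≤ d → Done i s a (r + d) ⊎ (a ≡ i × r + d ≡ s) →
                Shortest a (r + d) d → M (cellOf 2 (a + d) r) ≡ d
    complete′ 1≤a b≤N 1≤d (inj₁ δ)          σ = complete tab 1≤a b≤N 1≤d δ σ
    complete′ 1≤a b≤N 1≤d (inj₂ (refl , r+d≡s)) σ =
      contradiction (≤-trans 1≤d (proj₂ λ₀ _ (proj₁ (subst (λ s → Shortest i s _) r+d≡s σ) 1≤d))) λ ()

  module Write (M : ℕ → ℕ) {t a b : ℕ} (v : ℕ) (t<3 : t < 3) (1≤a : 1 ≤ a) (b≤N : b ≤ N) where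

    M′ : ℕ → ℕ
    M′ = M [ cellOf t a b ≔ v ]

    written : M′ (cellOf t a b) ≡ v
    written = ≔-same M _ v

    unwritten : ∀ {t′ a′ b′} → t′ < 3 → b′ ≤ N → (t ≡ t′ → a ≡ a′ → b ≡ b′ → ⊥) →
                M′ (cellOf t′ a′ b′) ≡ M (cellOf t′ a′ b′)
    unwritten {t′} {a′} {b′} t′<3 b′≤N h≢ = ≔-other M v λ e →
      let t≡ , a≡ , b≡ = address-injective {a = a} {a′ = a′} t<3 t′<3 (s≤s b≤N) (s≤s b′≤N) e in h≢ t≡ a≡ b≡

    unwritten-input : ∀ {x} → x ≤ N → M′ x ≡ M x
    unwritten-input x≤N = ≔-other M v λ e → <⇒≱ (beyond t b 1≤a) (≤-trans (≤-reflexive e) x≤N)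

  -- The delicate field is `complete`: an extension recorded at the same cell of table 2 must not be
  -- destroyed, and `extension-unique` shows that its length is the one being written.
  tabulated-write : ∀ {M i s k d r} → 1 ≤ i → s ≤ N → Longest i s k → Shortest i s d → 1 ≤ d → r + d ≡ s →
    Tabulated M i s →
    Tabulated (((M [ cellOf 0 i s ≔ k ]) [ cellOf 1 i s ≔ d ]) [ cellOf 2 (i + d) r ≔ d ]) i (suc s)
  tabulated-write {M} {i} {s} {k} {d} {r} 1≤i s≤N λₖ σ 1≤d refl tab = record
    { input    = λ x≤N → trans (W₂.unwritten-input x≤N) (trans (W₁.unwritten-input x≤N) (trans (W₀.unwritten-input x≤N) (input tab x≤N)))
    ; longest  = λ {a} {b} 1≤a b≤N δ → longest′ 1≤a b≤N (done-suc δ)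
    ; shortest = λ {a} {b} 1≤a b≤N δ → shortest′ 1≤a b≤N (done-suc δ)
    ; fresh₀   = λ 1≤a b≤N ¬δ → trans (keep₀ b≤N λ { refl refl → ¬δ now }) (fresh₀ tab 1≤a b≤N λ δ → ¬δ (done-pred δ))
    ; fresh₁   = λ 1≤a b≤N ¬δ → trans (keep₁ b≤N λ { refl refl → ¬δ now }) (fresh₁ tab 1≤a b≤N λ δ → ¬δ (done-pred δ))
    ; sound    = sound′
    ; complete = λ 1≤a b≤N 1≤d δ → complete′ 1≤a b≤N 1≤d (done-suc δ)
    }
    where
    r≤N : r ≤ N
    r≤N = ≤-trans (m≤m+n r d) s≤N
    i≤s : i ≤ r + d
    i≤s with p , i<p , p+d , _ ← proj₁ σ 1≤d = linear 5 (λ i p r d s → i ≺ p ⇛ p ⊞ d ≊ con 1 ⊞ s ⇛ con 1 ≼ d ⇛ goal (i ≼ s)) i p r d (r + d) i<p p+d 1≤d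
    now : Done i (suc (r + d)) i (r + d)
    now = i≤s , inj₂ (refl , ≤-refl)
    module W₀ = Write M {0} {i} {r + d} k (s≤s z≤n) 1≤i s≤N
    module W₁ = Write W₀.M′ {1} {i} {r + d} d (s≤s (s≤s z≤n)) 1≤i s≤N
    module W₂ = Write W₁.M′ {2} {i + d} {r} d ≤-refl (≤-trans 1≤i (m≤m+n i d)) r≤N
    keep₀ : ∀ {a b} → b ≤ N → (i ≡ a → r + d ≡ b → ⊥) → W₂.M′ (cellOf 0 a b) ≡ M (cellOf 0 a b)
    keep₀ b≤N h≢ = trans (W₂.unwritten (s≤s z≤n) b≤N λ ()) (trans (W₁.unwritten (s≤s z≤n) b≤N λ ()) (W₀.unwritten (s≤s z≤n) b≤N λ _ → h≢))
    keep₁ : ∀ {a b} → b ≤ N → (i ≡ a → r + d ≡ b → ⊥) → W₂.M′ (cellOf 1 a b) ≡ M (cellOf 1 a b)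
    keep₁ b≤N h≢ = trans (W₂.unwritten (s≤s (s≤s z≤n)) b≤N λ ()) (trans (W₁.unwritten (s≤s (s≤s z≤n)) b≤N λ _ → h≢) (W₀.unwritten (s≤s (s≤s z≤n)) b≤N λ ()))
    keep₂ : ∀ {a b} → b ≤ N → (i + d ≡ a → r ≡ b → ⊥) → W₂.M′ (cellOf 2 a b) ≡ M (cellOf 2 a b)
    keep₂ b≤N h≢ = trans (W₂.unwritten ≤-refl b≤N λ _ → h≢) (trans (W₁.unwritten ≤-refl b≤N λ ()) (W₀.unwritten ≤-refl b≤N λ ()))
    at₀ : W₂.M′ (cellOf 0 i (r + d)) ≡ k
    at₀ = trans (W₂.unwritten (s≤s z≤n) s≤N λ ()) (trans (W₁.unwritten (s≤s z≤n) s≤N λ ()) W₀.written)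
    at₁ : W₂.M′ (cellOf 1 i (r + d)) ≡ d
    at₁ = trans (W₂.unwritten (s≤s (s≤s z≤n)) s≤N λ ()) W₁.written
    longest′ : ∀ {a b} → 1 ≤ a → b ≤ N → Done i (r + d) a b ⊎ (a ≡ i × b ≡ r + d) → Longest a b (W₂.M′ (cellOf 0 a b))
    longest′ 1≤a b≤N (inj₂ (refl , refl)) = subst (Longest _ _) (sym at₀) λₖ
    longest′ 1≤a b≤N (inj₁ δ)             =
      subst (Longest _ _) (sym (keep₀ b≤N λ { refl refl → not-done δ })) (longest tab 1≤a b≤N δ)
    shortest′ : ∀ {a b} → 1 ≤ a → b ≤ N → Done i (r + d) a b ⊎ (a ≡ i × b ≡ r + d) → Shortest a b (W₂.M′ (cellOf 1 a b))
    shortest′ 1≤a b≤N (inj₂ (refl , refl)) = subst (Shortest _ _) (sym at₁) σ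
    shortest′ 1≤a b≤N (inj₁ δ)             =
      subst (Shortest _ _) (sym (keep₁ b≤N λ { refl refl → not-done δ })) (shortest tab 1≤a b≤N δ)
    Sound : ℕ → ℕ → ℕ → Set
    Sound l r e = ∃[ a ] 1 ≤ a × a + e ≡ l × r + e ≤ N × Shortest a (r + e) e
    sound′ : ∀ {l r} → 1 ≤ l → r ≤ N → 1 ≤ W₂.M′ (cellOf 2 l r) → Sound l r (W₂.M′ (cellOf 2 l r))
    sound′ {l} {r′} 1≤l r′≤N 1≤e with i + d ≟ l | r ≟ r′
    ... | yes refl | yes refl = subst (Sound l r) (sym W₂.written) (i , 1≤i , refl , s≤N , σ)
    ... | no h≢     | _        = subst (Sound l r′) (sym kept) (sound tab 1≤l r′≤N (subst (1 ≤_) kept 1≤e))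
      where
      kept : W₂.M′ (cellOf 2 l r′) ≡ M (cellOf 2 l r′)
      kept = keep₂ r′≤N λ e _ → h≢ e
    ... | yes _    | no h≢     = subst (Sound l r′) (sym kept) (sound tab 1≤l r′≤N (subst (1 ≤_) kept 1≤e))
      where
      kept : W₂.M′ (cellOf 2 l r′) ≡ M (cellOf 2 l r′)
      kept = keep₂ r′≤N λ _ e → h≢ e
    complete′ : ∀ {a r′ d′} → 1 ≤ a → r′ + d′ ≤ N → 1 ≤ d′ → Done i (r + d) a (r′ + d′) ⊎ (a ≡ i × r′ + d′ ≡ r + d) →
                Shortest a (r′ + d′) d′ → W₂.M′ (cellOf 2 (a + d′) r′) ≡ d′
    complete′ {a} {r′} {d′} 1≤a b≤N 1≤d′ δ σ′ with i + d ≟ a + d′ | r ≟ r′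
    ... | yes e | yes refl = trans (cong (λ l → W₂.M′ (cellOf 2 l r)) (sym e)) (trans W₂.written (extension-unique 1≤d 1≤d′ e σ σ′))
    complete′ {a} {r′} {d′} 1≤a b≤N 1≤d′ (inj₁ δ) σ′ | no h≢ | _ =
      trans (keep₂ (≤-trans (m≤m+n r′ d′) b≤N) λ e _ → h≢ e) (complete tab 1≤a b≤N 1≤d′ δ σ′)
    complete′ {a} {r′} {d′} 1≤a b≤N 1≤d′ (inj₁ δ) σ′ | yes _ | no h≢ =
      trans (keep₂ (≤-trans (m≤m+n r′ d′) b≤N) λ _ e → h≢ e) (complete tab 1≤a b≤N 1≤d′ δ σ′)
    complete′ {a} {r′} {d′} 1≤a b≤N 1≤d′ (inj₂ (refl , e)) σ′ | no h≢ | _ =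
      contradiction (cong (i +_) (shortest-unique σ (subst (λ s → Shortest i s d′) e σ′))) h≢
    complete′ {a} {r′} {d′} 1≤a b≤N 1≤d′ (inj₂ (refl , e)) σ′ | yes e′ | no h≢
      with refl ← +-cancelˡ-≡ i d d′ e′ = contradiction (sym (+-cancelʳ-≡ d r′ r e)) h≢

-- `2 * suc N + k ≤ m + 2 * suc s` states, without subtraction, that `m` iterations suffice. The
-- factor 2 on the position pays for the growth of `k` on a match, leaving a decrease of one.
potential-exit : ∀ N s k → 2 * suc N + k ≤ 2 * suc s → suc s ≤ N → ⊥
potential-exit = linear 3 λ N s k → 2 ⊠ (con 1 ⊞ N) ⊞ k ≼ 2 ⊠ (con 1 ⊞ s) ⇛ s ≺ N ⇛ absurd

potential-match : ∀ N k m s → 2 * suc N + k ≤ suc m + 2 * suc s → 2 * suc N + suc k ≤ m + 2 * suc (suc s)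
potential-match = linear 4 λ N k m s →
  2 ⊠ (con 1 ⊞ N) ⊞ k ≼ con 1 ⊞ m ⊞ 2 ⊠ (con 1 ⊞ s) ⇛ goal (2 ⊠ (con 1 ⊞ N) ⊞ (con 1 ⊞ k) ≼ m ⊞ 2 ⊠ (con 2 ⊞ s))

potential-skip : ∀ N m s → 2 * suc N + 0 ≤ suc m + 2 * suc s → 2 * suc N + 0 ≤ m + 2 * suc (suc s)
potential-skip = linear 3 λ N m s →
  2 ⊠ (con 1 ⊞ N) ⊞ con 0 ≼ con 1 ⊞ m ⊞ 2 ⊠ (con 1 ⊞ s) ⇛ goal (2 ⊠ (con 1 ⊞ N) ⊞ con 0 ≼ m ⊞ 2 ⊠ (con 2 ⊞ s))

potential-retry : ∀ N k f m s i p → 2 * suc N + suc k ≤ suc m + 2 * suc s → i < p → p + f ≡ suc (i + k) →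
                  2 * suc N + f ≤ m + 2 * suc s
potential-retry = linear 7 λ N k f m s i p →
  2 ⊠ (con 1 ⊞ N) ⊞ (con 1 ⊞ k) ≼ con 1 ⊞ m ⊞ 2 ⊠ (con 1 ⊞ s) ⇛ i ≺ p ⇛ p ⊞ f ≊ con 1 ⊞ (i ⊞ k) ⇛
  goal (2 ⊠ (con 1 ⊞ N) ⊞ f ≼ m ⊞ 2 ⊠ (con 1 ⊞ s))

potential-start : ∀ K i → 2 * K + 0 ≤ 2 * K + 2 * suc i
potential-start = linear 2 λ K i → goal (2 ⊠ K ⊞ con 0 ≼ 2 ⊠ K ⊞ 2 ⊠ (con 1 ⊞ i))

-- 14 = 3 + 4 + 2 + 4 + 1 counts the loop test, the three assignments and the jump back. They are
-- paid by the last of the `2 * K + 2` units; the one before it pays for leaving the inner loop.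
row-cost : ∀ u K → 14 ≤ u → 3 + (4 + (2 + ((u * (2 * K) + u) + 4))) + 1 ≤ u * (2 * K + 2)
row-cost u K 14≤u = ≤-trans (bound u (u * (2 * K)) 14≤u) (≤-reflexive (distribute u K))
  where
  bound : ∀ u x → 14 ≤ u → 3 + (4 + (2 + ((x + u) + 4))) + 1 ≤ x + 2 * u
  bound = linear 2 λ u x → con 14 ≼ u ⇛ goal (con 3 ⊞ (con 4 ⊞ (con 2 ⊞ ((x ⊞ u) ⊞ con 4))) ⊞ con 1 ≼ x ⊞ 2 ⊠ u)
  distribute : ∀ u K → u * (2 * K) + 2 * u ≡ u * (2 * K + 2)
  distribute = solve-∀

-- Running time of the tabulation

module ScanExecution (w N : ℕ) (ch : ℕ → ℕ) (room : (3 * suc N + 3) * suc N ≤ 2 ^ w) where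

  open BorderTheory ch
  open Execution w
  open Tabulation w N ch room

  vars : (i s k d l r : ℕ) → Vec ℕ 8
  vars i s k d l r = N ∷ K ∷ i ∷ s ∷ k ∷ d ∷ l ∷ r ∷ []

  ≡ᵇ-true : ∀ {m n} → m ≡ n → (m ≡ᵇ n) ≡ true
  ≡ᵇ-true {m} refl = ≡ᵇ-refl m

  run-onMatch : ∀ {i s k d v r l r₀ d₀ M O} → 1 ≤ i → i + k ≤ s → suc s ≤ N → 1 ≤ d → i + d ≤ K → r + d ≡ suc s →
    M (cellOf 1 i (i + k)) ≡ v → v ≡ 0 × d ≡ suc k ⊎ 1 ≤ v × d ≡ v →
    Run onMatch ⟨ vars i (suc s) k d₀ l r₀ , M , O ⟩ 100
      ⟨ vars i (suc (suc s)) (suc k) d l r₀ ,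
        ((M [ cellOf 0 i (suc s) ≔ suc k ]) [ cellOf 1 i (suc s) ≔ d ]) [ cellOf 2 (i + d) r ≔ d ] , O ⟩
  run-onMatch {i} {s} {k} {d} {v} {r} {l} {r₀} {d₀} {M} {O} 1≤i i+k≤s s<N 1≤d i+d≤K r+d M≡v choice =
    run-≤ (≤ᵇ⇒≤ _ 100 tt)
      (run-seq (run-set (fits-load (fits-cell 1 𝑖 (𝑖 ⊕ 𝑘) (s≤s z≤n) tt (tt , tt , small′ i+k≤K) i≤K i+k≤N))
                        (trans (cong M address-≡) M≡v))
      (run-seq (run-set (fit (tt , numeral (s≤s z≤n) , small′ (≤-trans (≤-reflexive (+-comm k 1)) 1+k≤K))) (+-comm k 1))
      (run-seq (run-write (fits-cell 0 𝑖 𝑠 z≤n tt tt i≤K s<N) (fit tt) address-≡ refl)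
      (run-seq (run-choice choice)
      (run-seq (run-write (fits-cell 1 𝑖 𝑠 (s≤s z≤n) tt tt i≤K s<N) (fit tt) address-≡ refl)
      (run-seq (run-write (fits-cell 2 (𝑖 ⊕ 𝑑) (𝑠 ⊖ 𝑑) ≤-refl (tt , tt , small′ i+d≤K) (tt , tt , d≤s , small′ (≤-trans s<N (n≤1+n N)))
                             i+d≤K (≤-trans (m∸n≤m (suc s) d) s<N))
                          (fit tt) (trans (cong (((i + d) * 3 + 2) * K +_) s∸d) address-≡) refl)
               (run-set (fit (tt , numeral (s≤s z≤n) , small′ (≤-trans (≤-reflexive (+-comm (suc s) 1)) (s≤s s<N)))) (+-comm (suc s) 1))))))))
    where
    small′ : ∀ {x} → x ≤ K → x < W
    small′ x≤K = small (≤-trans x≤K (≤-trans (n≤1+n K) (n≤1+n (suc K))))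
    i≤K : i ≤ K
    i≤K = ≤-trans (m≤m+n i d) i+d≤K
    i+k≤N : i + k ≤ N
    i+k≤N = ≤-trans i+k≤s (≤-trans (n≤1+n s) s<N)
    i+k≤K : i + k ≤ K
    i+k≤K = ≤-trans i+k≤N (n≤1+n N)
    1+k≤K : suc k ≤ K
    1+k≤K = ≤-trans (+-monoˡ-≤ k 1≤i) i+k≤K
    d≤s : d ≤ suc s
    d≤s = subst (d ≤_) r+d (m≤n+m d r)
    s∸d : suc s ∸ d ≡ r
    s∸d = trans (cong (_∸ d) (sym r+d)) (m+n∸n≡m r d)
    run-choice : v ≡ 0 × d ≡ suc k ⊎ 1 ≤ v × d ≡ v → ∀ {M O} →
                 Run (ifₜ # 0 ≺ₜ 𝑑 then 5F := 𝑑 else 5F := 𝑘) ⟨ vars i (suc s) (suc k) v l r₀ , M , O ⟩ 10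
                     ⟨ vars i (suc s) (suc k) d l r₀ , M , O ⟩
    run-choice (inj₁ (refl , refl)) = run-≤ (≤ᵇ⇒≤ _ 10 tt) (run-else (numeral z≤n , tt) refl (run-set (fit tt) refl))
    run-choice (inj₂ (1≤v , refl))  = run-≤ (≤ᵇ⇒≤ _ 10 tt) (run-then (numeral z≤n , tt) (<ᵇ-true 1≤v) (run-set (fit tt) refl))

  run-retry : ∀ {i s k f d l r M O} → 1 ≤ i → i + k ≤ N → M (cellOf 0 i (i + k)) ≡ f →
    Run onMismatch ⟨ vars i s (suc k) d l r , M , O ⟩ 50 ⟨ vars i s f d l r , M , O ⟩
  run-retry {i} {s} {k} {f} {M = M} 1≤i i+k≤N M≡f = run-≤ (≤ᵇ⇒≤ _ 50 tt)
    (run-then (numeral z≤n , tt) refl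
      (run-set (fits-load (fits-cell 0 𝑖 (𝑖 ⊕ 𝑘 ⊖ # 1) z≤n tt
                  ((tt , tt , i+k<W) , numeral (s≤s z≤n) , ≤-trans 1≤i (m≤m+n i (suc k)) , i+k<W)
                  (≤-trans (m≤m+n i k) (≤-trans i+k≤N (n≤1+n N))) (≤-trans (≤-reflexive pred≡) i+k≤N)))
               (trans (cong M (trans (cong ((i * 3 + 0) * K +_) pred≡) address-≡)) M≡f)))
    where
    pred≡ : i + suc k ∸ 1 ≡ i + k
    pred≡ = cong (_∸ 1) (+-suc i k)
    i+k<W : i + suc k < W
    i+k<W = small (≤-trans (≤-reflexive (+-suc i k)) (≤-trans (s≤s i+k≤N) (≤-trans (n≤1+n K) (n≤1+n (suc K)))))

  run-skip : ∀ {i s d l r M O} → suc s ≤ N →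
    Run onMismatch ⟨ vars i (suc s) 0 d l r , M , O ⟩ 50 ⟨ vars i (suc (suc s)) 0 d l r , M , O ⟩
  run-skip {s = s} s<N = run-≤ (≤ᵇ⇒≤ _ 50 tt)
    (run-else (numeral z≤n , tt) refl
      (run-set (fit (tt , numeral (s≤s z≤n) , small (≤-trans (≤-reflexive (+-comm (suc s) 1)) (≤-trans (s≤s s<N) (≤-trans (n≤1+n K) (n≤1+n (suc K)))))))
               (+-comm (suc s) 1)))

  Scanned : (m i s k d l r : ℕ) → (ℕ → ℕ) → List ℕ → Set
  Scanned m i s k d l r M O = ∃[ k′ ] ∃[ d′ ] ∃[ M′ ]
    Run scanRow ⟨ vars i (suc s) k d l r , M , O ⟩ (unit * m + unit) ⟨ vars i K k′ d′ l r , M′ , O ⟩ × Tabulated M′ i K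

  -- The potential 2 (K - s) + k decreases in every iteration.
  run-scanRow : ∀ m {i s k d l r M O} → 1 ≤ i → i ≤ s → s ≤ N → 2 * K + k ≤ m + 2 * suc s →
    Candidate i s k → Tabulated M i (suc s) → Scanned m i s k d l r M O
  run-scanRow m {i} {s} {k} {d} {l} {r} {M} {O} 1≤i i≤s s≤N pot cand tab with m≤n⇒m<n∨m≡n s≤N
  ... | inj₂ refl = k , d , M , run-≤ (≤-trans (affordable (≤ᵇ⇒≤ _ 120 tt)) (m≤n+m unit (unit * m)))
                      (run-exit (tt , tt) (<ᵇ-false {K} {K} ≤-refl)) , tab
  run-scanRow zero {s = s} {k} 1≤i i≤s s≤N pot cand tab | inj₁ s<N = ⊥-elim (potential-exit N s k pot s<N)
  run-scanRow (suc m) {i} {s} {k} {d} {l} {r} {M} {O} 1≤i i≤s s≤N pot cand tab | inj₁ s<N =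
    case-split (ch (i + k) ≟ ch (suc s))
    where
    Goal : Set
    Goal = Scanned (suc m) i s k d l r M O

    i+k≤s : i + k ≤ s
    i+k≤s with p , i<p , p+k , _ ← proj₁ cand =
      linear 4 (λ i p k s → i ≺ p ⇛ p ⊞ k ≊ con 1 ⊞ s ⇛ goal (i ⊞ k ≼ s)) i p k s i<p p+k
    i+k≤N : i + k ≤ N
    i+k≤N = ≤-trans i+k≤s s≤N

    fits : Fitsₜ (vars i (suc s) k d l r) M W (! (𝑖 ⊕ 𝑘) ≡ₜ ! 𝑠)
    fits = (tt , tt , small (≤-trans i+k≤N (≤-trans (n≤1+n N) (≤-trans (n≤1+n K) (n≤1+n (suc K)))))) , tt

    enter : ∀ {s₁ k₁ d₁ M₁ c} → c ≤ 110 →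
            Run scan ⟨ vars i (suc s) k d l r , M , O ⟩ c ⟨ vars i (suc s₁) k₁ d₁ l r , M₁ , O ⟩ →
            Scanned m i s₁ k₁ d₁ l r M₁ O → Goal
    enter c≤ now (k′ , d′ , M′ , later , tab′) = k′ , d′ , M′ ,
      -- 3 steps for the loop test, at most 110 for the body and 1 for the jump back stay below the
      -- unit of 120.
      run-≤ (loop-cost unit m (affordable (≤-trans (+-monoˡ-≤ 1 (+-monoʳ-≤ 3 c≤)) (≤ᵇ⇒≤ _ 120 tt))))
        (run-loop (tt , tt) (<ᵇ-true (s≤s s<N)) now later) ,
      tab′

    matched : ∀ {v d′} → ch (i + k) ≡ ch (suc s) → M (cellOf 1 i (i + k)) ≡ v →
              v ≡ 0 × d′ ≡ suc k ⊎ 1 ≤ v × d′ ≡ v → 1 ≤ d′ → Shortest i (suc s) d′ → Goal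
    matched {v} {d′} h M≡v choice 1≤d′ σ
      with p , i<p , p+d , _ ← proj₁ σ 1≤d′
      -- The right occurrence begins at `suc q`, so `q` is the last position of the inner substring
      -- and indexes the cell of table 2 that is written.
      with q , refl ← m≤n⇒∃[o]m+o≡n (≤-trans 1≤i (<⇒≤ i<p))
      with dis ← shortest-disjoint 1≤d′ σ =
      enter (≤ᵇ⇒≤ _ 110 tt)
        (run-then fits (≡ᵇ-true (trans (input tab i+k≤N) (trans h (sym (input tab s<N)))))
          (run-onMatch 1≤i i+k≤s s<N 1≤d′
            (linear 4 (λ i d s N → i ⊞ d ⊞ d ≼ con 2 ⊞ s ⇛ con 1 ≼ d ⇛ s ≺ N ⇛ goal (i ⊞ d ≼ con 1 ⊞ N)) i d′ s N dis 1≤d′ s<N)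
            (suc-injective p+d) M≡v choice))
        (run-scanRow m 1≤i (m≤n⇒m≤1+n i≤s) s<N (potential-match N k m s pot)
          (longest⇒candidate (candidate-match cand h))
          (tabulated-write 1≤i s<N (candidate-match cand h) σ 1≤d′ (suc-injective p+d) tab))

    case-split : _ → Goal
    case-split (yes h) with M (cellOf 1 i (i + k)) in M≡ | shortest tab 1≤i i+k≤N (m≤m+n i k , inj₂ (refl , s≤s i+k≤s))
    ... | zero  | σ = matched h M≡ (inj₁ (refl , refl)) (s≤s z≤n) (shortest-longest (candidate-match cand h) σ)
    ... | suc v | σ = matched h M≡ (inj₂ (s≤s z≤n , refl)) (s≤s z≤n) (shortest-inherit (candidate-match cand h) σ)
    case-split (no h≢) = mismatch refl
      where
      differ : (M (i + k) ≡ᵇ M (suc s)) ≡ false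
      differ = ≢⇒≡ᵇ-false λ e → h≢ (trans (sym (input tab i+k≤N)) (trans e (input tab s<N)))
      mismatch : ∀ {k′} → k ≡ k′ → Goal
      mismatch {zero} refl =
        enter (≤ᵇ⇒≤ _ 110 tt) (run-else fits differ (run-skip s<N))
          (run-scanRow m 1≤i (m≤n⇒m≤1+n i≤s) s<N (potential-skip N m s pot) (longest⇒candidate λ₀)
            (tabulated-skip 1≤i s<N λ₀ tab))
        where
        λ₀ : Longest i (suc s) 0
        λ₀ = candidate-none i≤s cand λ e → h≢ (trans (cong ch (+-identityʳ i)) e)
      mismatch {suc k′} refl = retry (proj₁ λf)
        where
        j≤N : i + k′ ≤ N
        j≤N = ≤-trans (≤-trans (n≤1+n _) (≤-reflexive (sym (+-suc i k′)))) i+k≤N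
        λf : Longest i (i + k′) (M (cellOf 0 i (i + k′)))
        λf = longest tab 1≤i j≤N (m≤m+n i k′ , inj₂ (refl , ≤-trans (≤-reflexive (sym (+-suc i k′))) (m≤n⇒m≤1+n i+k≤s)))
        retry : Border i (i + k′) (M (cellOf 0 i (i + k′))) → Goal
        retry (p , i<p , p+f , _) =
          enter (≤ᵇ⇒≤ _ 110 tt) (run-else fits differ (run-retry 1≤i j≤N refl))
            (run-scanRow m 1≤i i≤s s≤N (potential-retry N k′ _ m s i p pot i<p p+f) (candidate-fail cand h≢ λf) tab)

  Rows : (n i s k d l r : ℕ) → (ℕ → ℕ) → List ℕ → Set
  Rows n i s k d l r M O = ∃[ s′ ] ∃[ k′ ] ∃[ d′ ] ∃[ M′ ]
    Run (while 𝑖 ≺ₜ 𝐾 repeat (3F := 𝑖 ⊕ # 1 ⨾ 4F := # 0 ⨾ scanRow ⨾ 2F := 𝑖 ⊕ # 1))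
        ⟨ vars i s k d l r , M , O ⟩ (unit * (2 * K + 2) * n + unit) ⟨ vars K s′ k′ d′ l r , M′ , O ⟩ ×
    Tabulated M′ K K

  run-rows : ∀ n {i s k d l r M O} → 1 ≤ i → i + n ≡ K → Tabulated M i i → Rows n i s k d l r M O
  run-rows zero {i} {s} {k} {d} {l} {r} {M} {O} 1≤i i+n tab rewrite trans (sym (+-identityʳ i)) i+n =
    s , k , d , M , run-≤ (≤-trans (affordable (≤ᵇ⇒≤ _ 120 tt)) (m≤n+m unit _)) (run-exit (tt , tt) (<ᵇ-false {K} {K} ≤-refl)) , tab
  run-rows (suc n) {i} {s} {k} {d} {l} {r} {M} {O} 1≤i i+n tab =
    -- Position `i` takes no iteration: a single letter has no border and its zero cells are already
    -- correct, so the scan starts at `suc i` with `k = 0`.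
    afterRow (run-scanRow (2 * K) 1≤i ≤-refl i≤N (potential-start K i)
      (longest⇒candidate longest-single) (tabulated-skip 1≤i i≤N longest-single tab))
    where
    i≤N : i ≤ N
    i≤N = linear 3 (λ i n N → i ⊞ (con 1 ⊞ n) ≊ con 1 ⊞ N ⇛ goal (i ≼ N)) i n N i+n
    increment : ∀ {s k d l r M} → Fit (vars i s k d l r) M W (𝑖 ⊕ # 1)
    increment = fit (tt , numeral (s≤s z≤n) ,
      small (linear 3 (λ i n N → i ⊞ (con 1 ⊞ n) ≊ con 1 ⊞ N ⇛ goal (i ⊞ con 1 ≼ con 3 ⊞ N)) i n N i+n))
    afterRows : ∀ {k₁ d₁ M₁} → Run scanRow ⟨ vars i (suc i) 0 d l r , M , O ⟩ (unit * (2 * K) + unit) ⟨ vars i K k₁ d₁ l r , M₁ , O ⟩ →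
                Rows n (suc i) K k₁ d₁ l r M₁ O → Rows (suc n) i s k d l r M O
    afterRows row (s′ , k′ , d′ , M′ , rest , tab′) = s′ , k′ , d′ , M′ ,
      run-≤ (loop-cost (unit * (2 * K + 2)) n (row-cost unit K (affordable (≤ᵇ⇒≤ _ 120 tt))))
        (run-loop (tt , tt) (<ᵇ-true (s≤s i≤N))
          (run-seq (run-set increment (+-comm i 1))
          (run-seq (run-set (fit (numeral z≤n)) refl)
          (run-seq row
                   (run-set increment (+-comm i 1)))))
          rest) ,
      tab′
    afterRow : Scanned (2 * K) i i 0 d l r M O → Rows (suc n) i s k d l r M O
    afterRow (k₁ , d₁ , M₁ , row , tab₁) =
      afterRows row (run-rows n (s≤s z≤n) (trans (sym (+-suc i n)) i+n) (tabulated-row tab₁))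

  run-tabulateBorders : ∀ {O} → (∀ {x} → N < x → ch x ≡ 0) →
    ∃[ s ] ∃[ k ] ∃[ d ] ∃[ M ]
      Run tabulateBorders ⟨ N ∷ 0 ∷ 0 ∷ 0 ∷ 0 ∷ 0 ∷ 0 ∷ 0 ∷ [] , ch , O ⟩ (unit * (2 * K + 2) * N + unit + 6)
          ⟨ vars K s k d 0 0 , M , O ⟩ ×
      Tabulated M K K
  run-tabulateBorders {O} outside = afterSetup (run-rows N {1} ≤-refl refl (tabulated-row (tabulated-start outside)))
    where
    afterSetup : Rows N 1 0 0 0 0 0 ch O → _
    afterSetup (s , k , d , M , rows , tab) = s , k , d , M ,
      run-≤ (≤-reflexive (+-comm 6 _))
        (run-seq (run-set (fit (tt , numeral (s≤s z≤n) ,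
                                small (≤-trans (≤-reflexive (+-comm N 1)) (≤-trans (n≤1+n K) (n≤1+n (suc K)))))) (+-comm N 1))
        (run-seq (run-set (fit (numeral (s≤s z≤n))) refl)
                 rows)) ,
      tab

-- Reporting the chains of extensions

-- The peeled lengths are not saved: table 2 leads back along the same chain, and the climb stops at
-- the substring it started from because that one has no extension.
peelLoop climbLoop reportChain visit reportRow reportAll : Cmd 8
peelLoop = while # 0 ≺ₜ 𝑑 repeat
  (emit 𝑙 ⨾ emit (𝑙 ⊕ 𝑑 ⊖ # 1) ⨾ 6F := 𝑙 ⊕ 𝑑 ⨾ 7F := 𝑟 ⊖ 𝑑 ⨾ 5F := ! cell 1 𝑙 𝑟)
climbLoop = while # 0 ≺ₜ 𝑑 repeat
  (emit (𝑟 ⊕ # 1) ⨾ emit (𝑟 ⊕ 𝑑) ⨾ 6F := 𝑙 ⊖ 𝑑 ⨾ 7F := 𝑟 ⊕ 𝑑 ⨾ 5F := ! cell 2 𝑙 𝑟)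
reportChain =
  6F := 𝑖 ⨾ 7F := 𝑠 ⨾ 5F := ! cell 1 𝑙 𝑟 ⨾ peelLoop ⨾
  emit 𝑙 ⨾ emit 𝑟 ⨾ 5F := ! cell 2 𝑙 𝑟 ⨾ climbLoop ⨾ emit (# 0)
-- `5F := 𝑑` serves as the empty command: a substring with an extension is reported only as part of
-- a longer chain.
visit = 5F := ! cell 2 𝑖 𝑠 ⨾ (ifₜ # 0 ≺ₜ 𝑑 then 5F := 𝑑 else reportChain) ⨾ 3F := 𝑠 ⊕ # 1
reportRow = while 𝑠 ≺ₜ 𝐾 repeat visit
reportAll = 2F := # 1 ⨾ while 𝑖 ≺ₜ 𝐾 repeat (3F := 𝑖 ⨾ reportRow ⨾ 2F := 𝑖 ⊕ # 1)

climb-cost : ∀ u e n → u * e + (u + n) ≡ u * suc e + n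
climb-cost = solve-∀

-- One unit per layer for each of the two loops, one for leaving each of them, and a third for the
-- 32 steps of the straight-line commands.
chain-cost : ∀ u e → 32 ≤ u →
             2 + (2 + (11 + ((u * e + u) + (2 + (2 + (11 + ((u * e + u) + 2))))))) ≤ u * (2 * e + 3)
chain-cost u e 32≤u = ≤-trans (bound u (u * e) 32≤u) (≤-reflexive (distribute u e))
  where
  bound : ∀ u x → 32 ≤ u → 2 + (2 + (11 + ((x + u) + (2 + (2 + (11 + ((x + u) + 2))))))) ≤ 2 * x + 3 * u
  bound = linear 2 λ u x → con 32 ≼ u ⇛
    goal (con 2 ⊞ (con 2 ⊞ (con 11 ⊞ ((x ⊞ u) ⊞ (con 2 ⊞ (con 2 ⊞ (con 11 ⊞ ((x ⊞ u) ⊞ con 2))))))) ≼ 2 ⊠ x ⊞ 3 ⊠ u)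
  distribute : ∀ u e → 2 * (u * e) + 3 * u ≡ u * (2 * e + 3)
  distribute = solve-∀

leaf-cost : ∀ u e n x → 32 ≤ u →
            (3 + (11 + ((3 + u * (2 * e + 3) + 1) + 4)) + 1) + (u * (n + 4 * x) + u) ≤ u * (suc n + 4 * (suc e + x)) + u
leaf-cost u e n x 32≤u = ≤-trans (bound u (u * e) (u * n) (u * x) _ _ 32≤u (distribute₁ u e) (distribute₂ u n x)) (≤-reflexive (distribute₃ u e n x))
  where
  bound : ∀ u y z t p q → 32 ≤ u → p ≡ 2 * y + 3 * u → q ≡ z + 4 * t →
          (3 + (11 + ((3 + p + 1) + 4)) + 1) + (q + u) ≤ 6 * u + z + 4 * y + 4 * t
  bound = linear 6 λ u y z t p q → con 32 ≼ u ⇛ p ≊ 2 ⊠ y ⊞ 3 ⊠ u ⇛ q ≊ z ⊞ 4 ⊠ t ⇛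
    goal ((con 3 ⊞ (con 11 ⊞ ((con 3 ⊞ p ⊞ con 1) ⊞ con 4)) ⊞ con 1) ⊞ (q ⊞ u) ≼ 6 ⊠ u ⊞ z ⊞ 4 ⊠ y ⊞ 4 ⊠ t)
  distribute₁ : ∀ u e → u * (2 * e + 3) ≡ 2 * (u * e) + 3 * u
  distribute₁ = solve-∀
  distribute₂ : ∀ u n x → u * (n + 4 * x) ≡ u * n + 4 * (u * x)
  distribute₂ = solve-∀
  distribute₃ : ∀ u e n x → 6 * u + u * n + 4 * (u * e) + 4 * (u * x) ≡ u * (suc n + 4 * (suc e + x)) + u
  distribute₃ = solve-∀

-- Of the `K + 2` units of a row, `K` pay for the positions, one for leaving the inner loop, and one
-- for the test, the assignments and the jump back.
rows-cost : ∀ u n m K x y → 20 ≤ u → n ≤ K →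
            (3 + (2 + ((u * (n + 4 * x) + u) + 4)) + 1) + (u * ((K + 2) * m + 4 * y) + u) ≤
            u * ((K + 2) * suc m + 4 * (x + y)) + u
rows-cost u n m K x y 20≤u n≤K =
  ≤-trans (bound u (u * n) (u * x) (u * ((K + 2) * m + 4 * y)) (u * K) _ 20≤u (*-monoʳ-≤ u n≤K) (distribute₁ u n x))
    (≤-reflexive (distribute₂ u m K x y))
  where
  bound : ∀ u z t q v p → 20 ≤ u → z ≤ v → p ≡ z + 4 * t →
          (3 + (2 + ((p + u) + 4)) + 1) + (q + u) ≤ v + 4 * t + q + 3 * u
  bound = linear 6 λ u z t q v p → con 20 ≼ u ⇛ z ≼ v ⇛ p ≊ z ⊞ 4 ⊠ t ⇛
    goal ((con 3 ⊞ (con 2 ⊞ ((p ⊞ u) ⊞ con 4)) ⊞ con 1) ⊞ (q ⊞ u) ≼ v ⊞ 4 ⊠ t ⊞ q ⊞ 3 ⊠ u)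
  distribute₁ : ∀ u n x → u * (n + 4 * x) ≡ u * n + 4 * (u * x)
  distribute₁ = solve-∀
  distribute₂ : ∀ u m K x y → u * K + 4 * (u * x) + u * ((K + 2) * m + 4 * y) + 3 * u ≡
                              u * ((K + 2) * suc m + 4 * (x + y)) + u
  distribute₂ = solve-∀

module Chains (ch : ℕ → ℕ) where

  open BorderTheory ch

  -- The shortest borders are split off the substring from i to s until an unbordered centre is left.
  data Chain : ℕ → ℕ → Set where
    centre : ∀ {i s} → i ≤ suc s → Shortest i s 0 → Chain i s
    layer  : ∀ {i s d} → 1 ≤ d → Shortest i (s + d) d → Chain (i + d) s → Chain i (s + d)

  innerˡ innerʳ depth : ∀ {i s} → Chain i s → ℕ
  innerˡ (centre {i} _ _) = i
  innerˡ (layer _ _ c)    = innerˡ c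
  innerʳ (centre {s = s} _ _) = s
  innerʳ (layer _ _ c)        = innerʳ c
  depth (centre _ _)  = 0
  depth (layer _ _ c) = suc (depth c)

  leftSpans rightSpans report : ∀ {i s} → Chain i s → List ℕ
  leftSpans (centre _ _)            = []
  leftSpans (layer {i} {s} {d} _ _ c) = i ∷ i + d ∸ 1 ∷ leftSpans c
  rightSpans (centre _ _)             = []
  rightSpans (layer {i} {s} {d} _ _ c) = rightSpans c ++ suc s ∷ s + d ∷ []
  report c = leftSpans c ++ innerˡ c ∷ innerʳ c ∷ rightSpans c ++ 0 ∷ []

  chain-ordered : ∀ {i s} → Chain i s → i ≤ suc s
  chain-ordered (centre h _) = h
  chain-ordered (layer {i} {s} {d} 1≤d σ c) =
    linear 3 (λ i s d → i ⊞ d ⊞ d ≼ con 1 ⊞ (s ⊞ d) ⇛ goal (i ≼ con 1 ⊞ (s ⊞ d))) i s d (shortest-disjoint 1≤d σ)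

  inner-ordered : ∀ {i s} (c : Chain i s) → i ≤ innerˡ c × innerˡ c ≤ suc (innerʳ c) × innerʳ c ≤ s
  inner-ordered (centre h _) = ≤-refl , h , ≤-refl
  inner-ordered (layer {i} {s} {d} _ _ c) with h₁ , h₂ , h₃ ← inner-ordered c =
    ≤-trans (m≤m+n i d) h₁ , h₂ , ≤-trans h₃ (m≤m+n s d)

-- Running time and output of the report

module ReportExecution (w N : ℕ) (ch : ℕ → ℕ) (room : (3 * suc N + 3) * suc N ≤ 2 ^ w) where

  open BorderTheory ch
  open Execution w
  open Tabulation w N ch room
  open ScanExecution w N ch room using (vars)
  open Chains ch

  module _ {M : ℕ → ℕ} (tab : Tabulated M K K) where

    -- Chains are pictured as growing outwards from the centre: the entry is the length of the
    -- extension, 0 if there is none, and substrings without extension are the leaves.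
    child : ℕ → ℕ → ℕ
    child i s = M (cellOf 2 i s)

    done-all : ∀ {a b} → a ≤ b → b ≤ N → Done K K a b
    done-all a≤b b≤N = a≤b , inj₁ (s≤s (≤-trans a≤b b≤N))

    -- `peelLoop` may end at an empty substring, `i = suc s`, which is never tabulated; its
    -- untouched cell holds 0, the correct value.
    shortest-cell : ∀ {i s} → 1 ≤ i → i ≤ suc s → s ≤ N → Shortest i s (M (cellOf 1 i s))
    shortest-cell {i} {s} 1≤i i≤ s≤N with m≤n⇒m<n∨m≡n i≤
    ... | inj₁ i<  = shortest tab 1≤i s≤N (done-all (s≤s⁻¹ i<) s≤N)
    ... | inj₂ refl = subst (Shortest (suc s) s) (sym (fresh₁ tab 1≤i s≤N (λ δ → <⇒≱ ≤-refl (proj₁ δ))))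
      ((λ ()) , λ { b 1≤b (p , i<p , p+b , _) →
        ⊥-elim (linear 3 (λ s p b → con 1 ⊞ s ≺ p ⇛ p ⊞ b ≊ con 1 ⊞ s ⇛ absurd) s p b i<p p+b) })

    chain-fuel : ∀ n {i s} → s ≤ n → 1 ≤ i → i ≤ suc s → s ≤ N → Chain i s
    chain-split : ∀ n {i s} v → s ≤ n → 1 ≤ i → i ≤ suc s → s ≤ N → Shortest i s v → Chain i s
    chain-fuel n {i} {s} s≤n 1≤i i≤ s≤N = chain-split n (M (cellOf 1 i s)) s≤n 1≤i i≤ s≤N (shortest-cell 1≤i i≤ s≤N)
    chain-split n zero s≤n 1≤i i≤ s≤N σ = centre i≤ σ
    chain-split n {i} {s} (suc v) s≤n 1≤i i≤ s≤N σ
      with p , i<p , p+v , _ ← proj₁ σ (s≤s z≤n)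
      with r , 1+r ← m≤n⇒∃[o]m+o≡n (≤-trans 1≤i (<⇒≤ i<p))
      with refl ← suc-injective (trans (cong (_+ suc v) 1+r) p+v)
      with n
    ... | zero  = contradiction (≤-trans (m≤n+m (suc v) r) s≤n) λ ()
    ... | suc n = layer (s≤s z≤n) σ (chain-fuel n
          (linear 3 (λ r v n → r ⊞ (con 1 ⊞ v) ≼ con 1 ⊞ n ⇛ goal (r ≼ n)) r v n s≤n)
          (≤-trans 1≤i (m≤m+n i (suc v)))
          (linear 3 (λ i r v → i ⊞ (con 1 ⊞ v) ⊞ (con 1 ⊞ v) ≼ con 1 ⊞ (r ⊞ (con 1 ⊞ v)) ⇛ goal (i ⊞ (con 1 ⊞ v) ≼ con 1 ⊞ r)) i r v
            (shortest-disjoint (s≤s z≤n) σ))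
          (≤-trans (m≤m+n r (suc v)) s≤N))

    chain : ∀ {i s} → 1 ≤ i → i ≤ suc s → s ≤ N → Chain i s
    chain {s = s} = chain-fuel s ≤-refl

    run-output : ∀ {v} {c : Cmd v} {s n ρ M′ O O′} → O ≡ O′ → Run c s n ⟨ ρ , M′ , O ⟩ → Run c s n ⟨ ρ , M′ , O′ ⟩
    run-output refl r = r

    ++-∷ʳ² : ∀ (O : List ℕ) {x y X} → ((O ∷ʳ x) ∷ʳ y) ++ X ≡ O ++ x ∷ y ∷ X
    ++-∷ʳ² O {x} {y} {X} = trans (++-assoc (O ∷ʳ x) (y ∷ []) X) (++-assoc O (x ∷ []) (y ∷ X))

    tiny : ∀ {x} → x ≤ K → x < W
    tiny x≤K = small (≤-trans x≤K (≤-trans (n≤1+n K) (n≤1+n (suc K))))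

    load-cell : ∀ {i s k d l r x} t → t ≤ 2 → l ≤ K → r ≤ N → M (cellOf t l r) ≡ x → ∀ {O} →
                Run (5F := ! cell t 𝑙 𝑟) ⟨ vars i s k d l r , M , O ⟩ (‖ cell t 𝑙 𝑟 ‖ + 1 + 1) ⟨ vars i s k x l r , M , O ⟩
    load-cell t t≤2 l≤K r≤N e = run-set (fits-load (fits-cell t 𝑙 𝑟 t≤2 tt tt l≤K r≤N)) (trans (cong M address-≡) e)

    run-peel : ∀ {i₀ s₀ k i s v} (c : Chain i s) → 1 ≤ i → s ≤ N → M (cellOf 1 i s) ≡ v → ∀ {O} →
      Run peelLoop ⟨ vars i₀ s₀ k v i s , M , O ⟩ (unit * depth c + unit)
        ⟨ vars i₀ s₀ k 0 (innerˡ c) (innerʳ c) , M , O ++ leftSpans c ⟩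
    run-peel (centre i≤ σ) 1≤i s≤N e {O}
      with refl ← trans (sym e) (shortest-unique (shortest-cell 1≤i i≤ s≤N) σ) =
      run-≤ (≤-trans (affordable (≤ᵇ⇒≤ _ 120 tt)) (m≤n+m unit (unit * 0))) (run-output (sym (++-identityʳ O)) (run-exit (numeral z≤n , tt) refl))
    run-peel {i₀} {s₀} {k} (layer {i} {s} {d} 1≤d σ c) 1≤i s≤N e {O}
      with refl ← trans (sym e) (shortest-unique (shortest-cell 1≤i (chain-ordered (layer 1≤d σ c)) s≤N) σ)
      with i+d≤ ← ≤-trans (chain-ordered c) (s≤s (≤-trans (m≤m+n s d) s≤N)) =
      run-≤ (loop-cost unit {c = 31} (depth c) (affordable (≤ᵇ⇒≤ 31 120 tt)))
        (run-output (++-∷ʳ² O)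
          (run-loop (numeral z≤n , tt) (<ᵇ-true 1≤d)
            (run-seq (run-emit (fit tt) refl)
            (run-seq (run-emit (fit ((tt , tt , tiny i+d≤) , numeral (s≤s z≤n) , ≤-trans 1≤i (m≤m+n i d) , tiny i+d≤)) refl)
            (run-seq (run-set (fit (tt , tt , tiny i+d≤)) refl)
            (run-seq (run-set (fit (tt , tt , m≤n+m d s , tiny (≤-trans s≤N (n≤1+n N)))) (m+n∸n≡m s d))
                     (load-cell 1 (s≤s z≤n) i+d≤ (≤-trans (m≤m+n s d) s≤N) refl)))))
            (run-peel c (≤-trans 1≤i (m≤m+n i d)) (≤-trans (m≤m+n s d) s≤N) refl)))

    -- The induction descends the chain from the outside while the program moves from the inside
    -- out. Therefore the remainder of the run, from the outer end of `c` on, is a hypothesis with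
    -- cost `n` and output `X`.
    run-climb : ∀ {i₀ s₀ k i s ρ n X} (c : Chain i s) → 1 ≤ i → s ≤ N →
      (∀ {O} → Run climbLoop ⟨ vars i₀ s₀ k (child i s) i s , M , O ⟩ n ⟨ ρ , M , O ++ X ⟩) → ∀ {O} →
      Run climbLoop ⟨ vars i₀ s₀ k (child (innerˡ c) (innerʳ c)) (innerˡ c) (innerʳ c) , M , O ⟩ (unit * depth c + n)
        ⟨ ρ , M , O ++ rightSpans c ++ X ⟩
    run-climb {n = n} (centre _ _) _ _ rest = run-≤ (m≤n+m n (unit * 0)) rest
    run-climb {i₀} {s₀} {k} {ρ = ρ} {n} {X} (layer {i} {s} {d} 1≤d σ c) 1≤i s≤N rest {O} =
      run-≤ (≤-reflexive (climb-cost unit (depth c) n))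
        (run-output (cong (O ++_) (sym (++-assoc (rightSpans c) (suc s ∷ s + d ∷ []) X)))
          (run-climb c (≤-trans 1≤i (m≤m+n i d)) (≤-trans (m≤m+n s d) s≤N) climb₁))
      where
      i+d≤ : i + d ≤ K
      i+d≤ = ≤-trans (chain-ordered c) (s≤s (≤-trans (m≤m+n s d) s≤N))
      child≡ : child (i + d) s ≡ d
      child≡ = complete tab 1≤i s≤N 1≤d (done-all i≤s s≤N) σ
        where
        i≤s : i ≤ s + d
        i≤s = linear 3 (λ i s d → i ⊞ d ⊞ d ≼ con 1 ⊞ (s ⊞ d) ⇛ con 1 ≼ d ⇛ goal (i ≼ s ⊞ d)) i s d (shortest-disjoint 1≤d σ) 1≤d
      s+d<W : s + d < W
      s+d<W = tiny (≤-trans s≤N (n≤1+n N))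
      climb₁ : ∀ {O} → Run climbLoop ⟨ vars i₀ s₀ k (child (i + d) s) (i + d) s , M , O ⟩ (unit + n)
                      ⟨ ρ , M , O ++ suc s ∷ s + d ∷ X ⟩
      climb₁ {O} rewrite child≡ = run-≤ (+-monoˡ-≤ n (affordable (≤ᵇ⇒≤ _ 120 tt)))
        (run-output (++-∷ʳ² O)
          (run-loop (numeral z≤n , tt) (<ᵇ-true 1≤d)
            (run-seq (run-emit (fit (tt , numeral (s≤s z≤n) , tiny (≤-trans (≤-reflexive (+-comm s 1)) (s≤s (≤-trans (m≤m+n s d) s≤N)))))
                       (+-comm s 1))
            (run-seq (run-emit (fit (tt , tt , s+d<W)) refl)
            (run-seq (run-set (fit (tt , tt , m≤n+m d i , tiny i+d≤)) (m+n∸n≡m i d))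
            (run-seq (run-set (fit (tt , tt , s+d<W)) refl)
                     (load-cell 2 ≤-refl (≤-trans (m≤m+n i d) i+d≤) s≤N refl)))))
            rest))

    run-reportChain : ∀ {i s k d l r} (c : Chain i s) → 1 ≤ i → s ≤ N → child i s ≡ 0 → ∀ {O} →
      Run reportChain ⟨ vars i s k d l r , M , O ⟩ (unit * (2 * depth c + 3)) ⟨ vars i s k 0 i s , M , O ++ report c ⟩
    run-reportChain {i} {s} {k} c 1≤i s≤N childless {O}
      with h₁ , h₂ , h₃ ← inner-ordered c =
      run-≤ (chain-cost unit (depth c) (affordable (≤ᵇ⇒≤ _ 120 tt)))
        (run-output assemble
          (run-seq (run-set (fit tt) refl)
          (run-seq (run-set (fit tt) refl)
          (run-seq (load-cell 1 (s≤s z≤n) (≤-trans (chain-ordered c) (s≤s s≤N)) s≤N refl)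
          (run-seq (run-peel c 1≤i s≤N refl)
          (run-seq (run-emit (fit tt) refl)
          (run-seq (run-emit (fit tt) refl)
          (run-seq (load-cell 2 ≤-refl (≤-trans h₂ (s≤s (≤-trans h₃ s≤N))) (≤-trans h₃ s≤N) refl)
          (run-seq (run-climb c 1≤i s≤N stop′)
                   (run-emit (fit (numeral z≤n)) refl))))))))))
      where
      stop′ : ∀ {O} → Run climbLoop ⟨ vars i s k (child i s) i s , M , O ⟩ unit ⟨ vars i s k 0 i s , M , O ++ [] ⟩
      stop′ {O} rewrite childless = run-≤ (affordable (≤ᵇ⇒≤ _ 120 tt)) (run-output (sym (++-identityʳ O)) (run-exit (numeral z≤n , tt) refl))
      open ≡-Reasoning
      assemble : (((O ++ leftSpans c) ∷ʳ innerˡ c) ∷ʳ innerʳ c ++ rightSpans c ++ []) ∷ʳ 0 ≡ O ++ report c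
      assemble = begin
        (((O ++ leftSpans c) ∷ʳ innerˡ c) ∷ʳ innerʳ c ++ rightSpans c ++ []) ∷ʳ 0
          ≡⟨ cong (_∷ʳ 0) (++-∷ʳ² (O ++ leftSpans c)) ⟩
        ((O ++ leftSpans c) ++ innerˡ c ∷ innerʳ c ∷ rightSpans c ++ []) ∷ʳ 0
          ≡⟨ cong (λ X → ((O ++ leftSpans c) ++ innerˡ c ∷ innerʳ c ∷ X) ∷ʳ 0) (++-identityʳ (rightSpans c)) ⟩
        ((O ++ leftSpans c) ++ innerˡ c ∷ innerʳ c ∷ rightSpans c) ∷ʳ 0
          ≡⟨ ++-assoc (O ++ leftSpans c) _ (0 ∷ []) ⟩
        (O ++ leftSpans c) ++ innerˡ c ∷ innerʳ c ∷ rightSpans c ++ 0 ∷ []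
          ≡⟨ ++-assoc O (leftSpans c) _ ⟩
        O ++ report c ∎

    record Leaf : Set where
      constructor leaf
      field
        {first last} : ℕ
        1≤first      : 1 ≤ first
        ordered      : first ≤ last
        last≤N       : last ≤ N
        childless    : child first last ≡ 0

      leafChain : Chain first last
      leafChain = chain 1≤first (m≤n⇒m≤1+n ordered) last≤N

    open Leaf public

    -- `n` counts the positions left in the row; the list follows the recursion of the loop, so that
    -- the run can be shown to report exactly its entries.
    rowLeaves : ∀ n {i s} → s + n ≡ K → 1 ≤ i → i ≤ s → List Leaf
    rowLeaves zero    _   _   _   = []
    rowLeaves (suc n) {i} {s} s+n 1≤i i≤s with child i s ≟ 0
    ... | yes h = leaf 1≤i i≤s (linear 3 (λ s n N → s ⊞ (con 1 ⊞ n) ≊ con 1 ⊞ N ⇛ goal (s ≼ N)) s n N s+n) h ∷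
                  rowLeaves n (trans (sym (+-suc s n)) s+n) 1≤i (m≤n⇒m≤1+n i≤s)
    ... | no _  = rowLeaves n (trans (sym (+-suc s n)) s+n) 1≤i (m≤n⇒m≤1+n i≤s)

    allLeaves : ∀ n {i} → i + n ≡ K → 1 ≤ i → List Leaf
    allLeaves zero    _   _   = []
    allLeaves (suc n) {i} i+n 1≤i = rowLeaves (suc n) i+n 1≤i ≤-refl ++ allLeaves n (trans (sym (+-suc i n)) i+n) (s≤s z≤n)

    reports : List Leaf → List ℕ
    reports = concatMap λ x → report (leafChain x)

    -- A chain with `depth` layers contains `suc depth` substrings, so this counts the substrings on
    -- the reported chains.
    weight : List Leaf → ℕ
    weight xs = sum (map (λ x → suc (depth (leafChain x))) xs)

    Reported : (n i s k d l r : ℕ) → List Leaf → List ℕ → Set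
    Reported n i s k d l r xs O = ∃[ d′ ] ∃[ l′ ] ∃[ r′ ]
      Run reportRow ⟨ vars i s k d l r , M , O ⟩ (unit * (n + 4 * weight xs) + unit) ⟨ vars i K k d′ l′ r′ , M , O ++ reports xs ⟩

    run-reportRow : ∀ n {i s k d l r O} (s+n : s + n ≡ K) (1≤i : 1 ≤ i) (i≤s : i ≤ s) →
                    Reported n i s k d l r (rowLeaves n s+n 1≤i i≤s) O
    run-reportRow zero {i} {s} {k} {d} {l} {r} {O} s+n _ _ with refl ← trans (sym (+-identityʳ s)) s+n =
      d , l , r , run-≤ (≤-trans (affordable (≤ᵇ⇒≤ _ 120 tt)) (m≤n+m unit _))
        (run-output (sym (++-identityʳ O)) (run-exit (tt , tt) (<ᵇ-false {K} {K} ≤-refl)))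
    run-reportRow (suc n) {i} {s} {k} {d} {l} {r} {O} s+n 1≤i i≤s = choose
      where
      s≤N : s ≤ N
      s≤N = linear 3 (λ s n N → s ⊞ (con 1 ⊞ n) ≊ con 1 ⊞ N ⇛ goal (s ≼ N)) s n N s+n
      fits : Fit (vars i s k d l r) M W (! cell 2 𝑖 𝑠)
      fits = fits-load (fits-cell 2 𝑖 𝑠 ≤-refl tt tt (≤-trans i≤s (≤-trans s≤N (n≤1+n N))) s≤N)
      increment : ∀ {d l r O} → Run (3F := 𝑠 ⊕ # 1) ⟨ vars i s k d l r , M , O ⟩ 4 ⟨ vars i (suc s) k d l r , M , O ⟩
      increment = run-set (fit (tt , numeral (s≤s z≤n) , tiny (≤-trans (≤-reflexive (+-comm s 1)) (s≤s s≤N)))) (+-comm s 1)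
      others : List Leaf
      others = rowLeaves n (trans (sym (+-suc s n)) s+n) 1≤i (m≤n⇒m≤1+n i≤s)
      later : ∀ {d l r O} → Reported n i (suc s) k d l r others O
      later = run-reportRow n (trans (sym (+-suc s n)) s+n) 1≤i (m≤n⇒m≤1+n i≤s)
      leave-cost : ∀ x → 24 + (unit * (n + 4 * x) + unit) ≤ unit * (suc n + 4 * x) + unit
      leave-cost x = loop-cost unit (n + 4 * x) (affordable (≤ᵇ⇒≤ 24 120 tt))
      leave : 1 ≤ child i s → Reported n i (suc s) k (child i s) l r others O → Reported (suc n) i s k d l r others O
      leave 1≤c (d′ , l′ , r′ , rest) = d′ , l′ , r′ ,
        run-≤ (leave-cost (weight others))
          (run-loop (tt , tt) (<ᵇ-true (s≤s s≤N))
            (run-seq (run-set fits (cong M address-≡))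
            (run-seq (run-then (numeral z≤n , tt) (<ᵇ-true 1≤c) (run-set (fit tt) refl))
                     increment))
            rest)
      visitLeaf : ∀ (x : Leaf) → first x ≡ i → last x ≡ s →
                  Reported n i (suc s) k 0 i s others (O ++ report (leafChain x)) → Reported (suc n) i s k d l r (x ∷ others) O
      visitLeaf x refl refl (d′ , l′ , r′ , rest) = d′ , l′ , r′ ,
        run-≤ (leaf-cost unit (depth (leafChain x)) n (weight others) (affordable (≤ᵇ⇒≤ _ 120 tt)))
          (run-output (++-assoc O (report (leafChain x)) (reports others))
            (run-loop (tt , tt) (<ᵇ-true (s≤s s≤N))
              (run-seq (run-set fits (trans (cong M address-≡) (childless x)))
              (run-seq (run-else (numeral z≤n , tt) refl (run-reportChain (leafChain x) 1≤i s≤N (childless x)))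
                       increment))
              rest))
      choose : Reported (suc n) i s k d l r (rowLeaves (suc n) s+n 1≤i i≤s) O
      choose with child i s ≟ 0
      ... | yes h = visitLeaf (leaf 1≤i i≤s _ h) refl refl later
      ... | no h≢ = leave (n≢0⇒n>0 h≢) later

    weight-++ : ∀ xs ys → weight (xs ++ ys) ≡ weight xs + weight ys
    weight-++ []       ys = refl
    weight-++ (x ∷ xs) ys = trans (cong (suc (depth (leafChain x)) +_) (weight-++ xs ys)) (sym (+-assoc (suc (depth (leafChain x))) (weight xs) (weight ys)))

    ReportedAll : (n i s k d l r : ℕ) → List Leaf → List ℕ → Set
    ReportedAll n i s k d l r xs O = ∃[ s′ ] ∃[ d′ ] ∃[ l′ ] ∃[ r′ ]
      Run (while 𝑖 ≺ₜ 𝐾 repeat (3F := 𝑖 ⨾ reportRow ⨾ 2F := 𝑖 ⊕ # 1)) ⟨ vars i s k d l r , M , O ⟩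
          (unit * ((K + 2) * n + 4 * weight xs) + unit) ⟨ vars K s′ k d′ l′ r′ , M , O ++ reports xs ⟩

    run-reportRows : ∀ n {i s k d l r O} (i+n : i + n ≡ K) (1≤i : 1 ≤ i) → ReportedAll n i s k d l r (allLeaves n i+n 1≤i) O
    run-reportRows zero {i} {s} {k} {d} {l} {r} {O} i+n _ with refl ← trans (sym (+-identityʳ i)) i+n =
      s , d , l , r , run-≤ (≤-trans (affordable (≤ᵇ⇒≤ _ 120 tt)) (m≤n+m unit _))
        (run-output (sym (++-identityʳ O)) (run-exit (tt , tt) (<ᵇ-false {K} {K} ≤-refl)))
    run-reportRows (suc n) {i} {s} {k} {d} {l} {r} {O} i+n 1≤i = afterRow (run-reportRow (suc n) i+n 1≤i ≤-refl)
      where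
      row : List Leaf
      row = rowLeaves (suc n) i+n 1≤i ≤-refl
      i≤N : i ≤ N
      i≤N = linear 3 (λ i n N → i ⊞ (con 1 ⊞ n) ≊ con 1 ⊞ N ⇛ goal (i ≼ N)) i n N i+n
      others : List Leaf
      others = allLeaves n (trans (sym (+-suc i n)) i+n) (s≤s z≤n)
      afterRows : ∀ {d′ l′ r′} →
        Run reportRow ⟨ vars i i k d l r , M , O ⟩ (unit * (suc n + 4 * weight row) + unit) ⟨ vars i K k d′ l′ r′ , M , O ++ reports row ⟩ →
        ReportedAll n (suc i) K k d′ l′ r′ others (O ++ reports row) → ReportedAll (suc n) i s k d l r (row ++ others) O
      afterRows now (s″ , d″ , l″ , r″ , rest) = s″ , d″ , l″ , r″ ,
        run-≤ (≤-trans (rows-cost unit (suc n) n K (weight row) (weight others) (affordable (≤ᵇ⇒≤ _ 120 tt)) (≤-trans (m≤n+m (suc n) i) (≤-reflexive i+n)))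
                       (≤-reflexive (cong (λ y → unit * ((K + 2) * suc n + 4 * y) + unit) (sym (weight-++ row others)))))
          (run-output (trans (++-assoc O (reports row) (reports others)) (cong (O ++_) (sym (concatMap-++ (λ x → report (leafChain x)) row others))))
            (run-loop (tt , tt) (<ᵇ-true (s≤s i≤N))
              (run-seq (run-set (fit tt) refl)
              (run-seq now
                       (run-set (fit (tt , numeral (s≤s z≤n) , tiny (≤-trans (≤-reflexive (+-comm i 1)) (s≤s i≤N)))) (+-comm i 1))))
              rest))
      afterRow : Reported (suc n) i i k d l r row O → ReportedAll (suc n) i s k d l r (allLeaves (suc n) i+n 1≤i) O
      afterRow (_ , _ , _ , now) = afterRows now (run-reportRows n (trans (sym (+-suc i n)) i+n) (s≤s z≤n))

    leaves : List Leaf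
    leaves = allLeaves N refl ≤-refl

    run-reportAll : ∀ {i s k d l r O} → ∃[ ρ ]
      Run reportAll ⟨ vars i s k d l r , M , O ⟩ (2 + (unit * ((K + 2) * N + 4 * weight leaves) + unit)) ⟨ ρ , M , O ++ reports leaves ⟩
    run-reportAll {i} {s} {k} {d} {l} {r} {O} = afterSetup (run-reportRows N refl ≤-refl)
      where
      afterSetup : ReportedAll N 1 s k d l r leaves O → ∃[ ρ ]
        Run reportAll ⟨ vars i s k d l r , M , O ⟩ (2 + (unit * ((K + 2) * N + 4 * weight leaves) + unit)) ⟨ ρ , M , O ++ reports leaves ⟩
      afterSetup (_ , _ , _ , _ , rows) = _ , run-seq (run-set (fit (numeral (s≤s z≤n))) refl) rows

-- Largest block palindromes

-- Levi's lemma.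
++-split : ∀ {A : Set} (xs ys zs ws : List A) → xs ++ ys ≡ zs ++ ws → length xs ≤ length zs →
           ∃[ as ] zs ≡ xs ++ as × ys ≡ as ++ ws
++-split []       ys zs       ws e _       = zs , refl , e
++-split (x ∷ xs) ys (z ∷ zs) ws e (s≤s h) with refl , e′ ← ∷-injective e
  with as , p , q ← ++-split xs ys zs ws e′ h = as , cong (x ∷_) p , q

++-splitʳ : ∀ {A : Set} (xs ys zs ws : List A) → xs ++ ys ≡ zs ++ ws → length ys ≤ length ws →
            ∃[ as ] xs ≡ zs ++ as × ws ≡ as ++ ys
++-splitʳ xs ys zs ws e h = ++-split zs ws xs ys (sym e)
  (linear 4 (λ x y z w → x ⊞ y ≊ z ⊞ w ⇛ y ≼ w ⇛ goal (z ≼ x)) (length xs) (length ys) (length zs) (length ws)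
    (trans (sym (length-++ xs)) (trans (cong length e) (length-++ zs))) h)

++-split-equal : ∀ {A : Set} (xs ys zs ws : List A) → xs ++ ys ≡ zs ++ ws → length xs ≡ length zs → xs ≡ zs × ys ≡ ws
++-split-equal xs ys zs ws e h with ++-split xs ys zs ws e (≤-reflexive h)
... | []     , refl , q = sym (++-identityʳ xs) , q
... | a ∷ as , refl , _ = ⊥-elim (m≢1+m+n (length xs)
  (trans h (trans (length-++ xs) (+-suc (length xs) (length as)))))

nonempty⇒length : ∀ {A : Set} {xs : List A} → xs ≢ [] → 1 ≤ length xs
nonempty⇒length {xs = []}    h = contradiction refl h
nonempty⇒length {xs = _ ∷ _} h = s≤s z≤n

length⇒nonempty : ∀ {A : Set} {xs : List A} → 1 ≤ length xs → xs ≢ []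
length⇒nonempty () refl

surround : String → Factorization → Factorization
surround u f = factorization (center f) (arms f ∷ʳ u)

blocks-surround : ∀ u f → blocks (surround u f) ≡ u ∷ blocks f ++ u ∷ []
blocks-surround u f = begin
  reverse (arms f ∷ʳ u) ++ center f ∷ arms f ∷ʳ u    ≡⟨ cong (_++ (center f ∷ arms f ∷ʳ u)) (reverse-++ (arms f) (u ∷ [])) ⟩
  u ∷ (reverse (arms f) ++ center f ∷ arms f ∷ʳ u)   ≡⟨ cong (u ∷_) (++-assoc (reverse (arms f)) (center f ∷ arms f) (u ∷ [])) ⟨
  u ∷ blocks f ++ u ∷ []                             ∎
  where open ≡-Reasoning

concat-surround : ∀ u f → concat (blocks (surround u f)) ≡ u ++ concat (blocks f) ++ u
concat-surround u f = begin
  concat (blocks (surround u f))         ≡⟨ cong concat (blocks-surround u f) ⟩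
  u ++ concat (blocks f ++ u ∷ [])       ≡⟨ cong (u ++_) (concat-++ (blocks f) (u ∷ [])) ⟨
  u ++ concat (blocks f) ++ (u ++ [])    ≡⟨ cong (λ v → u ++ concat (blocks f) ++ v) (++-identityʳ u) ⟩
  u ++ concat (blocks f) ++ u            ∎
  where open ≡-Reasoning

filterᵇ-++ : ∀ {A : Set} p (xs ys : List A) → filterᵇ p (xs ++ ys) ≡ filterᵇ p xs ++ filterᵇ p ys
filterᵇ-++ p []       ys = refl
filterᵇ-++ p (x ∷ xs) ys with p x
... | true  = cong (x ∷_) (filterᵇ-++ p xs ys)
... | false = filterᵇ-++ p xs ys

size-surround : ∀ {u} f → u ≢ [] → size (surround u f) ≡ 2 + size f
size-surround {[]}    f h = contradiction refl h
size-surround {x ∷ u} f h = begin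
  size (surround v f)                       ≡⟨ cong (λ bs → length (filterᵇ _ bs)) (blocks-surround v f) ⟩
  suc (length (filterᵇ _ (blocks f ++ v ∷ []))) ≡⟨ cong (λ bs → suc (length bs)) (filterᵇ-++ _ (blocks f) (v ∷ [])) ⟩
  suc (length (filterᵇ _ (blocks f) ++ v ∷ [])) ≡⟨ cong suc (length-++ (filterᵇ _ (blocks f))) ⟩
  suc (size f + 1)                          ≡⟨ cong suc (+-comm (size f) 1) ⟩
  2 + size f                                ∎
  where
  open ≡-Reasoning
  v = x ∷ u

length-surround : ∀ u f → ∣ surround u f ∣ ≡ length u + (∣ f ∣ + length u)
length-surround u f = begin
  sum (map length (blocks (surround u f)))                     ≡⟨ cong (λ bs → sum (map length bs)) (blocks-surround u f) ⟩
  length u + sum (map length (blocks f ++ u ∷ []))             ≡⟨ cong (λ ns → length u + sum ns) (map-++ length (blocks f) (u ∷ [])) ⟩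
  length u + sum (map length (blocks f) ++ length u ∷ [])      ≡⟨ cong (length u +_) (sum-++ (map length (blocks f)) (length u ∷ [])) ⟩
  length u + (∣ f ∣ + (length u + 0))                          ≡⟨ cong (λ n → length u + (∣ f ∣ + n)) (+-identityʳ (length u)) ⟩
  length u + (∣ f ∣ + length u)                                ∎
  where open ≡-Reasoning

surround-palindrome : ∀ {u w g} → u ≢ [] → IsBlockPalindrome w g → IsBlockPalindrome (u ++ w ++ u) (surround u g)
surround-palindrome {u} {w} {g} u≢[] bp = record
  { arms≢[] = All.++⁺ arms≢[] (u≢[] ∷ [])
  ; factors = trans (concat-surround u g) (cong (λ v → u ++ v ++ u) factors) }
  where open IsBlockPalindrome bp

-- Arms are listed outwards, so the outermost pair is the last arm; this view brings it to the front
-- of the recursion.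
data Outermost (w : String) : Factorization → Set where
  bare       : Outermost w (factorization w [])
  surrounded : ∀ {u y g} → u ≢ [] → w ≡ u ++ y ++ u → IsBlockPalindrome y g → Outermost w (surround u g)

outermost : ∀ {w g} → IsBlockPalindrome w g → Outermost w g
outermost {w} {factorization c as} bp with initLast as
... | []       = subst (λ c → Outermost w (factorization c [])) (trans (sym (IsBlockPalindrome.factors bp)) (++-identityʳ c)) bare
... | bs ∷ʳ′ u with hbs , (hu ∷ []) ← All.++⁻ bs (IsBlockPalindrome.arms≢[] bp) =
  surrounded {y = concat (blocks g)} hu (trans (sym (IsBlockPalindrome.factors bp)) (concat-surround u g))
    (record { arms≢[] = hbs ; factors = refl })
  where
  g = factorization c bs

size-bare : ∀ w → size (factorization w []) ≤ 1
size-bare []      = z≤n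
size-bare (_ ∷ _) = ≤-refl

-- The blocks are split off as shortest borders v; these have no proper border themselves.
data Largest : String → Factorization → Set where
  bare  : ∀ {w} → (∀ v x → v ≢ [] → w ≢ v ++ x ++ v) → Largest w (factorization w [])
  layer : ∀ {v x f} → v ≢ [] → (∀ p q r → p ≢ [] → q ≢ [] → v ≡ p ++ q → v ≢ r ++ p) →
          Largest x f → Largest (v ++ x ++ v) (surround v f)

largest-palindrome : ∀ {w f} → Largest w f → IsBlockPalindrome w f
largest-palindrome {w} (bare _)       = record { arms≢[] = [] ; factors = ++-identityʳ w }
largest-palindrome (layer v≢[] _ lg) = surround-palindrome v≢[] (largest-palindrome lg)

-- A longer border u = v z v than the shortest border v can be refined to the blocks v, z, v.
largest-maximal : ∀ {w f g} → Largest w f → IsBlockPalindrome w g → size g < size f ⊎ g ≡ f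
largest-maximal (bare unbordered) bp with outermost bp
... | bare                    = inj₂ refl
... | surrounded u≢[] w≡ _    = contradiction w≡ (unbordered _ _ u≢[])
largest-maximal {w} {f′} {g} (layer {v} {x} {f} v≢[] unbordered lg) bp with outermost bp
... | bare = inj₁ (≤-trans (s≤s (size-bare (v ++ x ++ v)))
        (≤-trans (s≤s (s≤s z≤n)) (≤-reflexive (sym (size-surround f v≢[])))))
... | surrounded {u} {y} {g′} u≢[] w≡ bp′ with <-cmp (length u) (length v)
... | tri≈ _ ≡len _
  with refl , e ← ++-split-equal v (x ++ v) u (y ++ u) w≡ (sym ≡len)
  with refl ← ++-cancelʳ v x y e
  with largest-maximal lg bp′
... | inj₁ lt = inj₁ (subst₂ _<_ (sym (size-surround g′ v≢[])) (sym (size-surround f v≢[])) (s≤s (s≤s lt)))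
... | inj₂ refl = inj₂ refl
-- An outer block `u` shorter than `v` would be a proper prefix and a suffix of `v`, which is
-- unbordered.
largest-maximal {w} {f′} {g} (layer {v} {x} {f} v≢[] unbordered lg) bp | surrounded {u} {y} {g′} u≢[] w≡ bp′ | tri< lt _ _
  with q , v≡ , _ ← ++-split u (y ++ u) v (x ++ v) (sym w≡) (<⇒≤ lt)
  with r , _ , v≡′ ← ++-splitʳ (u ++ y) u (v ++ x) v (trans (++-assoc u y u) (trans (sym w≡) (sym (++-assoc v x v)))) (<⇒≤ lt) =
  contradiction v≡′ (unbordered u q r u≢[] q≢[] v≡)
  where
  q≢[] : q ≢ []
  q≢[] refl = <⇒≢ lt (cong length (sym (trans v≡ (++-identityʳ u))))
-- A longer outer block has the forms `u = v a = b v`, and then `x = a y b`. It suffices to find a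
-- block palindrome of `x` with two blocks more than `g′`: such a one is bounded by `f` through the
-- induction hypothesis.
largest-maximal {w} {f′} {g} (layer {v} {x} {f} v≢[] unbordered lg) bp | surrounded {u} {y} {g′} u≢[] w≡ bp′ | tri> _ _ gt
  with a , u≡ , xv≡ ← ++-split v (x ++ v) u (y ++ u) w≡ (<⇒≤ gt)
  with b , x≡ , u≡′ ← ++-splitʳ x v (a ++ y) u (trans xv≡ (sym (++-assoc a y u))) (<⇒≤ gt)
  = inj₁ (refine (length v ≤? length b))
  where
  bound : ∀ {h} → IsBlockPalindrome x h → 2 + size g′ ≤ size h → size (surround u g′) < size (surround v f)
  bound {h} bph le = subst₂ _<_ (sym (size-surround g′ u≢[])) (sym (size-surround f v≢[]))
    (s≤s (≤-trans (≤-trans le (at-most (largest-maximal lg bph))) (n≤1+n _)))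
    where
    at-most : size h < size f ⊎ h ≡ f → size h ≤ size f
    at-most (inj₁ lt)   = <⇒≤ lt
    at-most (inj₂ refl) = ≤-refl
  a≢[] : a ≢ []
  a≢[] refl = <⇒≢ gt (cong length (sym (trans u≡ (++-identityʳ v))))
  refine : _ → size (surround u g′) < size (surround v f)
  -- The two occurrences of `v` in `u` overlap in `p`, which would be a proper border of `v`.
  refine (no v≰b) with p , v≡bp , v≡pa ← ++-split b v v a (trans (sym u≡′) u≡) (<⇒≤ (≰⇒> v≰b)) =
    contradiction v≡bp (unbordered p a b p≢[] a≢[] v≡pa)
    where
    p≢[] : p ≢ []
    p≢[] refl = v≰b (≤-reflexive (cong length (trans v≡bp (++-identityʳ b))))
  -- Now `b = v z` and `a = z v`, so `u = v z v` and `x = z v y v z`. An empty `z` must not become a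
  -- block, hence the two cases.
  refine (yes v≤b) with ++-split v a b v (trans (sym u≡) u≡′) v≤b
  ... | [] , b≡ , a≡ = bound (subst (λ x → IsBlockPalindrome x (surround v g′)) (sym x≡vyv) (surround-palindrome v≢[] bp′))
                         (≤-reflexive (sym (size-surround g′ v≢[])))
    where
    x≡vyv : x ≡ v ++ y ++ v
    x≡vyv = trans x≡ (trans (cong₂ (λ a b → (a ++ y) ++ b) a≡ (trans b≡ (++-identityʳ v))) (++-assoc v y v))
  ... | z ∷ zs , b≡ , a≡ =
    bound {surround (z ∷ zs) (surround v g′)} (subst (λ x → IsBlockPalindrome x (surround (z ∷ zs) (surround v g′))) (sym x≡zvyvz) (surround-palindrome {z ∷ zs} (λ ()) (surround-palindrome v≢[] bp′)))
          (≤-trans (m≤n+m _ 2) (≤-reflexive (sym (trans (size-surround {z ∷ zs} (surround v g′) (λ ())) (cong (2 +_) (size-surround g′ v≢[]))))))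
    where
    open ≡-Reasoning
    x≡zvyvz : x ≡ (z ∷ zs) ++ (v ++ y ++ v) ++ z ∷ zs
    x≡zvyvz = begin
      x                                       ≡⟨ trans x≡ (cong₂ (λ a b → (a ++ y) ++ b) a≡ b≡) ⟩
      (((z ∷ zs) ++ v) ++ y) ++ v ++ z ∷ zs   ≡⟨ ++-assoc ((z ∷ zs) ++ v) y _ ⟩
      ((z ∷ zs) ++ v) ++ y ++ v ++ z ∷ zs     ≡⟨ ++-assoc (z ∷ zs) v _ ⟩
      (z ∷ zs) ++ v ++ y ++ v ++ z ∷ zs       ≡⟨ cong (λ t → (z ∷ zs) ++ v ++ t) (++-assoc y v (z ∷ zs)) ⟨
      (z ∷ zs) ++ v ++ (y ++ v) ++ z ∷ zs     ≡⟨ cong ((z ∷ zs) ++_) (++-assoc v (y ++ v) (z ∷ zs)) ⟨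
      (z ∷ zs) ++ (v ++ y ++ v) ++ z ∷ zs     ∎

largest-unique : ∀ {w f g} → Largest w f → IsLargestBlockPalindrome w g → g ≡ f
largest-unique lg (bp , max) with largest-maximal lg bp
... | inj₂ g≡f = g≡f
... | inj₁ lt  = contradiction (max _ (largest-palindrome lg)) (<⇒≱ lt)

largest-isLargest : ∀ {w f} → Largest w f → IsLargestBlockPalindrome w f
largest-isLargest {f = f} lg = largest-palindrome lg , λ g bp → at-most (largest-maximal lg bp)
  where
  at-most : ∀ {g} → size g < size f ⊎ g ≡ f → size g ≤ size f
  at-most (inj₁ lt)   = <⇒≤ lt
  at-most (inj₂ refl) = ≤-refl

-- Given by start and length instead of both ends, so that concatenation adds lengths without
-- truncated subtraction.
slice : String → ℕ → ℕ → String
slice T i d = take d (drop (i ∸ 1) T)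

take-+ : ∀ {A : Set} m n (xs : List A) → take (m + n) xs ≡ take m xs ++ take n (drop m xs)
take-+ zero    n xs       = refl
take-+ (suc m) zero    [] = refl
take-+ (suc m) (suc n) [] = refl
take-+ (suc m) n (x ∷ xs) = cong (x ∷_) (take-+ m n xs)

slice-++ : ∀ T {i} a b → 1 ≤ i → slice T i (a + b) ≡ slice T i a ++ slice T (i + a) b
slice-++ T {suc j} a b _ = trans (take-+ a b (drop j T)) (cong (λ xs → take a (drop j T) ++ take b xs) (drop-drop j a T))

slice-length : ∀ T {i} d → 1 ≤ i → i + d ≤ suc (length T) → length (slice T i d) ≡ d
slice-length T {suc j} d _ (s≤s h) = trans (length-take d (drop j T))
  (m≤n⇒m⊓n≡m (≤-trans (≤-reflexive (sym (m+n∸m≡n j d))) (≤-trans (∸-monoˡ-≤ j h) (≤-reflexive (sym (length-drop j T))))))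

piece-slice : ∀ T {i} d → 1 ≤ i → T [ i ⋯ i + d ∸ 1 ] ≡ slice T i d
piece-slice T {suc j} d _ = cong (λ d → take d (drop j T)) (m+n∸m≡n j d)

range-slice : ∀ T i d {s} → i + d ≡ suc s → T [ i ⋯ s ] ≡ slice T i d
range-slice T i d e = cong (λ d → take d (drop (i ∸ 1) T)) (trans (cong (_∸ i) (sym e)) (m+n∸m≡n i d))

cells-drop : ∀ w j xs x → cells w (drop j xs) x ≡ cells w xs (j + x)
cells-drop w zero    xs       x = refl
cells-drop w (suc j) []       x = refl
cells-drop w (suc j) (_ ∷ xs) x = cells-drop w j xs x

take⇒cells : ∀ w d xs ys → take d xs ≡ take d ys → ∀ x → x < d → cells w xs x ≡ cells w ys x
take⇒cells w (suc d) []       []       e    x       _         = refl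
take⇒cells w (suc d) (_ ∷ xs) (_ ∷ ys) e    zero    _         = cong (wrap w) (∷-injectiveˡ e)
take⇒cells w (suc d) (_ ∷ xs) (_ ∷ ys) e    (suc x) (s≤s x<d) = take⇒cells w d xs ys (∷-injectiveʳ e) x x<d

-- Chains as largest block palindromes of substrings

module Strings-over (w : ℕ) (T : String) (words : All (_< 2 ^ w) T) where

  N : ℕ
  N = length T

  letter : ℕ → ℕ
  letter = mem (initial w T)

  open BorderTheory letter
  open Chains letter

  -- Memory holds the letters modulo `2 ^ w`, which is faithful on letters that are words. The
  -- bounds on `d` keep the comparison away from cells past the end, whose 0 could also be a letter.
  cells⇒take : ∀ d xs ys → All (_< 2 ^ w) xs → All (_< 2 ^ w) ys → d ≤ length xs → d ≤ length ys →
               (∀ x → x < d → cells w xs x ≡ cells w ys x) → take d xs ≡ take d ys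
  cells⇒take zero    _        _        _        _        _       _       _ = refl
  cells⇒take (suc d) (x ∷ xs) (y ∷ ys) (hx ∷ hs) (hy ∷ ks) (s≤s l) (s≤s m) e = cong₂ _∷_
    (trans (sym (wrap-word hx)) (trans (e 0 (s≤s z≤n)) (wrap-word hy)))
    (cells⇒take d xs ys hs ks l m λ x x<d → e (suc x) (s≤s x<d))
    where
    open Execution w using () renaming (wrap-< to wrap-word)

  match⇒slice : ∀ {i p d} → 1 ≤ i → 1 ≤ p → i + d ≤ suc N → p + d ≤ suc N → Match i p d → slice T i d ≡ slice T p d
  match⇒slice {suc i} {suc p} {d} _ _ (s≤s hi) (s≤s hp) m =
    cells⇒take d (drop i T) (drop p T) (All.drop⁺ i words) (All.drop⁺ p words) (fits i hi) (fits p hp)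
      λ x x<d → trans (cells-drop w i T x) (trans (m x x<d) (sym (cells-drop w p T x)))
    where
    fits : ∀ j → j + d ≤ N → d ≤ length (drop j T)
    fits j h = ≤-trans (≤-reflexive (sym (m+n∸m≡n j d))) (≤-trans (∸-monoˡ-≤ j h) (≤-reflexive (sym (length-drop j T))))

  slice⇒match : ∀ {i p d} → 1 ≤ i → 1 ≤ p → slice T i d ≡ slice T p d → Match i p d
  slice⇒match {suc i} {suc p} {d} _ _ e x x<d =
    trans (sym (cells-drop w i T x)) (trans (take⇒cells w d (drop i T) (drop p T) e x x<d) (cells-drop w p T x))

  factors : ∀ {i s} → Chain i s → Factorization
  factors (centre {i} {s} _ _)      = factorization (T [ i ⋯ s ]) []
  factors (layer {i} {s} {d} _ _ c) = surround (T [ i ⋯ i + d ∸ 1 ]) (factors c)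

  piece-length : ∀ {i s} d → 1 ≤ i → i ≤ suc s → s + d ≤ N → length (T [ i ⋯ i + d ∸ 1 ]) ≡ d
  piece-length {i} {s} d 1≤i i≤ s≤N = trans (cong length (piece-slice T d 1≤i))
    (slice-length T d 1≤i (linear 4 (λ i s d N → i ≼ con 1 ⊞ s ⇛ s ⊞ d ≼ N ⇛ goal (i ⊞ d ≼ con 1 ⊞ N)) i s d N i≤ s≤N))

  layer-ordered : ∀ {i s d} → Chain (i + d) s → i ≤ suc s
  layer-ordered {i} {s} {d} c = ≤-trans (m≤m+n i d) (chain-ordered c)

  chain-largest : ∀ {i s} (c : Chain i s) → 1 ≤ i → s ≤ N → Largest (T [ i ⋯ s ]) (factors c)
  chain-largest (centre {i} {s} i≤ (_ , none)) 1≤i s≤N = bare border-free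
    where
    border-free : ∀ v x → v ≢ [] → T [ i ⋯ s ] ≢ v ++ x ++ v
    border-free v x v≢[] e = contradiction (proj₁ (none a (nonempty⇒length v≢[]) border)) λ ()
      where
      a = length v
      b = length x
      total : i + (a + (b + a)) ≡ suc s
      total = trans (cong (i +_) (sym lengths)) (m+[n∸m]≡n i≤)
        where
        lengths : suc s ∸ i ≡ a + (b + a)
        lengths = trans (sym (slice-length T (suc s ∸ i) 1≤i (≤-trans (≤-reflexive (m+[n∸m]≡n i≤)) (s≤s s≤N))))
          (trans (cong length e) (trans (length-++ v) (cong (a +_) (length-++ x))))
      split : slice T i a ++ (slice T (i + a) b ++ slice T (i + a + b) a) ≡ v ++ x ++ v
      split = trans (cong (slice T i a ++_) (sym (slice-++ T b a (≤-trans 1≤i (m≤m+n i a)))))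
        (trans (sym (slice-++ T a (b + a) 1≤i)) (trans (sym (range-slice T i (a + (b + a)) total)) e))
      inside : ∀ {j} → j ≤ suc s → j ≤ suc N
      inside h = ≤-trans h (s≤s s≤N)
      first-part = ++-split-equal (slice T i a) _ v (x ++ v) split
        (slice-length T a 1≤i (inside (linear 4 (λ i a b s → i ⊞ (a ⊞ (b ⊞ a)) ≊ con 1 ⊞ s ⇛ goal (i ⊞ a ≼ con 1 ⊞ s)) i a b s total)))
      last-part = ++-split-equal (slice T (i + a) b) _ x v (proj₂ first-part)
        (slice-length T b (≤-trans 1≤i (m≤m+n i a))
          (inside (linear 4 (λ i a b s → i ⊞ (a ⊞ (b ⊞ a)) ≊ con 1 ⊞ s ⇛ goal (i ⊞ a ⊞ b ≼ con 1 ⊞ s)) i a b s total)))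
      border : Border i s a
      border = i + a + b ,
        linear 3 (λ i a b → con 1 ≼ a ⇛ goal (i ≺ i ⊞ a ⊞ b)) i a b (nonempty⇒length v≢[]) ,
        linear 4 (λ i a b s → i ⊞ (a ⊞ (b ⊞ a)) ≊ con 1 ⊞ s ⇛ goal (i ⊞ a ⊞ b ⊞ a ≊ con 1 ⊞ s)) i a b s total ,
        slice⇒match 1≤i (≤-trans 1≤i (≤-trans (m≤m+n i a) (m≤m+n (i + a) b))) (trans (proj₁ first-part) (sym (proj₂ last-part)))
  chain-largest (layer {i} {s} {d} 1≤d (σ , min) c) 1≤i s≤N = subst₂ Largest (sym whole) refl
    (layer u≢[] unbordered (chain-largest c (≤-trans 1≤i (m≤m+n i d)) (≤-trans (m≤m+n s d) s≤N)))
    where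
    u = T [ i ⋯ i + d ∸ 1 ]
    u-length : length u ≡ d
    u-length = piece-length d 1≤i (layer-ordered c) s≤N
    u≢[] : u ≢ []
    u≢[] = length⇒nonempty (subst (1 ≤_) (sym u-length) 1≤d)
    u≡ : u ≡ slice T i d
    u≡ = piece-slice T d 1≤i
    i+d≤ : i + d ≤ suc (s + d)
    i+d≤ = ≤-trans (chain-ordered c) (s≤s (m≤m+n s d))
    m = suc s ∸ (i + d)
    i+d+m : i + d + m ≡ suc s
    i+d+m = m+[n∸m]≡n (chain-ordered c)
    right≡ : slice T i d ≡ slice T (suc s) d
    right≡ with p , i<p , p+d , match ← σ 1≤d
      with refl ← +-cancelʳ-≡ d p (suc s) p+d =
      match⇒slice 1≤i (s≤s z≤n) (≤-trans i+d≤ (s≤s s≤N)) (s≤s s≤N) match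
    whole : T [ i ⋯ s + d ] ≡ u ++ T [ i + d ⋯ s ] ++ u
    whole = begin
      T [ i ⋯ s + d ]                                              ≡⟨ range-slice T i (d + (m + d)) total ⟩
      slice T i (d + (m + d))                                      ≡⟨ slice-++ T d (m + d) 1≤i ⟩
      slice T i d ++ slice T (i + d) (m + d)                       ≡⟨ cong (slice T i d ++_) (slice-++ T m d (≤-trans 1≤i (m≤m+n i d))) ⟩
      slice T i d ++ slice T (i + d) m ++ slice T (i + d + m) d    ≡⟨ cong (λ j → slice T i d ++ slice T (i + d) m ++ slice T j d) i+d+m ⟩
      slice T i d ++ slice T (i + d) m ++ slice T (suc s) d        ≡⟨ cong₂ (λ x y → x ++ slice T (i + d) m ++ y) (sym u≡) (sym (trans u≡ right≡)) ⟩
      u ++ T [ i + d ⋯ s ] ++ u                                    ∎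
      where
      open ≡-Reasoning
      total : i + (d + (m + d)) ≡ suc (s + d)
      total = linear 4 (λ i d m s → i ⊞ d ⊞ m ≊ con 1 ⊞ s ⇛ goal (i ⊞ (d ⊞ (m ⊞ d)) ≊ con 1 ⊞ (s ⊞ d))) i d m s i+d+m
    unbordered : ∀ p q r → p ≢ [] → q ≢ [] → u ≡ p ++ q → u ≢ r ++ p
    -- A proper border `p` of the arm is, by `border-trans`, a border of the whole substring, and it
    -- is shorter than the shortest one.
    unbordered p q r p≢[] q≢[] e₁ e₂ = <⇒≱ b<d (proj₂ (min b 1≤b (border-trans {j = s′} inner (σ 1≤d) s′≡)))
      where
      b = length p
      e = length q
      e′ = length r
      1≤b = nonempty⇒length p≢[]
      d≡ : d ≡ b + e
      d≡ = trans (sym u-length) (trans (cong length e₁) (length-++ p))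
      d≡′ : d ≡ e′ + b
      d≡′ = trans (sym u-length) (trans (cong length e₂) (length-++ r))
      b<d : b < d
      b<d = linear 3 (λ b e d → d ≊ b ⊞ e ⇛ con 1 ≼ e ⇛ goal (b ≺ d)) b e d d≡ (nonempty⇒length q≢[])
      s′ = i + d ∸ 1
      s′≡ : suc s′ ≡ i + d
      s′≡ = m+[n∸m]≡n (≤-trans 1≤i (m≤m+n i d))
      inside : ∀ {j} → j ≤ i + d → j ≤ suc N
      inside h = ≤-trans h (≤-trans i+d≤ (s≤s s≤N))
      prefix : slice T i b ≡ p
      prefix = proj₁ (++-split-equal (slice T i b) (slice T (i + b) e) p q
        (trans (sym (slice-++ T b e 1≤i)) (trans (cong (slice T i) (sym d≡)) (trans (sym u≡) e₁)))
        (slice-length T b 1≤i (inside (+-monoʳ-≤ i (<⇒≤ b<d)))))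
      suffix : slice T (i + e′) b ≡ p
      suffix = proj₂ (++-split-equal (slice T i e′) (slice T (i + e′) b) r p
        (trans (sym (slice-++ T e′ b 1≤i)) (trans (cong (slice T i) (sym d≡′)) (trans (sym u≡) e₂)))
        (slice-length T e′ 1≤i (inside (+-monoʳ-≤ i (≤-trans (m≤m+n e′ b) (≤-reflexive (sym d≡′)))))))
      inner : Border i s′ b
      inner = i + e′ ,
        linear 5 (λ i b e d e′ → d ≊ b ⊞ e ⇛ d ≊ e′ ⊞ b ⇛ con 1 ≼ e ⇛ goal (i ≺ i ⊞ e′)) i b e d e′ d≡ d≡′ (nonempty⇒length q≢[]) ,
        trans (+-assoc i e′ b) (trans (cong (i +_) (sym d≡′)) (sym s′≡)) ,
        slice⇒match 1≤i (≤-trans 1≤i (m≤m+n i e′)) (trans prefix (sym suffix))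

  factors-length : ∀ {i s} (c : Chain i s) → 1 ≤ i → s ≤ N → i + ∣ factors c ∣ ≡ suc s
  factors-length (centre {i} {s} i≤ _) 1≤i s≤N = begin
    i + (length (T [ i ⋯ s ]) + 0)   ≡⟨ cong (i +_) (+-identityʳ _) ⟩
    i + length (T [ i ⋯ s ])         ≡⟨ cong (i +_) (slice-length T (suc s ∸ i) 1≤i (≤-trans (≤-reflexive (m+[n∸m]≡n i≤)) (s≤s s≤N))) ⟩
    i + (suc s ∸ i)                  ≡⟨ m+[n∸m]≡n i≤ ⟩
    suc s                            ∎
    where open ≡-Reasoning
  factors-length (layer {i} {s} {d} 1≤d σ c) 1≤i s≤N
    with ih ← factors-length c (≤-trans 1≤i (m≤m+n i d)) (≤-trans (m≤m+n s d) s≤N) = begin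
    i + ∣ surround u (factors c) ∣                  ≡⟨ cong (i +_) (length-surround u (factors c)) ⟩
    i + (length u + (∣ factors c ∣ + length u))     ≡⟨ cong (λ d → i + (d + (∣ factors c ∣ + d))) (piece-length d 1≤i (layer-ordered c) s≤N) ⟩
    i + (d + (∣ factors c ∣ + d))                   ≡⟨ linear 4 (λ i d f s → i ⊞ d ⊞ f ≊ con 1 ⊞ s ⇛ goal (i ⊞ (d ⊞ (f ⊞ d)) ≊ con 1 ⊞ (s ⊞ d)))
                                                         i d ∣ factors c ∣ s ih ⟩
    suc (s + d)                                     ∎
    where
    open ≡-Reasoning
    u = T [ i ⋯ i + d ∸ 1 ]

  armLength : Factorization → ℕ
  armLength f = length (concat (arms f))

  armLength-surround : ∀ u f → armLength (surround u f) ≡ armLength f + length u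
  armLength-surround u f = begin
    length (concat (arms f ∷ʳ u))              ≡⟨ cong length (concat-++ (arms f) (u ∷ [])) ⟨
    length (concat (arms f) ++ (u ++ []))      ≡⟨ length-++ (concat (arms f)) ⟩
    armLength f + length (u ++ [])             ≡⟨ cong (λ v → armLength f + length v) (++-identityʳ u) ⟩
    armLength f + length u                     ∎
    where open ≡-Reasoning

  -- `armLength` is the `k` of `InF`, so the centre and `k` determine both ends of a chain.
  chain-arms : ∀ {i s} (c : Chain i s) → 1 ≤ i → s ≤ N →
               i + armLength (factors c) ≡ innerˡ c × innerʳ c + armLength (factors c) ≡ s
  chain-arms (centre {i} {s} _ _) _ _ = +-identityʳ i , +-identityʳ s
  chain-arms (layer {i} {s} {d} 1≤d σ c) 1≤i s≤N
    with hˡ , hʳ ← chain-arms c (≤-trans 1≤i (m≤m+n i d)) (≤-trans (m≤m+n s d) s≤N)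
    rewrite armLength-surround (T [ i ⋯ i + d ∸ 1 ]) (factors c) | piece-length {s = s} d 1≤i (layer-ordered c) s≤N =
    linear 4 (λ i k d l → i ⊞ d ⊞ k ≊ l ⇛ goal (i ⊞ (k ⊞ d) ≊ l)) i _ d _ hˡ ,
    trans (sym (+-assoc (innerʳ c) _ d)) (cong (_+ d) hʳ)

  chain-centre : ∀ {i s} (c : Chain i s) → center (factors c) ≡ T [ innerˡ c ⋯ innerʳ c ]
  chain-centre (centre _ _)  = refl
  chain-centre (layer _ _ c) = chain-centre c

  spans-++ : ∀ p xs ys → spans p (xs ++ ys) ≡ spans p xs ++ spans (p + length (concat xs)) ys
  spans-++ p []       ys = cong (λ q → spans q ys) (sym (+-identityʳ p))
  spans-++ p (x ∷ xs) ys = cong (λ zs → p ∷ p + length x ∸ 1 ∷ zs)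
    (trans (spans-++ (p + length x) xs ys)
      (cong (λ q → spans (p + length x) xs ++ spans q ys)
        (trans (+-assoc p _ _) (cong (p +_) (sym (length-++ x))))))

  chain-spans : ∀ {i s} (c : Chain i s) → 1 ≤ i → s ≤ N →
                spans i (blocks (factors c)) ≡ leftSpans c ++ innerˡ c ∷ innerʳ c ∷ rightSpans c
  chain-spans (centre {i} {s} i≤ σ) 1≤i s≤N =
    cong (λ e → i ∷ e ∸ 1 ∷ []) (trans (cong (i +_) (sym (+-identityʳ _))) (factors-length (centre i≤ σ) 1≤i s≤N))
  chain-spans (layer {i} {s} {d} 1≤d σ c) 1≤i s≤N = begin
    spans i (blocks (surround u (factors c)))
      ≡⟨ cong (spans i) (blocks-surround u (factors c)) ⟩
    i ∷ i + length u ∸ 1 ∷ spans (i + length u) (blocks (factors c) ++ u ∷ [])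
      ≡⟨ cong (λ d → i ∷ i + d ∸ 1 ∷ spans (i + d) (blocks (factors c) ++ u ∷ [])) u-length ⟩
    i ∷ i + d ∸ 1 ∷ spans (i + d) (blocks (factors c) ++ u ∷ [])
      ≡⟨ cong (λ xs → i ∷ i + d ∸ 1 ∷ xs) (spans-++ (i + d) (blocks (factors c)) (u ∷ [])) ⟩
    i ∷ i + d ∸ 1 ∷ spans (i + d) (blocks (factors c)) ++ spans (i + d + length (concat (blocks (factors c)))) (u ∷ [])
      ≡⟨ cong₂ (λ xs q → i ∷ i + d ∸ 1 ∷ xs ++ spans q (u ∷ [])) ih position ⟩
    i ∷ i + d ∸ 1 ∷ (leftSpans c ++ innerˡ c ∷ innerʳ c ∷ rightSpans c) ++ suc s ∷ s + length u ∷ []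
      ≡⟨ cong (λ xs → i ∷ i + d ∸ 1 ∷ xs) (++-assoc (leftSpans c) (innerˡ c ∷ innerʳ c ∷ rightSpans c) _) ⟩
    i ∷ i + d ∸ 1 ∷ leftSpans c ++ innerˡ c ∷ innerʳ c ∷ rightSpans c ++ suc s ∷ s + length u ∷ []
      ≡⟨ cong (λ d′ → i ∷ i + d ∸ 1 ∷ leftSpans c ++ innerˡ c ∷ innerʳ c ∷ rightSpans c ++ suc s ∷ s + d′ ∷ []) u-length ⟩
    i ∷ i + d ∸ 1 ∷ leftSpans c ++ innerˡ c ∷ innerʳ c ∷ rightSpans c ++ suc s ∷ s + d ∷ [] ∎
    where
    open ≡-Reasoning
    u = T [ i ⋯ i + d ∸ 1 ]
    u-length : length u ≡ d
    u-length = piece-length d 1≤i (layer-ordered c) s≤N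
    1≤i+d : 1 ≤ i + d
    1≤i+d = ≤-trans 1≤i (m≤m+n i d)
    s≤N′ : s ≤ N
    s≤N′ = ≤-trans (m≤m+n s d) s≤N
    ih = chain-spans c 1≤i+d s≤N′
    position : i + d + length (concat (blocks (factors c))) ≡ suc s
    position = trans (cong (λ xs → i + d + length xs) (IsBlockPalindrome.factors (largest-palindrome (chain-largest c 1≤i+d s≤N′))))
      (trans (cong (i + d +_) (slice-length T (suc s ∸ (i + d)) 1≤i+d
               (≤-trans (≤-reflexive (m+[n∸m]≡n (chain-ordered c))) (s≤s s≤N′))))
        (m+[n∸m]≡n (chain-ordered c)))

  chain-encode : ∀ {i s} (c : Chain i s) → 1 ≤ i → s ≤ N → encode (occurrence i (factors c)) ≡ report c
  chain-encode c 1≤i s≤N = trans (cong (_∷ʳ 0) (chain-spans c 1≤i s≤N)) (++-assoc (leftSpans c) _ (0 ∷ []))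

  -- The centre may be empty, so with at least one layer only the two arms of each layer are
  -- counted, and `2 * suc e` is at least `2 + e`. Without layers the centre is the whole, non-empty
  -- substring.
  chain-size : ∀ {i s} (c : Chain i s) → 1 ≤ i → i ≤ s → s ≤ N → suc (depth c) ≤ size (factors c)
  inner-size : ∀ {i s} (c : Chain i s) → 1 ≤ i → s ≤ N → 2 * depth c ≤ size (factors c)
  inner-size (centre _ _) _ _ = z≤n
  inner-size (layer {i} {s} {d} 1≤d σ c) 1≤i s≤N =
    ≤-trans (≤-trans (≤-reflexive (*-suc 2 (depth c))) (s≤s (s≤s (inner-size c (≤-trans 1≤i (m≤m+n i d)) (≤-trans (m≤m+n s d) s≤N)))))
      (≤-reflexive (sym (size-surround (factors c)
        (length⇒nonempty (subst (1 ≤_) (sym (piece-length d 1≤i (layer-ordered c) s≤N)) 1≤d)))))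
  chain-size (centre {i} {s} _ σ) 1≤i i≤s s≤N with T [ i ⋯ s ] in eq
  ... | _ ∷ _ = ≤-refl
  ... | []    = contradiction (trans (sym (m+[n∸m]≡n (m≤n⇒m≤1+n i≤s))) (trans (cong (i +_) empty) (+-identityʳ i))) (>⇒≢ (s≤s i≤s))
    where
    empty : suc s ∸ i ≡ 0
    empty = trans (sym (slice-length T (suc s ∸ i) 1≤i (≤-trans (≤-reflexive (m+[n∸m]≡n (m≤n⇒m≤1+n i≤s))) (s≤s s≤N)))) (cong length eq)
  chain-size (layer 1≤d σ c) 1≤i i≤s s≤N =
    ≤-trans (linear 1 (λ e → goal (con 2 ⊞ e ≼ 2 ⊠ (con 1 ⊞ e))) (depth c)) (inner-size (layer 1≤d σ c) 1≤i s≤N)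

-- Maximal block palindromes are the chains that cannot be extended

⌈∸2*⌉ : ∀ k x → ⌈ x ∸ 2 * k /2⌉ ≡ ⌈ x /2⌉ ∸ k
⌈∸2*⌉ zero    x rewrite *-zeroʳ 2 = refl
⌈∸2*⌉ (suc k) x rewrite *-suc 2 k = lemma x
  where
  lemma : ∀ x → ⌈ x ∸ (2 + 2 * k) /2⌉ ≡ ⌈ x /2⌉ ∸ suc k
  lemma zero          = refl
  lemma (suc zero)    = sym (0∸n≡0 k)
  lemma (suc (suc x)) = ⌈∸2*⌉ k x

⌊+2*⌋ : ∀ k x → ⌊ x + 2 * k /2⌋ ≡ ⌊ x /2⌋ + k
⌊+2*⌋ zero    x = trans (cong ⌊_/2⌋ (+-identityʳ x)) (sym (+-identityʳ ⌊ x /2⌋))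
⌊+2*⌋ (suc k) x = begin
  ⌊ x + 2 * suc k /2⌋         ≡⟨ cong ⌊_/2⌋ (lemma x k) ⟩
  suc ⌊ x + 2 * k /2⌋         ≡⟨ cong suc (⌊+2*⌋ k x) ⟩
  suc (⌊ x /2⌋ + k)           ≡⟨ +-suc ⌊ x /2⌋ k ⟨
  ⌊ x /2⌋ + suc k             ∎
  where
  open ≡-Reasoning
  lemma : ∀ x k → x + 2 * suc k ≡ 2 + (x + 2 * k)
  lemma = solve-∀

lo-shift : ∀ c₂ d k → ⌈ lo c₂ (d + k) /2⌉ ≡ ⌈ lo c₂ d /2⌉ ∸ k
lo-shift c₂ d k = trans (cong ⌈_/2⌉ (trans (cong (c₂ + 2 ∸_) (*-distribˡ-+ 2 d k)) (sym (∸-+-assoc (c₂ + 2) (2 * d) (2 * k)))))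
  (⌈∸2*⌉ k (lo c₂ d))

-- `1 ≤ d` keeps the subtraction of 2 in `hi` from truncating.
hi-shift : ∀ c₂ d k → 1 ≤ d → ⌊ hi c₂ (d + k) /2⌋ ≡ ⌊ hi c₂ d /2⌋ + k
hi-shift c₂ (suc d) k _ = trans (cong ⌊_/2⌋ lemma) (⌊+2*⌋ k (hi c₂ (suc d)))
  where
  expand : ∀ c d → c + 2 * suc d ≡ 2 + (c + 2 * d)
  expand = solve-∀
  lemma : hi c₂ (suc d + k) ≡ hi c₂ (suc d) + 2 * k
  lemma = trans (cong (_∸ 2) (expand c₂ (d + k)))
    (trans (trans (cong (c₂ +_) (*-distribˡ-+ 2 d k)) (sym (+-assoc c₂ (2 * d) (2 * k))))
      (cong (_+ 2 * k) (sym (cong (_∸ 2) (expand c₂ d)))))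

lo-hi : ∀ c₂ d → 1 ≤ d → ⌈ lo c₂ d /2⌉ ≤ suc ⌊ hi c₂ d /2⌋
lo-hi c₂ (suc d) _ = ≤-trans (⌈n/2⌉-mono (≤-trans lo≤ (≤-reflexive (sym hi≡)))) (⌈n/2⌉≤1+⌊n/2⌋ (hi c₂ (suc d)))
  where
  ⌈n/2⌉≤1+⌊n/2⌋ : ∀ n → ⌈ n /2⌉ ≤ suc ⌊ n /2⌋
  ⌈n/2⌉≤1+⌊n/2⌋ zero          = z≤n
  ⌈n/2⌉≤1+⌊n/2⌋ (suc zero)    = ≤-refl
  ⌈n/2⌉≤1+⌊n/2⌋ (suc (suc n)) = s≤s (⌈n/2⌉≤1+⌊n/2⌋ n)
  expand : ∀ c d → c + 2 * suc d ≡ 2 + (c + 2 * d)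
  expand = solve-∀
  hi≡ : hi c₂ (suc d) ≡ c₂ + 2 * d
  hi≡ = cong (_∸ 2) (expand c₂ d)
  lo≤ : lo c₂ (suc d) ≤ c₂ + 2 * d
  lo≤ = ≤-trans (≤-reflexive (cong₂ _∸_ (+-comm c₂ 2) (*-suc 2 d))) (≤-trans (m∸n≤m c₂ (2 * d)) (m≤m+n c₂ (2 * d)))

-- F_T(c,d) in terms of the first and last positions l and r of the centre block.
record Extends (T : String) (l r : ℕ) (o : Occurrence) : Set where
  k : ℕ
  k = length (concat (arms (fact o)))

  field
    center≡ : center (fact o) ≡ T [ l ⋯ r ]
    first≥1 : 1 ≤ l ∸ k
    last≤N  : r + k ≤ length T
    start≡  : start o ≡ l ∸ k
    largest : IsLargestBlockPalindrome (T [ l ∸ k ⋯ r + k ]) (fact o)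

inF⇒extends : ∀ {T c₂ d o} → 1 ≤ d → InF T c₂ d o → Extends T ⌈ lo c₂ d /2⌉ ⌊ hi c₂ d /2⌋ o
inF⇒extends {T} {c₂} {d} {o} 1≤d f = record
  { center≡ = center≡
  ; first≥1 = subst (1 ≤_) (lo-shift c₂ d k) (proj₁ within)
  ; last≤N  = subst (_≤ length T) (hi-shift c₂ d k 1≤d) (proj₂ within)
  ; start≡  = trans start≡ (lo-shift c₂ d k)
  ; largest = subst₂ (λ i j → IsLargestBlockPalindrome (T [ i ⋯ j ]) (fact o)) (lo-shift c₂ d k) (hi-shift c₂ d k 1≤d) largest
  }
  where open InF f

extends⇒inF : ∀ {T c₂ d o} → 1 ≤ d → Extends T ⌈ lo c₂ d /2⌉ ⌊ hi c₂ d /2⌋ o → InF T c₂ d o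
extends⇒inF {T} {c₂} {d} {o} 1≤d f = record
  { center≡ = center≡
  ; within  = subst (1 ≤_) (sym (lo-shift c₂ d k)) first≥1 , subst (_≤ length T) (sym (hi-shift c₂ d k 1≤d)) last≤N
  ; start≡  = trans start≡ (sym (lo-shift c₂ d k))
  ; largest = subst₂ (λ i j → IsLargestBlockPalindrome (T [ i ⋯ j ]) (fact o)) (sym (lo-shift c₂ d k)) (sym (hi-shift c₂ d k 1≤d)) largest
  }
  where open Extends f

-- The doubled centre l + r and d = ⌊n/2⌋ + 1 for a centre block of length n from l to r.
centre-ends : ∀ {l r} n → 1 ≤ l → l + n ≡ suc r →
              ⌈ lo (l + r) (suc ⌊ n /2⌋) /2⌉ ≡ l × ⌊ hi (l + r) (suc ⌊ n /2⌋) /2⌋ ≡ r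
centre-ends {suc l} {r} zero 1≤l e with refl ← trans (sym (+-identityʳ l)) (suc-injective e) =
  trans (cong (λ x → ⌈ x ∸ 2 /2⌉) (lemma l)) (half-ceil l) ,
  trans (cong (λ x → ⌊ x ∸ 2 /2⌋) (lemma l)) (half-floor l)
  where
  lemma : ∀ l → suc l + l + 2 ≡ 2 + (1 + 2 * l)
  lemma = solve-∀
  half-ceil : ∀ l → ⌈ 1 + 2 * l /2⌉ ≡ suc l
  half-ceil l = cong suc (trans (⌊+2*⌋ l 0) refl)
  half-floor : ∀ l → ⌊ 1 + 2 * l /2⌋ ≡ l
  half-floor l = ⌊+2*⌋ l 1
centre-ends {l} {r} (suc zero) 1≤l e with refl ← suc-injective (trans (+-comm 1 l) e) =
  trans (cong (λ x → ⌈ x ∸ 2 /2⌉) (lemma l)) (⌊+2*⌋ l 1) ,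
  trans (cong (λ x → ⌊ x ∸ 2 /2⌋) (lemma l)) (⌊+2*⌋ l 0)
  where
  lemma : ∀ l → l + l + 2 ≡ 2 + 2 * l
  lemma = solve-∀
centre-ends {l} {zero} (suc (suc n)) 1≤l e =
  ⊥-elim (linear 2 (λ l n → con 1 ≼ l ⇛ l ⊞ (con 2 ⊞ n) ≊ con 1 ⇛ absurd) l n 1≤l e)
-- Removing one letter at each end preserves the doubled centre, `suc l + r = l + suc r`, and lowers
-- `d` by one.
centre-ends {l} {suc r} (suc (suc n)) 1≤l e
  with ihˡ , ihʳ ← centre-ends {suc l} {r} n (s≤s z≤n)
         (linear 3 (λ l n r → l ⊞ (con 2 ⊞ n) ≊ con 2 ⊞ r ⇛ goal (con 1 ⊞ l ⊞ n ≊ con 1 ⊞ r)) l n r e)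
  rewrite +-suc l r =
  trans (trans (cong (λ d → ⌈ lo (suc (l + r)) d /2⌉) (+-comm 1 (suc ⌊ n /2⌋))) (lo-shift (suc (l + r)) (suc ⌊ n /2⌋) 1)) (cong (_∸ 1) ihˡ) ,
  trans (trans (cong (λ d → ⌊ hi (suc (l + r)) d /2⌋) (+-comm 1 (suc ⌊ n /2⌋))) (hi-shift (suc (l + r)) (suc ⌊ n /2⌋) 1 (s≤s z≤n)))
    (trans (cong (_+ 1) ihʳ) (+-comm r 1))

module Maximality (w : ℕ) (T : String) (words : All (_< 2 ^ w) T)
                  (room : (3 * suc (length T) + 3) * suc (length T) ≤ 2 ^ w) where

  open Strings-over w T words
  open BorderTheory letter
  open Chains letter
  open Tabulation w N letter room
  open ReportExecution w N letter room

  Extension : (i s i′ : ℕ) → Set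
  Extension i s i′ = ∃[ a ] ∃[ e ] 1 ≤ e × a + e ≡ i × i′ ≤ a × s + e ≤ N × Shortest a (s + e) e

  -- Layers of `c′` are removed from the outside until the inner start `i′ + d` is no longer left of
  -- `i`. If it equals `i`, the last layer is the extension. If it lies right of `i`, exchanging the
  -- chains yields an extension of that inner substring starting at or after `i`; by uniqueness it
  -- starts at `i′`, which lies left of `i`. The exchange terminates because a layer of `c′` is
  -- gone.
  extension : ∀ {i s i′ s′} (c : Chain i s) (c′ : Chain i′ s′) → 1 ≤ i → s ≤ N → 1 ≤ i′ → s′ ≤ N →
              innerˡ c ≡ innerˡ c′ → innerʳ c ≡ innerʳ c′ → i′ < i → Extension i s i′
  extension c (centre _ _) 1≤i s≤N 1≤i′ s′≤N eˡ eʳ i′<i =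
    contradiction (≤-trans (proj₁ (inner-ordered c)) (≤-reflexive eˡ)) (<⇒≱ i′<i)
  extension {i} {s} c (layer {i′} {s′} {d} 1≤d σ c″) 1≤i s≤N 1≤i′ s′≤N eˡ eʳ i′<i = by-cases (<-cmp (i′ + d) i)
    where
    1≤i′+d : 1 ≤ i′ + d
    1≤i′+d = ≤-trans 1≤i′ (m≤m+n i′ d)
    s′≤N′ : s′ ≤ N
    s′≤N′ = ≤-trans (m≤m+n s′ d) s′≤N
    same-last : i′ + d ≡ i → s′ ≡ s
    same-last e = begin
      s′                                       ≡⟨ proj₂ (chain-arms c″ 1≤i′+d s′≤N′) ⟨
      innerʳ c″ + armLength (factors c″)       ≡⟨ cong₂ _+_ (sym eʳ) same-arms ⟩
      innerʳ c + armLength (factors c)         ≡⟨ proj₂ (chain-arms c 1≤i s≤N) ⟩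
      s                                        ∎
      where
      open ≡-Reasoning
      same-arms : armLength (factors c″) ≡ armLength (factors c)
      same-arms = +-cancelˡ-≡ i _ _ (trans (cong (_+ armLength (factors c″)) (sym e))
        (trans (proj₁ (chain-arms c″ 1≤i′+d s′≤N′)) (trans (sym eˡ) (sym (proj₁ (chain-arms c 1≤i s≤N))))))
    widen : Extension i s (i′ + d) → Extension i s i′
    widen (a , e , 1≤e , a+e , ≤a , rest) = a , e , 1≤e , a+e , ≤-trans (m≤m+n i′ d) ≤a , rest
    clash : Extension (i′ + d) s′ i → Extension i s i′
    clash (a , e , 1≤e , a+e , i≤a , _ , σ′) = contradiction (≤-trans i≤a (≤-reflexive a≡)) (<⇒≱ i′<i)
      where
      a≡ : a ≡ i′
      a≡ = +-cancelʳ-≡ d a i′ (trans (cong (a +_) (sym (extension-unique 1≤e 1≤d a+e σ′ σ))) a+e)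
    by-cases : _ → Extension i s i′
    by-cases (tri< lt _ _) = widen (extension c c″ 1≤i s≤N 1≤i′+d s′≤N′ eˡ eʳ lt)
    by-cases (tri≈ _ e _)  = i′ , d , 1≤d , e , ≤-refl , subst (λ s → s + d ≤ N) (same-last e) s′≤N ,
                             subst (λ s → Shortest i′ (s + d) d) (same-last e) σ
    by-cases (tri> _ _ gt) = clash (extension c″ c 1≤i′+d s′≤N′ 1≤i s≤N (sym eˡ) (sym eʳ) gt)

  module _ {M : ℕ → ℕ} (tab : Tabulated M K K) where

    report-occurrence : Leaf tab → Occurrence
    report-occurrence x = occurrence (first x) (factors (leafChain x))

    chain-unique : ∀ {i s} (c c′ : Chain i s) → 1 ≤ i → s ≤ N → factors c ≡ factors c′
    chain-unique c c′ 1≤i s≤N = largest-unique (chain-largest c′ 1≤i s≤N) (largest-isLargest (chain-largest c 1≤i s≤N))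

    childless⇒no-extension : ∀ {i s a e} → child tab i s ≡ 0 → 1 ≤ a → 1 ≤ e → a + e ≡ i → s + e ≤ N → Shortest a (s + e) e → ⊥
    childless⇒no-extension {s = s} {a} {e} none 1≤a 1≤e refl s+e≤N σ =
      contradiction (trans (sym (complete tab 1≤a s+e≤N 1≤e (done-all tab a≤ s+e≤N) σ)) none) (>⇒≢ 1≤e)
      where
      a≤ : a ≤ s + e
      a≤ = linear 3 (λ a s e → a ⊞ e ⊞ e ≼ con 1 ⊞ (s ⊞ e) ⇛ con 1 ≼ e ⇛ goal (a ≼ s ⊞ e)) a s e (shortest-disjoint 1≤e σ) 1≤e

    -- A member of the same F_T(c,d) is a chain with the same centre. If it began further left,
    -- `extension` would give the leaf an extension; otherwise its length is at most that of the
    -- leaf.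
    leaf⇒maximal : ∀ x → MBP T (report-occurrence x)
    leaf⇒maximal x = l + r , suc ⌊ n /2⌋ , record
      { 1≤c     = linear 5 (λ i s l r k → i ⊞ k ≊ l ⇛ r ⊞ k ≊ s ⇛ con 1 ≼ i ⇛ i ≼ s ⇛ goal (con 2 ≼ l ⊞ r)) i s l r k hˡ hʳ (1≤first x) (ordered x)
      ; c≤N     = linear 6 (λ i s l r k N → i ⊞ k ≊ l ⇛ r ⊞ k ≊ s ⇛ i ≼ s ⇛ s ≼ N ⇛ goal (l ⊞ r ≼ 2 ⊠ N)) i s l r k N hˡ hʳ (ordered x) (last≤N x)
      ; 1≤d     = s≤s z≤n
      ; inRange = subst (1 ≤_) (sym endˡ) 1≤l , ≤-trans (≤-reflexive endʳ) (≤-trans (proj₂ (proj₂ (inner-ordered c))) (last≤N x))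
      ; inF     = extends⇒inF (s≤s z≤n) (subst₂ (λ l r → Extends T l r o) (sym endˡ) (sym endʳ) extends)
      ; longest = λ o′ f → bounded o′ (subst₂ (λ l r → Extends T l r o′) endˡ endʳ (inF⇒extends (s≤s z≤n) f))
      ; size≢0  = λ e → contradiction (≤-trans (chain-size c (1≤first x) (ordered x) (last≤N x)) (≤-reflexive e)) λ ()
      }
      where
      i = first x
      s = last x
      c = leafChain x
      o = report-occurrence x
      l = innerˡ c
      r = innerʳ c
      k = armLength (factors c)
      hˡ = proj₁ (chain-arms c (1≤first x) (last≤N x))
      hʳ = proj₂ (chain-arms c (1≤first x) (last≤N x))
      1≤l : 1 ≤ l
      1≤l = ≤-trans (1≤first x) (proj₁ (inner-ordered c))
      n = suc r ∸ l
      ends = centre-ends n 1≤l (m+[n∸m]≡n (proj₁ (proj₂ (inner-ordered c))))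
      endˡ = proj₁ ends
      endʳ = proj₂ ends
      l∸k : l ∸ k ≡ i
      l∸k = trans (cong (_∸ k) (sym hˡ)) (m+n∸n≡m i k)
      extends : Extends T l r o
      extends = record
        { center≡ = chain-centre c
        ; first≥1 = subst (1 ≤_) (sym l∸k) (1≤first x)
        ; last≤N  = ≤-trans (≤-reflexive hʳ) (last≤N x)
        ; start≡  = sym l∸k
        ; largest = subst₂ (λ i s → IsLargestBlockPalindrome (T [ i ⋯ s ]) (factors c)) (sym l∸k) (sym hʳ)
                      (largest-isLargest (chain-largest c (1≤first x) (last≤N x)))
        }
      bounded : ∀ o′ → Extends T l r o′ → ∣ fact o′ ∣ ≤ ∣ factors c ∣
      bounded o′ f = subst (λ f → ∣ f ∣ ≤ ∣ factors c ∣) (sym fact≡) (by-cases (i ≤? i′))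
        where
        open Extends f renaming (k to k′; first≥1 to 1≤i′; last≤N to s′≤N)
        i′ = l ∸ k′
        s′ = r + k′
        i′≤ : i′ ≤ suc s′
        i′≤ = ≤-trans (m∸n≤m l k′) (≤-trans (proj₁ (proj₂ (inner-ordered c))) (s≤s (m≤m+n r k′)))
        c′ : Chain i′ s′
        c′ = chain tab 1≤i′ i′≤ s′≤N
        fact≡ : fact o′ ≡ factors c′
        fact≡ = largest-unique (chain-largest c′ 1≤i′ s′≤N) largest
        k≡ : armLength (factors c′) ≡ k′
        k≡ = cong armLength (sym fact≡)
        i′+k′ : i′ + k′ ≡ l
        -- `1 ≤ l ∸ k′` shows that this subtraction did not truncate.
        i′+k′ = m∸n+n≡m {l} {k′} (<⇒≤ (m∸n≢0⇒n<m {l} {k′} λ e → contradiction (subst (1 ≤_) e 1≤i′) λ ()))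
        l≡ : innerˡ c ≡ innerˡ c′
        l≡ = trans (sym i′+k′) (trans (cong (i′ +_) (sym k≡)) (proj₁ (chain-arms c′ 1≤i′ s′≤N)))
        r≡ : innerʳ c ≡ innerʳ c′
        r≡ = sym (+-cancelʳ-≡ k′ _ r (trans (cong (innerʳ c′ +_) (sym k≡)) (proj₂ (chain-arms c′ 1≤i′ s′≤N))))
        by-cases : _ → ∣ factors c′ ∣ ≤ ∣ factors c ∣
        by-cases (yes i≤i′) = linear 9 (λ i i′ s r k k′ l f f′ → i ⊞ k ≊ l ⇛ i′ ⊞ k′ ≊ l ⇛ r ⊞ k ≊ s ⇛ i ≼ i′ ⇛ i ⊞ f ≊ con 1 ⊞ s ⇛
            i′ ⊞ f′ ≊ con 1 ⊞ (r ⊞ k′) ⇛ goal (f′ ≼ f)) i i′ s r k k′ l ∣ factors c ∣ ∣ factors c′ ∣ hˡ i′+k′ hʳ i≤i′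
            (factors-length c (1≤first x) (last≤N x)) (factors-length c′ 1≤i′ s′≤N)
        by-cases (no i≰i′)
          with a , e , 1≤e , a+e , i′≤a , s+e≤N , σ ← extension c c′ (1≤first x) (last≤N x) 1≤i′ s′≤N l≡ r≡ (≰⇒> i≰i′) =
          ⊥-elim (childless⇒no-extension (childless x) (≤-trans 1≤i′ i′≤a) 1≤e a+e s+e≤N σ)

    Listed : List (Leaf tab) → ℕ → ℕ → Set
    Listed xs i s = ∃[ x ] x ∈ xs × first x ≡ i × last x ≡ s

    listed-⊆ : ∀ {xs ys i s} → (∀ {x} → x ∈ xs → x ∈ ys) → Listed xs i s → Listed ys i s
    listed-⊆ inclusion (x , x∈ , p) = x , inclusion x∈ , p

    row-listed : ∀ n {i s j} (s+n : s + n ≡ K) (1≤i : 1 ≤ i) (i≤s : i ≤ s) → s ≤ j → j ≤ N → child tab i j ≡ 0 →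
                 Listed (rowLeaves tab n s+n 1≤i i≤s) i j
    row-listed zero {s = s} {j} s+n _ _ s≤j j≤N _ =
      ⊥-elim (linear 3 (λ s j N → s ⊞ con 0 ≊ con 1 ⊞ N ⇛ s ≼ j ⇛ j ≼ N ⇛ absurd) s j N s+n s≤j j≤N)
    row-listed (suc n) {i} {s} s+n 1≤i i≤s s≤j j≤N none with child tab i s ≟ 0 | m≤n⇒m<n∨m≡n s≤j
    ... | yes _ | inj₂ refl = _ , here refl , refl , refl
    ... | no h≢ | inj₂ refl = contradiction none h≢
    ... | yes _ | inj₁ s<j = listed-⊆ there (row-listed n (trans (sym (+-suc s n)) s+n) 1≤i (m≤n⇒m≤1+n i≤s) s<j j≤N none)
    ... | no _  | inj₁ s<j = row-listed n (trans (sym (+-suc s n)) s+n) 1≤i (m≤n⇒m≤1+n i≤s) s<j j≤N none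

    all-listed : ∀ n {i j s} (i+n : i + n ≡ K) (1≤i : 1 ≤ i) → i ≤ j → j ≤ s → s ≤ N → child tab j s ≡ 0 →
                 Listed (allLeaves tab n i+n 1≤i) j s
    all-listed zero {i} {j} {s} i+n _ i≤j j≤s s≤N _ =
      ⊥-elim (linear 4 (λ i j s N → i ⊞ con 0 ≊ con 1 ⊞ N ⇛ i ≼ j ⇛ j ≼ s ⇛ s ≼ N ⇛ absurd) i j s N i+n i≤j j≤s s≤N)
    all-listed (suc n) {i} i+n 1≤i i≤j j≤s s≤N none with m≤n⇒m<n∨m≡n i≤j
    ... | inj₂ refl = listed-⊆ ∈-++⁺ˡ (row-listed (suc n) i+n 1≤i ≤-refl j≤s s≤N none)
    ... | inj₁ i<j =
      listed-⊆ (∈-++⁺ʳ (rowLeaves tab (suc n) i+n 1≤i ≤-refl)) (all-listed n (trans (sym (+-suc i n)) i+n) (s≤s z≤n) i<j j≤s s≤N none)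

    leaf-listed : ∀ {i s} → 1 ≤ i → i ≤ s → s ≤ N → child tab i s ≡ 0 → Listed (leaves tab) i s
    leaf-listed 1≤i i≤s s≤N none = all-listed N refl ≤-refl 1≤i i≤s s≤N none

    report-≡ : ∀ {i s} x (c : Chain i s) → first x ≡ i → last x ≡ s → report-occurrence x ≡ occurrence i (factors c)
    report-≡ x c refl refl = cong (occurrence (first x)) (chain-unique (leafChain x) c (1≤first x) (last≤N x))

    -- A positive entry of table 2 would, by `sound`, add a layer to the chain of `o`. The centre is
    -- unchanged, so this is a longer member of the same F_T(c,d), against maximality.
    maximal⇒leaf : ∀ {o} → MBP T o → o ∈ map report-occurrence (leaves tab)
    maximal⇒leaf {o} (c₂ , d , mx) = member (leaf-listed 1≤i i≤s s≤N none)
      where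
      open IsMaximalAt mx using (1≤d; inF; size≢0) renaming (longest to maximal)
      open Extends (inF⇒extends 1≤d inF) renaming (first≥1 to 1≤i; last≤N to s≤N)
      l = ⌈ lo c₂ d /2⌉
      r = ⌊ hi c₂ d /2⌋
      i = l ∸ k
      s = r + k
      i≤1+s : i ≤ suc s
      i≤1+s = ≤-trans (m∸n≤m l k) (≤-trans (lo-hi c₂ d 1≤d) (s≤s (m≤m+n r k)))
      c : Chain i s
      c = chain tab 1≤i i≤1+s s≤N
      fact≡ : fact o ≡ factors c
      fact≡ = largest-unique (chain-largest c 1≤i s≤N) largest
      empty-size : ∀ {i s} (c : Chain i s) → i ≡ suc s → size (factors c) ≡ 0
      empty-size (centre {s = s} _ _) refl = cong (λ n → size (factorization (take n (drop s T)) [])) (n∸n≡0 s)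
      empty-size (layer {i} {s} {d} 1≤d σ c) refl = ⊥-elim (linear 2 (λ s d → con 1 ⊞ (s ⊞ d) ⊞ d ⊞ d ≼ con 1 ⊞ (s ⊞ d) ⇛ con 1 ≼ d ⇛ absurd)
                                                    s d (shortest-disjoint 1≤d σ) 1≤d)
      -- `size≢0` excludes the occurrence that consists only of an empty centre.
      i≤s : i ≤ s
      i≤s with m≤n⇒m<n∨m≡n i≤1+s
      ... | inj₁ i<   = s≤s⁻¹ i<
      ... | inj₂ i≡   = contradiction (trans (cong size fact≡) (empty-size c i≡)) size≢0
      none : child tab i s ≡ 0
      none = n≤0⇒n≡0 (≮⇒≥ λ 1≤v → parent 1≤v (sound tab 1≤i s≤N 1≤v))
        where
        grow : ∀ a e → 1 ≤ a → a + e ≡ i → s + e ≤ N → Shortest a (s + e) e → 1 ≤ e → ⊥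
        grow a e 1≤a a+e s+e≤N σ 1≤e = <⇒≱ longer (subst (λ f → ∣ factors c′ ∣ ≤ ∣ f ∣) fact≡ (maximal o′ (extends⇒inF 1≤d extends)))
          where
          c′ : Chain a (s + e)
          c′ = layer 1≤e σ (subst (λ i → Chain i s) (sym a+e) c)
          factors-subst : ∀ {i j} (e : i ≡ j) (c : Chain i s) → factors (subst (λ i → Chain i s) e c) ≡ factors c
          factors-subst refl c = refl
          o′ : Occurrence
          o′ = occurrence a (factors c′)
          u-length : length (T [ a ⋯ a + e ∸ 1 ]) ≡ e
          u-length = piece-length e 1≤a (≤-trans (m≤m+n a e) (≤-trans (≤-reflexive a+e) i≤1+s)) s+e≤N
          inner≡ : factors (subst (λ i → Chain i s) (sym a+e) c) ≡ fact o
          inner≡ = trans (factors-subst (sym a+e) c) (sym fact≡)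
          k′≡ : length (concat (arms (fact o′))) ≡ k + e
          k′≡ = trans (armLength-surround _ (factors (subst (λ i → Chain i s) (sym a+e) c))) (cong₂ _+_ (cong armLength inner≡) u-length)
          a≡ : l ∸ length (concat (arms (fact o′))) ≡ a
          a≡ = trans (cong (l ∸_) k′≡) (trans (sym (∸-+-assoc l k e)) (trans (cong (_∸ e) (sym a+e)) (m+n∸n≡m a e)))
          s≡ : r + length (concat (arms (fact o′))) ≡ s + e
          s≡ = trans (cong (r +_) k′≡) (sym (+-assoc r k e))
          extends : Extends T l r o′
          extends = record
            { center≡ = trans (cong center inner≡) center≡
            ; first≥1 = subst (1 ≤_) (sym a≡) 1≤a
            ; last≤N  = ≤-trans (≤-reflexive s≡) s+e≤N
            ; start≡  = sym a≡
            ; largest = subst₂ (λ i s → IsLargestBlockPalindrome (T [ i ⋯ s ]) (fact o′)) (sym a≡) (sym s≡)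
                          (largest-isLargest (chain-largest c′ 1≤a s+e≤N))
            }
          longer : ∣ factors c ∣ < ∣ factors c′ ∣
          longer = linear 6 (λ i s a e f f′ → i ⊞ f ≊ con 1 ⊞ s ⇛ a ⊞ f′ ≊ con 1 ⊞ (s ⊞ e) ⇛ a ⊞ e ≊ i ⇛ con 1 ≼ e ⇛ goal (f ≺ f′))
            i s a e ∣ factors c ∣ ∣ factors c′ ∣ (factors-length c 1≤i s≤N) (factors-length c′ 1≤a s+e≤N) a+e 1≤e
        parent : 1 ≤ child tab i s → ∃[ a ] 1 ≤ a × a + child tab i s ≡ i × s + child tab i s ≤ N × Shortest a (s + child tab i s) (child tab i s) → ⊥
        parent 1≤e (a , 1≤a , a+e , s+e≤N , σ) = grow a (child tab i s) 1≤a a+e s+e≤N σ 1≤e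
      member : Listed (leaves tab) i s → o ∈ map report-occurrence (leaves tab)
      member (x , x∈ , first≡ , last≡) = subst (_∈ map report-occurrence (leaves tab))
        (trans (report-≡ x c first≡ last≡) (sym (cong₂ occurrence start≡ fact≡))) (∈-map⁺ report-occurrence x∈)

-- Every non-empty substring lies on a reported chain, so the output has quadratic size

unique-⊆⇒length-≤ : ∀ {A : Set} {xs ys : List A} → Unique xs → (∀ {x} → x ∈ xs → x ∈ ys) → length xs ≤ length ys
unique-⊆⇒length-≤ []                            _         = z≤n
unique-⊆⇒length-≤ {xs = x ∷ xs} (x∉xs ∷ unique) inclusion with us , vs , refl ← ∈-∃++ (inclusion (here refl)) =
  ≤-trans (s≤s (unique-⊆⇒length-≤ unique smaller))
    (≤-reflexive (trans (cong suc (length-++ us)) (trans (sym (+-suc (length us) (length vs))) (sym (length-++ us)))))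
  where
  smaller : ∀ {y} → y ∈ xs → y ∈ us ++ vs
  smaller {y} y∈ with ∈-++⁻ us (inclusion (there y∈))
  ... | inj₁ y∈us         = ∈-++⁺ˡ y∈us
  ... | inj₂ (here refl)  = contradiction refl (All.lookup x∉xs y∈)
  ... | inj₂ (there y∈vs) = ∈-++⁺ʳ us y∈vs

substrings : ℕ → List (ℕ × ℕ)
substrings zero    = []
substrings (suc n) = map (λ i → suc i , suc n) (upTo (suc n)) ++ substrings n

∈-substrings : ∀ n {i s} → (i , s) ∈ substrings n → 1 ≤ i × i ≤ s × s ≤ n
∈-substrings (suc n) p with ∈-++⁻ (map (λ i → suc i , suc n) (upTo (suc n))) p
... | inj₂ q with 1≤i , i≤s , s≤n ← ∈-substrings n q = 1≤i , i≤s , m≤n⇒m≤1+n s≤n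
... | inj₁ q with j , j∈ , refl ← ∈-map⁻ (λ i → suc i , suc n) q = s≤s z≤n , ∈-upTo⁻ j∈ , ≤-refl

substrings-unique : ∀ n → Unique (substrings n)
substrings-unique zero    = []
substrings-unique (suc n) = Unique.++⁺ (Unique.map⁺ (λ e → suc-injective (,-injectiveˡ e)) (Unique.upTo⁺ (suc n)))
  (substrings-unique n) λ { (p , q) → disjoint p q }
  where
  disjoint : ∀ {x} → x ∈ map (λ i → suc i , suc n) (upTo (suc n)) → x ∈ substrings n → ⊥
  disjoint p q with _ , _ , refl ← ∈-map⁻ (λ i → suc i , suc n) p = <⇒≱ ≤-refl (proj₂ (proj₂ (∈-substrings n q)))

length-substrings : ∀ n → 2 * length (substrings n) ≡ n * suc n
length-substrings zero    = refl
length-substrings (suc n) = begin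
  2 * length (substrings (suc n))              ≡⟨ cong (2 *_) (length-++ (map (λ i → suc i , suc n) (upTo (suc n)))) ⟩
  2 * (length (map (λ i → suc i , suc n) (upTo (suc n))) + length (substrings n))
                                               ≡⟨ cong (λ x → 2 * (x + length (substrings n))) (trans (length-map _ (upTo (suc n))) (length-upTo (suc n))) ⟩
  2 * (suc n + length (substrings n))          ≡⟨ *-distribˡ-+ 2 (suc n) _ ⟩
  2 * suc n + 2 * length (substrings n)        ≡⟨ cong (2 * suc n +_) (length-substrings n) ⟩
  2 * suc n + n * suc n                        ≡⟨ lemma n ⟩
  suc n * suc (suc n)                          ∎
  where
  open ≡-Reasoning
  lemma : ∀ n → 2 * suc n + n * suc n ≡ suc n * suc (suc n)
  lemma = solve-∀

-- Counting and distinctness of the reported occurrences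

module Enumeration (w : ℕ) (T : String) (words : All (_< 2 ^ w) T)
                   (room : (3 * suc (length T) + 3) * suc (length T) ≤ 2 ^ w) where

  open Strings-over w T words
  open BorderTheory letter
  open Chains letter
  open Tabulation w N letter room
  open ReportExecution w N letter room
  open Maximality w T words room

  nodes : ∀ {i s} → Chain i s → List (ℕ × ℕ)
  nodes (centre {i} {s} _ _)      = (i , s) ∷ []
  nodes (layer {i} {s} {d} _ _ c) = (i , s + d) ∷ nodes c

  length-nodes : ∀ {i s} (c : Chain i s) → length (nodes c) ≡ suc (depth c)
  length-nodes (centre _ _)  = refl
  length-nodes (layer _ _ c) = cong suc (length-nodes c)

  head-node : ∀ {i s} (c : Chain i s) → (i , s) ∈ nodes c
  head-node (centre _ _)  = here refl
  head-node (layer _ _ _) = here refl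

  -- Shortest borders are unique, so a chain through the outer substring has no choice but to
  -- continue with the inner one.
  inner-node : ∀ {i s a b e} (c : Chain i s) → (a , b + e) ∈ nodes c → 1 ≤ e → Shortest a (b + e) e → (a + e , b) ∈ nodes c
  inner-node (centre _ σ₀) (here p) 1≤e σ with refl ← ,-injectiveˡ p =
    contradiction (shortest-unique (subst (λ s → Shortest _ s _) (,-injectiveʳ p) σ) σ₀) (>⇒≢ 1≤e)
  inner-node {b = b} {e} (layer {i} {s} {d} 1≤d σ′ c) (here p) 1≤e σ with refl ← ,-injectiveˡ p
    with refl ← shortest-unique (subst (λ s → Shortest i s e) (,-injectiveʳ p) σ) σ′
    with refl ← +-cancelʳ-≡ e b s (,-injectiveʳ p) = there (head-node c)
  inner-node (layer _ _ c) (there p) 1≤e σ = there (inner-node c p 1≤e σ)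

  module _ {M : ℕ → ℕ} (tab : Tabulated M K K) where

    leafNodes : List (Leaf tab) → List (ℕ × ℕ)
    leafNodes = concatMap λ x → nodes (leafChain x)

    length-leafNodes : ∀ xs → length (leafNodes xs) ≡ weight tab xs
    length-leafNodes []       = refl
    length-leafNodes (x ∷ xs) = trans (length-++ (nodes (leafChain x))) (cong₂ _+_ (length-nodes (leafChain x)) (length-leafNodes xs))

    leafNodes⁺ : ∀ {xs p} x → x ∈ xs → p ∈ nodes (leafChain x) → p ∈ leafNodes xs
    leafNodes⁺ x (here refl) p = ∈-++⁺ˡ p
    leafNodes⁺ x (there {x = y} x∈) p = ∈-++⁺ʳ (nodes (leafChain y)) (leafNodes⁺ x x∈ p)

    OnChain : ℕ → ℕ → Set
    OnChain i s = ∃[ x ] x ∈ leaves tab × (i , s) ∈ nodes (leafChain x)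

    -- An extension begins strictly further left, so repeated extension ends at a leaf, with `n`
    -- bounding the left end. On the way back `inner-node` places each inner substring on the chain
    -- of that leaf.
    on-chain : ∀ n {i s} → i ≤ n → 1 ≤ i → i ≤ s → s ≤ N → OnChain i s
    on-chain n {i} {s} i≤n 1≤i i≤s s≤N with m≤n⇒m<n∨m≡n (z≤n {child tab i s})
    ... | inj₂ none = top (leaf-listed tab 1≤i i≤s s≤N (sym none))
      where
      top : Listed tab (leaves tab) i s → OnChain i s
      top (x , x∈ , refl , refl) = x , x∈ , head-node (leafChain x)
    ... | inj₁ 1≤e = ascend n i≤n (sound tab 1≤i s≤N 1≤e)
      where
      e = child tab i s
      ascend : ∀ n → i ≤ n → ∃[ a ] 1 ≤ a × a + e ≡ i × s + e ≤ N × Shortest a (s + e) e → OnChain i s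
      ascend zero i≤0 _ = contradiction (≤-trans 1≤i i≤0) λ ()
      ascend (suc n) i≤1+n (a , 1≤a , a+e , s+e≤N , σ) = descend (on-chain n
        (linear 4 (λ a e i n → a ⊞ e ≊ i ⇛ con 1 ≼ e ⇛ i ≼ con 1 ⊞ n ⇛ goal (a ≼ n)) a e i n a+e 1≤e i≤1+n) 1≤a
        (linear 4 (λ a e i s → a ⊞ e ≊ i ⇛ i ≼ s ⇛ goal (a ≼ s ⊞ e)) a e i s a+e i≤s) s+e≤N)
        where
        descend : OnChain a (s + e) → OnChain i s
        descend (x , x∈ , p) = x , x∈ , subst (λ i → (i , s) ∈ nodes (leafChain x)) a+e (inner-node (leafChain x) p 1≤e σ)

    -- Pigeonhole: the distinct pairs in `substrings N` all occur among the nodes of the leaf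
    -- chains.
    quadratic : N * suc N ≤ 2 * weight tab (leaves tab)
    quadratic = ≤-trans (≤-reflexive (sym (length-substrings N))) (*-monoʳ-≤ 2 (≤-trans
      (unique-⊆⇒length-≤ (substrings-unique N) cover) (≤-reflexive (length-leafNodes (leaves tab)))))
      where
      cover : ∀ {p} → p ∈ substrings N → p ∈ leafNodes (leaves tab)
      cover {i , s} p with 1≤i , i≤s , s≤N ← ∈-substrings N p with x , x∈ , q ← on-chain i ≤-refl 1≤i i≤s s≤N = leafNodes⁺ x x∈ q

    weight≤totalSize : ∀ xs → weight tab xs ≤ totalSize (map (report-occurrence tab) xs)
    weight≤totalSize []       = z≤n
    weight≤totalSize (x ∷ xs) = +-mono-≤ (chain-size (leafChain x) (1≤first x) (ordered x) (last≤N x)) (weight≤totalSize xs)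

    encode-reports : ∀ xs → encodeAll (map (report-occurrence tab) xs) ≡ reports tab xs
    encode-reports []       = refl
    encode-reports (x ∷ xs) = cong₂ _++_ (chain-encode (leafChain x) (1≤first x) (last≤N x)) (encode-reports xs)

    -- The strict lexicographic order in which the loops visit substrings; sortedness yields the
    -- uniqueness of the enumeration.
    _Before_ : Leaf tab → Leaf tab → Set
    x Before y = first x < first y ⊎ first x ≡ first y × last x < last y

    row-bounds : ∀ n {i s} (s+n : s + n ≡ K) (1≤i : 1 ≤ i) (i≤s : i ≤ s) →
                 All (λ x → first x ≡ i × s ≤ last x) (rowLeaves tab n s+n 1≤i i≤s)
    row-bounds zero    _ _ _ = []
    row-bounds (suc n) {i} {s} s+n 1≤i i≤s with child tab i s ≟ 0
    ... | yes _ = (refl , ≤-refl) ∷ All.map (λ (p , q) → p , <⇒≤ q) (row-bounds n _ 1≤i _)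
    ... | no _  = All.map (λ (p , q) → p , <⇒≤ q) (row-bounds n _ 1≤i _)

    row-sorted : ∀ n {i s} (s+n : s + n ≡ K) (1≤i : 1 ≤ i) (i≤s : i ≤ s) → AllPairs _Before_ (rowLeaves tab n s+n 1≤i i≤s)
    row-sorted zero    _ _ _ = []
    row-sorted (suc n) {i} {s} s+n 1≤i i≤s with child tab i s ≟ 0
    ... | yes _ = All.map (λ (p , q) → inj₂ (sym p , q)) (row-bounds n _ 1≤i _) ∷ row-sorted n _ 1≤i _
    ... | no _  = row-sorted n _ 1≤i _

    all-bounds : ∀ n {i} (i+n : i + n ≡ K) (1≤i : 1 ≤ i) → All (λ x → i ≤ first x) (allLeaves tab n i+n 1≤i)
    all-bounds zero    _ _ = []
    all-bounds (suc n) i+n 1≤i = All.++⁺ (All.map (λ (p , _) → ≤-reflexive (sym p)) (row-bounds (suc n) i+n 1≤i ≤-refl))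
                                         (All.map <⇒≤ (all-bounds n _ (s≤s z≤n)))

    all-sorted : ∀ n {i} (i+n : i + n ≡ K) (1≤i : 1 ≤ i) → AllPairs _Before_ (allLeaves tab n i+n 1≤i)
    all-sorted zero    _ _ = []
    all-sorted (suc n) i+n 1≤i = AllPairs.++⁺ (row-sorted (suc n) i+n 1≤i ≤-refl) (all-sorted n _ (s≤s z≤n))
      (All.map (λ (p , _) → All.map (λ q → inj₁ (≤-trans (s≤s (≤-reflexive p)) q)) (all-bounds n _ (s≤s z≤n)))
               (row-bounds (suc n) i+n 1≤i ≤-refl))

    -- An `Occurrence` does not record its last position; `factors-length` recovers it from the
    -- start and the total length.
    before⇒distinct : ∀ {x y} → x Before y → report-occurrence tab x ≢ report-occurrence tab y
    before⇒distinct (inj₁ lt) e = <⇒≢ lt (cong start e)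
    before⇒distinct {x} {y} (inj₂ (_ , lt)) e = <⇒≢ lt (suc-injective (begin
      suc (last x)                            ≡⟨ factors-length (leafChain x) (1≤first x) (last≤N x) ⟨
      first x + ∣ factors (leafChain x) ∣     ≡⟨ cong₂ _+_ (cong start e) (cong (λ o → ∣ fact o ∣) e) ⟩
      first y + ∣ factors (leafChain y) ∣     ≡⟨ factors-length (leafChain y) (1≤first y) (last≤N y) ⟩
      suc (last y)                            ∎))
      where open ≡-Reasoning

    enumerates : Enumerates (map (report-occurrence tab) (leaves tab)) (MBP T)
    enumerates = record
      { unique = AllPairs.map⁺ (AllPairs.map (λ {x} {y} → before⇒distinct {x} {y}) (all-sorted N refl ≤-refl))
      ; exact  = λ o → mk⇔ maximal (maximal⇒leaf tab)
      }
      where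
      maximal : ∀ {o} → o ∈ map (report-occurrence tab) (leaves tab) → MBP T o
      maximal o∈ with x , _ , refl ← ∈-map⁻ (report-occurrence tab) o∈ = leaf⇒maximal tab x

-- Word size and running time

n<2^bits : ∀ n → n < 2 ^ bits n
n<2^bits n = ≰⇒> λ h → <⇒≱ ≤-refl (subst (_≤ ⌊log₂ n ⌋) (⌊log₂[2^n]⌋≡n (bits n)) (⌊log₂⌋-mono-≤ h))

n≤2^n : ∀ n → n ≤ 2 ^ n
n≤2^n zero    = z≤n
n≤2^n (suc n) = ≤-trans (+-mono-≤ (m^n>0 2 n) (n≤2^n n)) (≤-reflexive (cong (2 ^ n +_) (sym (+-identityʳ (2 ^ n)))))

-- With `Y = 2 ^ bits N`, which exceeds `N`, the addresses are bounded by
-- `(3 * Y + 3) * Y ≤ 8 * Y * Y ≤ Y ^ 5`, whence the 5. The letters are bounded by `2 ^ m * Y ^ k`,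
-- whence `m + k`.
exponent : ℕ → ℕ → ℕ
exponent m k = m + k + 5

tables-fit : ∀ m k w N → exponent m k * bits N ≤ w → (3 * suc N + 3) * suc N ≤ 2 ^ w
tables-fit m k w N a≤w = begin
  (3 * suc N + 3) * suc N       ≤⟨ *-mono-≤ (+-mono-≤ (*-monoʳ-≤ 3 (n<2^bits N)) (≤-refl {3})) (n<2^bits N) ⟩
  (3 * Y + 3) * Y               ≤⟨ *-monoˡ-≤ Y (linear 1 (λ y → con 2 ≼ y ⇛ goal (3 ⊠ y ⊞ con 3 ≼ 8 ⊠ y)) Y 2≤Y) ⟩
  8 * Y * Y                     ≤⟨ *-monoˡ-≤ Y (*-monoˡ-≤ Y (^-monoˡ-≤ 3 2≤Y)) ⟩
  Y ^ 3 * Y * Y                 ≡⟨ lemma Y ⟩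
  Y ^ 5                         ≡⟨ ^-*-assoc 2 (bits N) 5 ⟩
  2 ^ (bits N * 5)              ≤⟨ ^-monoʳ-≤ 2 (≤-trans (≤-reflexive (*-comm (bits N) 5)) (≤-trans (*-monoˡ-≤ (bits N) (m≤n+m 5 (m + k))) a≤w)) ⟩
  2 ^ w                         ∎
  where
  open ≤-Reasoning
  Y = 2 ^ bits N
  2≤Y : 2 ≤ Y
  2≤Y = ^-monoʳ-≤ 2 {1} {bits N} (s≤s z≤n)
  lemma : ∀ y → y * (y * (y * 1)) * y * y ≡ y * (y * (y * (y * (y * 1))))
  lemma = solve-∀

letters-fit : ∀ m k w N → exponent m k * bits N ≤ w → m * N ^ k ≤ 2 ^ w
letters-fit m k w N a≤w = begin
  m * N ^ k                          ≤⟨ *-mono-≤ (n≤2^n m) (^-monoˡ-≤ k (<⇒≤ (n<2^bits N))) ⟩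
  2 ^ m * (2 ^ bits N) ^ k           ≡⟨ cong (2 ^ m *_) (^-*-assoc 2 (bits N) k) ⟩
  2 ^ m * 2 ^ (bits N * k)           ≡⟨ ^-distribˡ-+-* 2 m (bits N * k) ⟨
  2 ^ (m + bits N * k)               ≤⟨ ^-monoʳ-≤ 2 (≤-trans exponent≤ a≤w) ⟩
  2 ^ w                              ∎
  where
  open ≤-Reasoning
  exponent≤ : m + bits N * k ≤ exponent m k * bits N
  exponent≤ = begin
    m + bits N * k                             ≤⟨ +-monoˡ-≤ (bits N * k) (m≤m*n m (bits N)) ⟩
    m * bits N + bits N * k                    ≤⟨ m≤m+n _ (5 * bits N) ⟩
    m * bits N + bits N * k + 5 * bits N       ≡⟨ lemma m k (bits N) ⟩
    exponent m k * bits N                      ∎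
    where
    lemma : ∀ m k b → m * b + b * k + 5 * b ≡ (m + k + 5) * b
    lemma = solve-∀

cells-beyond : ∀ w T {i} → length T ≤ i → cells w T i ≡ 0
cells-beyond w []      _         = refl
cells-beyond w (_ ∷ T) (s≤s T≤i) = cells-beyond w T T≤i

-- In units, the cost is 3N(N+1) + 4N + 4x and at most 3 more. By `area` the first term is at most
-- 6x, and 3 ≤ 3N, so 10x + 7N is enough.
total-cost : ∀ u N x y → 8 ≤ u → 1 ≤ N → N * suc N ≤ 2 * x → x ≤ y →
             (u * (2 * suc N + 2) * N + u + 6) + (2 + (u * ((suc N + 2) * N + 4 * x) + u)) ≤ 10 * u * (N + y)
total-cost u N x y 8≤u 1≤N area x≤y = begin
  (u * (2 * suc N + 2) * N + u + 6) + (2 + (u * ((suc N + 2) * N + 4 * x) + u))  ≡⟨ expand u N x ⟩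
  u * (3 * (N * suc N) + 4 * N + 2 + 4 * x) + 8                                 ≤⟨ +-monoʳ-≤ _ 8≤u ⟩
  u * (3 * (N * suc N) + 4 * N + 2 + 4 * x) + u                                 ≡⟨ collect u (3 * (N * suc N) + 4 * N + 2 + 4 * x) ⟩
  u * (3 * (N * suc N) + 4 * N + 2 + 4 * x + 1)                                 ≤⟨ *-monoʳ-≤ u
    (linear 4 (λ q n x y → q ≼ 2 ⊠ x ⇛ con 1 ≼ n ⇛ x ≼ y ⇛ goal (3 ⊠ q ⊞ 4 ⊠ n ⊞ con 2 ⊞ 4 ⊠ x ⊞ con 1 ≼ 10 ⊠ (n ⊞ y)))
      (N * suc N) N x y area 1≤N x≤y) ⟩
  u * (10 * (N + y))                                                            ≡⟨ regroup u (N + y) ⟩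
  10 * u * (N + y)                                                              ∎
  where
  open ≤-Reasoning
  expand : ∀ u N x → (u * (2 * suc N + 2) * N + u + 6) + (2 + (u * ((suc N + 2) * N + 4 * x) + u)) ≡
                     u * (3 * (N * suc N) + 4 * N + 2 + 4 * x) + 8
  expand = solve-∀
  collect : ∀ u z → u * z + u ≡ u * (z + 1)
  collect = solve-∀
  regroup : ∀ u z → u * (10 * z) ≡ 10 * u * z
  regroup = solve-∀

-- The program and its correctness

enumerator : Program
enumerator = code 0 (tabulateBorders ⨾ reportAll) ++ halt ∷ []

module Correctness (w : ℕ) (T : String) (1≤N : 1 ≤ length T) (words : All (_< 2 ^ w) T)
                   (room : (3 * suc (length T) + 3) * suc (length T) ≤ 2 ^ w) where

  open Strings-over w T words
  open Execution w
  open Tabulation w N letter room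
  open ScanExecution w N letter room
  open ReportExecution w N letter room
  open Maximality w T words room
  open Enumeration w T words room

  -- The tables start out as zeros, which stand for "no border" and "no extension".
  letter-beyond : ∀ {x} → N < x → letter x ≡ 0
  letter-beyond {suc x} (s≤s N≤x) = cells-beyond w T N≤x

  initial-agrees : Agrees (regs (initial w T)) (N ∷ 0 ∷ 0 ∷ 0 ∷ 0 ∷ 0 ∷ 0 ∷ 0 ∷ [])
  initial-agrees = agrees λ where
    0F → wrap-< (small (≤-trans (n≤1+n N) (≤-trans (n≤1+n K) (n≤1+n (suc K)))))
    1F → refl
    2F → refl
    3F → refl
    4F → refl
    5F → refl
    6F → refl
    7F → refl

  Outcome : Set
  Outcome = ∃[ t ] ∃[ L ] Enumerates L (MBP T) × Halts w enumerator (initial w T) t (encodeAll L) × t ≤ 10 * unit * (N + totalSize L)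

  report-phase : ∀ {s k d M} →
    Run tabulateBorders ⟨ N ∷ 0 ∷ 0 ∷ 0 ∷ 0 ∷ 0 ∷ 0 ∷ 0 ∷ [] , letter , [] ⟩ (unit * (2 * K + 2) * N + unit + 6)
        ⟨ vars K s k d 0 0 , M , [] ⟩ →
    Tabulated M K K → Outcome
  report-phase {s} {k} {d} {M} tabulate tab = finish (run-reportAll tab)
    where
    L : List Occurrence
    L = map (report-occurrence tab) (leaves tab)
    cost : ℕ
    cost = (unit * (2 * K + 2) * N + unit + 6) + (2 + (unit * ((K + 2) * N + 4 * weight tab (leaves tab)) + unit))
    halted : ∃[ t ] t ≤ cost × Halts w enumerator (initial w T) t (reports tab (leaves tab)) → Outcome
    halted (t , t≤ , h) = t , L , enumerates tab , subst (Halts w enumerator (initial w T) t) (sym (encode-reports tab (leaves tab))) h ,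
      ≤-trans t≤ (total-cost unit N (weight tab (leaves tab)) (totalSize L) (affordable (≤ᵇ⇒≤ 8 120 tt)) 1≤N (quadratic tab)
                   (weight≤totalSize tab (leaves tab)))
    finish : ∃[ ρ ] Run reportAll ⟨ vars K s k d 0 0 , M , [] ⟩ (2 + (unit * ((K + 2) * N + 4 * weight tab (leaves tab)) + unit))
                        ⟨ ρ , M , reports tab (leaves tab) ⟩ → Outcome
    finish (ρ , report) = halted (run-program (run-seq tabulate report) initial-agrees)

  outcome : Outcome
  outcome = start-phase (run-tabulateBorders letter-beyond)
    where
    start-phase : _ → Outcome
    start-phase (_ , _ , _ , _ , tabulate , tab) = report-phase tabulate tab

theorem2 : ∃[ P ] ∀ (m k : ℕ) →
    ∃[ a ] ∀ (b : ℕ) →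
    ∃[ C ] ∀ (N σ w : ℕ) (T : String) →
    1 ≤ N → length T ≡ N →
    σ ≤ m * N ^ k → All (_< σ) T →
    a * bits N ≤ w → w ≤ b * bits N →
    ∃[ t ] ∃[ L ]
    Enumerates L (MBP T) ×
    Halts w P (initial w T) t (encodeAll L) ×
    t ≤ C * (N + totalSize L)
theorem2 = enumerator , λ m k → exponent m k , λ b → 10 * unit , λ where
  N σ w T 1≤N refl σ≤ letters a≤w _ →
    Correctness.outcome w T 1≤N (All.map (λ x<σ → ≤-trans x<σ (≤-trans σ≤ (letters-fit m k w N a≤w))) letters)
      (tables-fit m k w N a≤w)
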